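{- Let $d\in\{1,2\}$. Then every semi-algebraic set $S\subset\mathbb{R}^d$ belongs to $\mathfrak{A}_d$, the set algebra of subsets of $\mathbb{R}^d$ generated by the semigroups in $\mathbb{R}^d$.
   Context: A semigroup in $\mathbb{R}^d$ is a subset of $\mathbb{R}^d$ which is closed under (vector) addition. $\mathfrak{A}_d$ denotes the set algebra generated by all semigroups in $\mathbb{R}^d$, i.e. the smallest family of subsets of $\mathbb{R}^d$ that contains every semigroup and is closed under complement (in $\mathbb{R}^d$), finite union and finite intersection. Semi-algebraic sets are those defined by finite Boolean combinations of polynomial equations and inequalities with real coefficients. -}

module Defs where

open import Algebra.Bundles using (CommutativeRing; Semiring)
import Algebra.Definitions.RawSemiring as RawSemiringDefs
open import Data.List.Base using (List; foldr)
open import Data.Nat.Base using (ℕ)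
open import Data.Product.Base using (∃-syntax; _×_; _,_)
open import Data.Vec.Functional using (Vector; zipWith)
open import Data.Vec.Functional.Relation.Binary.Pointwise using (Pointwise)
open import Level using (0ℓ; suc; _⊔_)
import Relation.Binary.Construct.NonStrictToStrict as ToStrict
open import Relation.Binary.Core using (Rel)
open import Relation.Binary.Definitions using (_Respects_)
open import Relation.Binary.Structures using (IsTotalOrder)
open import Relation.Nullary.Negation using (¬_)
open import Relation.Unary using (Pred; _∈_; _≐_; _∪_; _∩_; ∁; Satisfiable)

-- The axioms of a Dedekind-complete ordered field, which determine ℝ up to a
-- unique isomorphism.
record RealNumbers : Set₁ where
  infix 4 _≤_
  field
    commutativeRing : CommutativeRing 0ℓ 0ℓ

  open CommutativeRing commutativeRing public

  field
    0≉1          : ¬ 0# ≈ 1#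
    inverse      : ∀ x → ¬ x ≈ 0# → ∃[ y ] x * y ≈ 1#
    _≤_          : Rel Carrier 0ℓ
    isTotalOrder : IsTotalOrder _≈_ _≤_
    +-monoˡ-≤    : ∀ {x y} z → x ≤ y → x + z ≤ y + z
    *-nonNeg     : ∀ {x y} → 0# ≤ x → 0# ≤ y → 0# ≤ x * y

  UpperBound : Pred Carrier 0ℓ → Pred Carrier 0ℓ
  UpperBound P u = ∀ {x} → x ∈ P → x ≤ u

  field
    supremum : ∀ (P : Pred Carrier 0ℓ) → Satisfiable P → Satisfiable (UpperBound P) →
               ∃[ s ] s ∈ UpperBound P × (∀ {u} → u ∈ UpperBound P → s ≤ u)

  open ToStrict _≈_ _≤_ public using (_<_)

-- The set algebra generated by a family 𝒢 of subsets of A.  Sets are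
-- predicates, so closure under extensional equality is made explicit.
data SetAlgebra {a ℓ g} {A : Set a} (𝒢 : Pred (Pred A ℓ) g) :
                Pred A ℓ → Set (a ⊔ suc ℓ ⊔ g) where
  generator    : ∀ {X} → X ∈ 𝒢 → SetAlgebra 𝒢 X
  complement   : ∀ {X} → SetAlgebra 𝒢 X → SetAlgebra 𝒢 (∁ X)
  union        : ∀ {X Y} → SetAlgebra 𝒢 X → SetAlgebra 𝒢 Y → SetAlgebra 𝒢 (X ∪ Y)
  intersection : ∀ {X Y} → SetAlgebra 𝒢 X → SetAlgebra 𝒢 Y → SetAlgebra 𝒢 (X ∩ Y)
  resp-≐       : ∀ {X Y} → X ≐ Y → SetAlgebra 𝒢 X → SetAlgebra 𝒢 Y

module Euclidean (ℝ : RealNumbers) (d : ℕ) where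

  open RealNumbers ℝ
  open RawSemiringDefs (Semiring.rawSemiring semiring) using (product; _^_)

  ℝᵈ : Set
  ℝᵈ = Vector Carrier d

  infix 4 _≋_
  _≋_ : Rel ℝᵈ 0ℓ
  _≋_ = Pointwise _≈_

  infixl 6 _⊕_
  _⊕_ : ℝᵈ → ℝᵈ → ℝᵈ
  _⊕_ = zipWith _+_

  -- The equality of ℝᵈ is ≋, so only predicates respecting ≋ are subsets of ℝᵈ.
  -- Requiring this of the generators makes it hold throughout 𝔄.
  record IsSemigroup (X : Pred ℝᵈ 0ℓ) : Set where
    field
      resp-≋ : X Respects _≋_
      closed : ∀ {x y} → x ∈ X → y ∈ X → x ⊕ y ∈ X

  𝔄 : Pred (Pred ℝᵈ 0ℓ) (suc 0ℓ)
  𝔄 = SetAlgebra IsSemigroup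

  -- A polynomial in d variables as a finite sum of terms: (c , α) stands for
  -- c x₁^α₁ ⋯ x_d^α_d.  Multi-indices may repeat.
  Polynomial : Set
  Polynomial = List (Carrier × Vector ℕ d)

  evalTerm : Carrier × Vector ℕ d → ℝᵈ → Carrier
  evalTerm (c , α) x = c * product (zipWith _^_ x α)

  ⟦_⟧ : Polynomial → ℝᵈ → Carrier
  ⟦ p ⟧ x = foldr (λ t s → evalTerm t x + s) 0# p

  data PolynomialCondition : Pred (Pred ℝᵈ 0ℓ) (suc 0ℓ) where
    zero-set     : ∀ p → PolynomialCondition (λ x → ⟦ p ⟧ x ≈ 0#)
    nonneg-set   : ∀ p → PolynomialCondition (λ x → 0# ≤ ⟦ p ⟧ x)
    positive-set : ∀ p → PolynomialCondition (λ x → 0# < ⟦ p ⟧ x)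

  SemiAlgebraic : Pred (Pred ℝᵈ 0ℓ) (suc 0ℓ)
  SemiAlgebraic = SetAlgebra PolynomialCondition

{-# OPTIONS --safe #-}

-- If E is a semigroup, every subset of E ∖ (E + E) lies in the algebra, being
-- the difference of E and another semigroup.  Hence every set in a slab
-- c ≤ x < 2c lies in the algebra, and in the half-plane x > 0 only the germs of
-- a semialgebraic set at x → 0 and x → ∞ matter.
--
-- In the coordinates x and m = y / x of the half-plane, m of a sum is a weighted
-- mean, so a set that is closed upwards in x and closed upwards (or downwards)
-- in m is a semigroup.  It remains to write { P > 0 }, for P a polynomial in x
-- and m and x near 0 or ∞, as a Boolean combination of such monotone sets.  By
-- induction on the degree in m one may take P irreducible over the rational
-- functions of x.  Then P has no zero in common with ∂P/∂m, so between the roots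
-- of ∂P/∂m, which are continuous functions of x, the sign of P is governed by
-- continuous root functions η(x); and P has no zero in common with the reduction
-- of ∂P/∂x modulo P (unless that vanishes), so ∂P/∂x keeps its sign along η and
-- each η is monotone.

module Submission where

open import Defs
open import Axiom.ExcludedMiddle using (ExcludedMiddle)
open import Data.Nat.Base using (ℕ)
open import Data.Sum.Base using (_⊎_)
open import Level using (0ℓ)
open import Relation.Binary.PropositionalEquality using (_≡_)
open import Relation.Unary using (Pred)
open import Data.Product.Base using (∃-syntax; _×_; _,_; proj₁; proj₂)
open import Data.Sum.Base as Sum using (_⊎_; inj₁; inj₂)
open import Data.Empty using (⊥; ⊥-elim)
open import Function.Base using (_∘_; id)
open import Relation.Nullary using (¬_; Dec; yes; no)
open import Relation.Unary using (Pred; _∪_; ∁; ∅; U)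
open import Data.Unit.Base using (⊤; tt)
open import Data.Bool.Base using (Bool; true; false; not; T)
open import Algebra.Bundles using (Semiring)
import Data.Nat.Properties as ℕ
import Relation.Binary.PropositionalEquality.Core as ≡
import Algebra.Definitions.RawSemiring as RawSemiringDefs
open import Algebra.Bundles using (CommutativeRing)

-- Passing to germs makes the coefficients behave like an ordered field: a polynomial in `x` is
-- identically zero or keeps a strict sign on a whole neighbourhood, so leading coefficients can be
-- divided by. The main obstacle is that the zeros of ∂P/∂m, once ordered pointwise by minimum and
-- maximum, are known to be continuous but not monotone, so regions bounded by them are not known to
-- lie in the monotone algebra. The set where P is positive is therefore cut along roots of P alone,
-- and the partial set built above a zero of ∂P/∂m is continued below it with a constant sign.
-- Reducing ∂P/∂x modulo P is forced: its degree in m can equal that of P, while irreducibility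
-- gives coprimality only with polynomials of smaller degree. When the reduction vanishes, ∂P/∂x is
-- zero along every root. Monotonicity of η is implicit differentiation, η′ = -∂x/∂m, carried out
-- with linear bounds whose slope exceeds the expected one by an arbitrarily small amount.

-- Ring normalisation with integer coefficients.

module IntegerSolver {c ℓ} (R : CommutativeRing c ℓ) where

  open import Data.Integer.Base as ℤ using (ℤ; +_; -[1+_])
  import Data.Integer.Properties as ℤ
  open import Data.Maybe.Base using (map)
  open import Data.Nat.Base as ℕ using (ℕ; zero; suc)
  open import Relation.Binary.Consequences using (dec⇒weaklyDec)
  open import Algebra.Solver.Ring.AlmostCommutativeRing
    using (fromCommutativeRing; _-Raw-AlmostCommutative⟶_)
  import Algebra.Solver.Ring as RingSolver

  open CommutativeRing R
  open import Algebra.Properties.Ring ring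
    using (-0#≈0#; -‿distribˡ-*; -‿distribʳ-*; -‿involutive; -‿+-comm)
  open import Algebra.Properties.Semiring.Mult.TCOptimised semiring
    using (×-homo-+; ×1-homo-*; 1+×) renaming (_×_ to _·_)
  open import Relation.Binary.Reasoning.Setoid setoid

  -- Coefficients live in ℤ because cancelling terms such as `x - x` needs a test for zero
  -- coefficients, which an abstract ring does not offer. With the optimised multiple, 1 is
  -- interpreted as `1#` itself and 2 as `1# + 1#`, so `:1` and `:2` match the goals by computation.
  ⟦_⟧ : ℤ → Carrier
  ⟦ + n ⟧      = n · 1#
  ⟦ -[1+ n ] ⟧ = - (suc n · 1#)

  neg-homo : ∀ i → ⟦ ℤ.- i ⟧ ≈ - ⟦ i ⟧
  neg-homo (+ zero)  = sym -0#≈0#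
  neg-homo (+ suc n) = refl
  neg-homo -[1+ n ]  = sym (-‿involutive _)

  ⊖-homo : ∀ m n → ⟦ m ℤ.⊖ n ⟧ ≈ m · 1# + - (n · 1#)
  ⊖-homo m zero = begin
    ⟦ m ℤ.⊖ 0 ⟧       ≡⟨ ≡.cong ⟦_⟧ (ℤ.⊖-≥ {m} ℕ.z≤n) ⟩
    m · 1#            ≈⟨ +-identityʳ _ ⟨
    m · 1# + 0#       ≈⟨ +-congˡ -0#≈0# ⟨
    m · 1# + - 0#     ∎
  ⊖-homo zero (suc n) = sym (+-identityˡ _)
  ⊖-homo (suc m) (suc n) = begin
    ⟦ suc m ℤ.⊖ suc n ⟧                     ≡⟨ ≡.cong ⟦_⟧ (ℤ.[1+m]⊖[1+n]≡m⊖n m n) ⟩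
    ⟦ m ℤ.⊖ n ⟧                             ≈⟨ ⊖-homo m n ⟩
    m · 1# + - (n · 1#)                     ≈⟨ +-congʳ (+-identityˡ _) ⟨
    0# + m · 1# + - (n · 1#)                ≈⟨ +-congʳ (+-congʳ (-‿inverseʳ 1#)) ⟨
    1# + - 1# + m · 1# + - (n · 1#)         ≈⟨ +-congʳ (trans (+-assoc _ _ _) (+-congˡ (+-comm _ _))) ⟩
    1# + (m · 1# + - 1#) + - (n · 1#)       ≈⟨ +-congʳ (+-assoc _ _ _) ⟨
    1# + m · 1# + - 1# + - (n · 1#)         ≈⟨ +-assoc _ _ _ ⟩
    1# + m · 1# + (- 1# + - (n · 1#))       ≈⟨ +-congˡ (-‿+-comm _ _) ⟩
    1# + m · 1# + - (1# + n · 1#)           ≈⟨ +-cong (1+× m 1#) (-‿cong (1+× n 1#)) ⟨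
    suc m · 1# + - (suc n · 1#)             ∎

  +-homo : ∀ i j → ⟦ i ℤ.+ j ⟧ ≈ ⟦ i ⟧ + ⟦ j ⟧
  +-homo (+ m)    (+ n)    = ×-homo-+ 1# m n
  +-homo (+ m)    -[1+ n ] = ⊖-homo m (suc n)
  +-homo -[1+ m ] (+ n)    = trans (⊖-homo n (suc m)) (+-comm _ _)
  +-homo -[1+ m ] -[1+ n ] = begin
    - (suc (suc (m ℕ.+ n)) · 1#)        ≡⟨ ≡.cong (λ k → - (suc k · 1#)) (ℕ.+-suc m n) ⟨
    - ((suc m ℕ.+ suc n) · 1#)          ≈⟨ -‿cong (×-homo-+ 1# (suc m) (suc n)) ⟩
    - (suc m · 1# + suc n · 1#)         ≈⟨ -‿+-comm _ _ ⟨
    - (suc m · 1#) + - (suc n · 1#)     ∎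

  *-homo-pos : ∀ m j → ⟦ + m ℤ.* j ⟧ ≈ m · 1# * ⟦ j ⟧
  *-homo-pos m (+ n) = trans (reflexive (≡.cong ⟦_⟧ (≡.sym (ℤ.pos-* m n)))) (×1-homo-* m n)
  *-homo-pos m -[1+ n ] = begin
    ⟦ + m ℤ.* -[1+ n ] ⟧          ≡⟨ ≡.cong ⟦_⟧ (ℤ.neg-distribʳ-* (+ m) (+ suc n)) ⟨
    ⟦ ℤ.- (+ m ℤ.* + suc n) ⟧     ≈⟨ neg-homo (+ m ℤ.* + suc n) ⟩
    - ⟦ + m ℤ.* + suc n ⟧         ≈⟨ -‿cong (*-homo-pos m (+ suc n)) ⟩
    - (m · 1# * (suc n · 1#))     ≈⟨ -‿distribʳ-* _ _ ⟩
    m · 1# * - (suc n · 1#)       ∎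

  *-homo : ∀ i j → ⟦ i ℤ.* j ⟧ ≈ ⟦ i ⟧ * ⟦ j ⟧
  *-homo (+ m)    j = *-homo-pos m j
  *-homo -[1+ m ] j = begin
    ⟦ -[1+ m ] ℤ.* j ⟧          ≡⟨ ≡.cong ⟦_⟧ (ℤ.neg-distribˡ-* (+ suc m) j) ⟨
    ⟦ ℤ.- (+ suc m ℤ.* j) ⟧     ≈⟨ neg-homo (+ suc m ℤ.* j) ⟩
    - ⟦ + suc m ℤ.* j ⟧         ≈⟨ -‿cong (*-homo-pos (suc m) j) ⟩
    - (suc m · 1# * ⟦ j ⟧)      ≈⟨ -‿distribˡ-* _ _ ⟩
    - (suc m · 1#) * ⟦ j ⟧      ∎

  morphism : ℤ.+-*-rawRing -Raw-AlmostCommutative⟶ fromCommutativeRing R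
  morphism = record
    { ⟦_⟧    = ⟦_⟧
    ; +-homo = +-homo
    ; *-homo = *-homo
    ; -‿homo = neg-homo
    ; 0-homo = refl
    ; 1-homo = refl
    }

  open RingSolver ℤ.+-*-rawRing (fromCommutativeRing R) morphism
    (λ i j → map (λ i≡j → reflexive (≡.cong ⟦_⟧ i≡j)) (dec⇒weaklyDec ℤ._≟_ i j)) public
    using (Polynomial; solve; con; _:=_; _:+_; _:*_; :-_; _:-_)

  :0 :1 :2 : ∀ {n} → Polynomial n
  :0 = con (+ 0)
  :1 = con (+ 1)
  :2 = con (+ 2)

-- Order and arithmetic of the real field.

module OrderedField (em : ExcludedMiddle 0ℓ) (ℝ : RealNumbers) where

  open import Relation.Binary.Structures using (IsTotalOrder)
  import Relation.Binary.Construct.NonStrictToStrict as ToStrict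
  open RealNumbers ℝ

  open IntegerSolver commutativeRing public
    using (solve; _:=_; _:+_; _:*_; :-_; _:-_; :0; :1; :2)

  open import Algebra.Properties.Ring ring public
    using (-0#≈0#; -1*x≈-x; -‿involutive; -‿+-comm; -‿distribˡ-*; -‿distribʳ-*; x[y-z]≈xy-xz; [y-z]x≈yx-zx)

  open IsTotalOrder isTotalOrder public using (antisym; total; ≤-respˡ-≈; ≤-respʳ-≈)
    renaming (refl to ≤-refl; reflexive to ≤-reflexive; trans to ≤-trans)
  open IsTotalOrder isTotalOrder using (isPartialOrder; ≤-resp-≈)

  private module S = ToStrict _≈_ _≤_

  Fun Fun₂ : Set
  Fun  = Carrier → Carrier
  Fun₂ = Carrier → Fun

  <⇒≤ : ∀ {x y} → x < y → x ≤ y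
  <⇒≤ = proj₁

  <-trans : ∀ {x y z} → x < y → y < z → x < z
  <-trans = S.<-trans isPartialOrder

  <-≤-trans : ∀ {x y z} → x < y → y ≤ z → x < z
  <-≤-trans = S.<-≤-trans sym ≤-trans antisym ≤-respʳ-≈

  ≤-<-trans : ∀ {x y z} → x ≤ y → y < z → x < z
  ≤-<-trans = S.≤-<-trans ≤-trans antisym ≤-respˡ-≈

  <-irrefl : ∀ {x} → ¬ x < x
  <-irrefl (_ , x≉x) = x≉x refl

  <⇒≱ : ∀ {x y} → x < y → ¬ y ≤ x
  <⇒≱ = S.<⇒≱ antisym

  <-respʳ : ∀ {x y z} → y ≈ z → x < y → x < z
  <-respʳ = S.<-respʳ-≈ sym trans ≤-respʳ-≈

  <-respˡ : ∀ {x y z} → y ≈ z → y < x → z < x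
  <-respˡ = S.<-respˡ-≈ trans ≤-respˡ-≈

  ≰⇒> : ∀ {x y} → ¬ x ≤ y → y < x
  ≰⇒> = S.≰⇒> sym ≤-reflexive total

  ≤-<-cases : ∀ x y → x ≤ y ⊎ y < x
  ≤-<-cases x y with em {x ≤ y}
  ... | yes x≤y = inj₁ x≤y
  ... | no  x≰y = inj₂ (≰⇒> x≰y)

  data Trichotomy (x y : Carrier) : Set where
    lt : x < y → Trichotomy x y
    eq : x ≈ y → Trichotomy x y
    gt : y < x → Trichotomy x y

  compare : ∀ x y → Trichotomy x y
  compare x y with ≤-<-cases x y | ≤-<-cases y x
  ... | inj₂ y<x | _        = gt y<x
  ... | inj₁ _   | inj₂ x<y = lt x<y
  ... | inj₁ x≤y | inj₁ y≤x = eq (antisym x≤y y≤x)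

  +-mono-≤ : ∀ {a b c d} → a ≤ b → c ≤ d → a + c ≤ b + d
  +-mono-≤ {a} {b} {c} {d} a≤b c≤d = ≤-trans (+-monoˡ-≤ c a≤b)
    (≤-respˡ-≈ (+-comm c b) (≤-respʳ-≈ (+-comm d b) (+-monoˡ-≤ b c≤d)))

  ≤⇒0≤ : ∀ {a b} → a ≤ b → 0# ≤ b - a
  ≤⇒0≤ {a} a≤b = ≤-respˡ-≈ (-‿inverseʳ a) (+-monoˡ-≤ (- a) a≤b)

  0≤⇒≤ : ∀ {a b e} → 0# ≤ e → e ≈ b - a → a ≤ b
  0≤⇒≤ {a} {b} {e} 0≤e e≈ = ≤-respˡ-≈ (+-identityˡ a)
    (≤-respʳ-≈ (trans (+-congʳ e≈) (solve 2 (λ a b → (b :- a) :+ a := b) refl a b))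
      (+-monoˡ-≤ a 0≤e))

  <⇒0< : ∀ {a b} → a < b → 0# < b - a
  <⇒0< {a} {b} (a≤b , a≉b) = ≤⇒0≤ a≤b , λ 0≈ → a≉b
    (trans (sym (+-identityˡ a)) (trans (+-congʳ 0≈) (solve 2 (λ a b → (b :- a) :+ a := b) refl a b)))

  0<⇒< : ∀ {a b e} → 0# < e → e ≈ b - a → a < b
  0<⇒< {a} {b} (0≤e , 0≉e) e≈ = 0≤⇒≤ 0≤e e≈ , λ a≈b → 0≉e
    (sym (trans e≈ (trans (+-congˡ (-‿cong a≈b)) (-‿inverseʳ b))))

  0≤+ : ∀ {a b} → 0# ≤ a → 0# ≤ b → 0# ≤ a + b
  0≤+ 0≤a 0≤b = ≤-respˡ-≈ (+-identityˡ 0#) (+-mono-≤ 0≤a 0≤b)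

  0<+ : ∀ {a b} → 0# < a → 0# ≤ b → 0# < a + b
  0<+ {a} {b} 0<a 0≤b = <-≤-trans 0<a (0≤⇒≤ 0≤b (solve 2 (λ a b → b := (a :+ b) :- a) refl a b))

  abstract
    -- recip 0# = 0#.
    recip : Fun
    recip x with em {x ≈ 0#}
    ... | yes _   = 0#
    ... | no  x≉0 = proj₁ (inverse x x≉0)

    *-recip : ∀ {x} → ¬ x ≈ 0# → x * recip x ≈ 1#
    *-recip {x} x≉0 with em {x ≈ 0#}
    ... | yes x≈0 = ⊥-elim (x≉0 x≈0)
    ... | no  x≉0 = proj₂ (inverse x x≉0)

  *≈0 : ∀ {a b} → a * b ≈ 0# → ¬ a ≈ 0# → b ≈ 0#
  *≈0 {a} {b} ab≈0 a≉0 = trans (sym (*-identityˡ b)) (trans (*-congʳ (sym (*-recip a≉0)))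
    (trans (solve 3 (λ a b r → (a :* r) :* b := r :* (a :* b)) refl a b (recip a))
      (trans (*-congˡ ab≈0) (zeroʳ _))))

  0<⇒≉0 : ∀ {a} → 0# < a → ¬ a ≈ 0#
  0<⇒≉0 (_ , 0≉a) = 0≉a ∘ sym

  0<* : ∀ {a b} → 0# < a → 0# < b → 0# < a * b
  0<* 0<a@(0≤a , _) 0<b@(0≤b , _) =
    *-nonNeg 0≤a 0≤b , λ 0≈ab → 0<⇒≉0 0<b (*≈0 (sym 0≈ab) (0<⇒≉0 0<a))

  neg-pos : ∀ {a} → a < 0# → 0# < - a
  neg-pos {a} a<0 = <-respʳ (+-identityˡ (- a)) (<⇒0< a<0)

  pos-neg : ∀ {a} → 0# < a → - a < 0#
  pos-neg {a} 0<a = 0<⇒< 0<a (solve 1 (λ a → a := :0 :- (:- a)) refl a)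

  neg-pos⁻¹ : ∀ {a} → 0# < - a → a < 0#
  neg-pos⁻¹ {a} 0<-a = 0<⇒< 0<-a (solve 1 (λ a → :- a := :0 :- a) refl a)

  0<1 : 0# < 1#
  0<1 with ≤-<-cases 1# 0#
  ... | inj₂ 0<1 = 0<1
  ... | inj₁ 1≤0 = ⊥-elim (0≉1 (antisym 0≤1 1≤0))
    where
    0≤-1 : 0# ≤ - 1#
    0≤-1 = 0≤⇒≤ (≤⇒0≤ 1≤0) (solve 0 (:0 :- :1 := :- :1 :- :0) refl)
    0≤1 : 0# ≤ 1#
    0≤1 = ≤-respʳ-≈ (solve 0 (:- :1 :* :- :1 := :1) refl) (*-nonNeg 0≤-1 0≤-1)

  2# : Carrier
  2# = 1# + 1#

  0<2 : 0# < 2#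
  0<2 = 0<+ 0<1 (<⇒≤ 0<1)

  0<recip : ∀ {a} → 0# < a → 0# < recip a
  0<recip {a} 0<a with compare (recip a) 0#
  ... | gt p = p
  ... | eq e = ⊥-elim (0≉1 (trans (sym (zeroʳ a)) (trans (*-congˡ (sym e)) (*-recip (0<⇒≉0 0<a)))))
  ... | lt n = ⊥-elim (<-irrefl (<-trans 0<1 (neg-pos⁻¹ (<-respʳ
    (trans (sym (-‿distribʳ-* a (recip a)))
      (-‿cong (*-recip (0<⇒≉0 0<a)))) (0<* 0<a (neg-pos n))))))

  half : Fun
  half a = a * recip 2#

  half-sum : ∀ a → half a + half a ≈ a
  half-sum a = trans (solve 2 (λ a r → a :* r :+ a :* r := (:2 :* r) :* a) refl a (recip 2#))
    (trans (*-congʳ (*-recip (0<⇒≉0 0<2))) (*-identityˡ a))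

  0<half : ∀ {a} → 0# < a → 0# < half a
  0<half 0<a = 0<* 0<a (0<recip 0<2)

  half< : ∀ {a} → 0# < a → half a < a
  half< {a} 0<a = 0<⇒< (0<half 0<a) (trans
    (solve 1 (λ h → h := (h :+ h) :- h) refl (half a)) (+-congʳ (half-sum a)))

  between : ∀ {a b} → a < b → ∃[ c ] a < c × c < b
  between {a} {b} a<b = a + half (b - a)
    , 0<⇒< (0<half (<⇒0< a<b)) (solve 2 (λ a h → h := (a :+ h) :- a) refl a _)
    , 0<⇒< (0<half (<⇒0< a<b)) (trans
        (solve 3 (λ a b h → h := (b :- a) :+ (h :- (b :- a))) refl a b _)
        (trans (+-congˡ (+-congˡ (-‿cong (sym (half-sum (b - a))))))
          (solve 3 (λ a b h → (b :- a) :+ (h :- (h :+ h)) := b :- (a :+ h)) refl a b _)))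

  0≤b-a : ∀ {a b} → a < b → 0# ≤ b - a
  0≤b-a = <⇒≤ ∘ <⇒0<

  infixl 6 _⊓_ _⊔_
  abstract
    _⊓_ _⊔_ : Carrier → Carrier → Carrier
    x ⊓ y = Sum.[ (λ _ → x) , (λ _ → y) ]′ (≤-<-cases x y)
    x ⊔ y = Sum.[ (λ _ → y) , (λ _ → x) ]′ (≤-<-cases x y)

    ⊓≤ˡ : ∀ x y → x ⊓ y ≤ x
    ⊓≤ˡ x y with ≤-<-cases x y
    ... | inj₁ _   = ≤-refl
    ... | inj₂ y<x = <⇒≤ y<x

    ⊓≤ʳ : ∀ x y → x ⊓ y ≤ y
    ⊓≤ʳ x y with ≤-<-cases x y
    ... | inj₁ x≤y = x≤y
    ... | inj₂ _   = ≤-refl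

    ≤⊔ˡ : ∀ x y → x ≤ x ⊔ y
    ≤⊔ˡ x y with ≤-<-cases x y
    ... | inj₁ x≤y = x≤y
    ... | inj₂ _   = ≤-refl

    ≤⊔ʳ : ∀ x y → y ≤ x ⊔ y
    ≤⊔ʳ x y with ≤-<-cases x y
    ... | inj₁ _   = ≤-refl
    ... | inj₂ y<x = <⇒≤ y<x

    ⊓-elim : ∀ {p} (P : Carrier → Set p) {x y} → P x → P y → P (x ⊓ y)
    ⊓-elim P {x} {y} px py with ≤-<-cases x y
    ... | inj₁ _ = px
    ... | inj₂ _ = py

    ⊔-elim : ∀ {p} (P : Carrier → Set p) {x y} → P x → P y → P (x ⊔ y)
    ⊔-elim P {x} {y} px py with ≤-<-cases x y
    ... | inj₁ _ = py
    ... | inj₂ _ = px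

    -- Minimum and maximum branch on the same comparison, so together they permute the two
    -- arguments; the pointwise sorting of root functions rests on this.
    ⊓-⊔-cases : ∀ x y → (x ⊓ y ≈ x × x ⊔ y ≈ y) ⊎ (x ⊓ y ≈ y × x ⊔ y ≈ x)
    ⊓-⊔-cases x y with ≤-<-cases x y
    ... | inj₁ _ = inj₁ (refl , refl)
    ... | inj₂ _ = inj₂ (refl , refl)

  a+b>a : ∀ {a b} → 0# < b → a < a + b
  a+b>a {a} {b} 0<b = 0<⇒< 0<b (solve 2 (λ a b → b := (a :+ b) :- a) refl a b)

  a-b<a : ∀ {a b} → 0# < b → a - b < a
  a-b<a {a} {b} 0<b = 0<⇒< 0<b (solve 2 (λ a b → b := a :- (a :- b)) refl a b)

-- Continuity, connectedness of intervals and differentiability.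

module Calculus (em : ExcludedMiddle 0ℓ) (ℝ : RealNumbers) where

  open OrderedField em ℝ
  open RealNumbers ℝ

  record Small (ε u : Carrier) : Set where
    constructor _,_
    field
      lower : - ε < u
      upper : u < ε
  open Small

  small-resp : ∀ {ε u v} → u ≈ v → Small ε u → Small ε v
  small-resp u≈v (l , r) = <-respʳ u≈v l , <-respˡ u≈v r

  small-≤ : ∀ {ε δ u} → ε ≤ δ → Small ε u → Small δ u
  small-≤ {ε} {δ} ε≤δ (l , r) =
      ≤-<-trans (0≤⇒≤ (≤⇒0≤ ε≤δ) (solve 2 (λ e d → d :- e := :- e :- (:- d)) refl ε δ)) l
    , <-≤-trans r ε≤δ

  small-0 : ∀ {ε} → 0# < ε → Small ε 0#
  small-0 0<ε = pos-neg 0<ε , 0<ε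

  small-neg : ∀ {ε u} → Small ε u → Small ε (- u)
  small-neg {ε} {u} (l , r) =
      0<⇒< (<⇒0< r) (solve 2 (λ e u → e :- u := :- u :- (:- e)) refl ε u)
    , 0<⇒< (<⇒0< l) (solve 2 (λ e u → u :- (:- e) := e :- (:- u)) refl ε u)

  small-self : ∀ {ε u v} → u ≈ v → 0# < ε → Small ε (u - v)
  small-self {v = v} u≈v 0<ε = small-resp
    (trans (sym (-‿inverseʳ v)) (+-congʳ (sym u≈v))) (small-0 0<ε)

  small-+ : ∀ {a b u v} → Small a u → Small b v → Small (a + b) (u + v)
  small-+ {a} {b} {u} {v} (l , r) (l′ , r′) =
      0<⇒< (0<+ (<⇒0< l) (0≤b-a l′))
        (solve 4 (λ a b u v → (u :- (:- a)) :+ (v :- (:- b)) := (u :+ v) :- (:- (a :+ b))) refl a b u v)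
    , 0<⇒< (0<+ (<⇒0< r) (0≤b-a r′))
        (solve 4 (λ a b u v → (a :- u) :+ (b :- v) := (a :+ b) :- (u :+ v)) refl a b u v)

  0<double : ∀ {a} → 0# < a + a → 0# < a
  0<double {a} 0<a+a with ≤-<-cases a 0#
  ... | inj₂ 0<a = 0<a
  ... | inj₁ a≤0 = ⊥-elim (<⇒≱ 0<a+a (≤-respʳ-≈ (+-identityˡ 0#) (+-mono-≤ a≤0 a≤0)))

  -- Twice `a * b - u * v` is `(a - u) * (b + v) + (a + u) * (b - v)`, a sum of positive terms;
  -- hence the detour through `0<double`. The lower bound is the same estimate for `- u`.
  small-* : ∀ {a b u v} → Small a u → Small b v → Small (a * b) (u * v)
  small-* {a} {b} {u} {v} su sv =
      0<⇒< (upper-bound (small-neg su) sv)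
        (solve 4 (λ a b u v → a :* b :- (:- u) :* v := u :* v :- (:- (a :* b))) refl a b u v)
    , 0<⇒< (upper-bound su sv) refl
    where
    upper-bound : ∀ {u} → Small a u → Small b v → 0# < a * b - u * v
    upper-bound {u} (l , r) (l′ , r′) = 0<double (<-respʳ
      (solve 4 (λ a b u v → (a :- u) :* (v :- (:- b)) :+ (u :- (:- a)) :* (b :- v)
                          := (a :* b :- u :* v) :+ (a :* b :- u :* v)) refl a b u v)
      (0<+ (0<* (<⇒0< r) (<⇒0< l′)) (<⇒≤ (0<* (<⇒0< l) (<⇒0< r′)))))

  abstract
    bound : ∀ c → ∃[ B ] 0# < B × Small B c
    bound c = B , 0<B , l , r
      where
      B : Carrier
      B = (c ⊔ - c) + 1#
      r : c < B
      r = ≤-<-trans (≤⊔ˡ c (- c)) (a+b>a 0<1)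
      -c<B : - c < B
      -c<B = ≤-<-trans (≤⊔ʳ c (- c)) (a+b>a 0<1)
      l : - B < c
      l = 0<⇒< (<⇒0< -c<B) (solve 2 (λ B c → B :- (:- c) := c :- (:- B)) refl B c)
      0<B : 0# < B
      0<B = 0<double (<-respʳ (solve 2 (λ B c → (B :- c) :+ (B :- (:- c)) := B :+ B) refl B c)
        (0<+ (<⇒0< r) (0≤b-a -c<B)))

  small-scale : ∀ c {ε} → 0# < ε → ∃[ δ ] 0# < δ × (∀ {u} → Small δ u → Small ε (c * u))
  small-scale c {ε} 0<ε = scale (bound c)
    where
    scale : ∃[ B ] 0# < B × Small B c → ∃[ δ ] 0# < δ × (∀ {u} → Small δ u → Small ε (c * u))
    scale (B , 0<B , sB) = recip B * ε , 0<* (0<recip 0<B) 0<ε , λ su →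
      small-≤ (≤-reflexive Bδ≈ε) (small-* sB su)
      where
      Bδ≈ε : B * (recip B * ε) ≈ ε
      Bδ≈ε = trans (sym (*-assoc _ _ _)) (trans (*-congʳ (*-recip (0<⇒≉0 0<B))) (*-identityˡ ε))

  Near : Pred Carrier 0ℓ → Carrier → Pred Carrier 0ℓ → Set
  Near D s Q = ∃[ δ ] 0# < δ × (∀ u → D u → Small δ (u - s) → Q u)

  near-map : ∀ {D s Q R} → (∀ u → D u → Q u → R u) → Near D s Q → Near D s R
  near-map f (δ , 0<δ , q) = δ , 0<δ , λ u Du su → f u Du (q u Du su)

  near-× : ∀ {D s Q R} → Near D s Q → Near D s R → Near D s (λ u → Q u × R u)
  near-× (δ , 0<δ , q) (δ′ , 0<δ′ , r) = δ ⊓ δ′ , ⊓-elim (0# <_) 0<δ 0<δ′ , λ u Du su →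
    q u Du (small-≤ (⊓≤ˡ δ δ′) su) , r u Du (small-≤ (⊓≤ʳ δ δ′) su)

  near-⊆ : ∀ {D E s Q} → (∀ u → E u → D u) → Near D s Q → Near E s Q
  near-⊆ E⊆D (δ , 0<δ , q) = δ , 0<δ , λ u Eu → q u (E⊆D u Eu)

  near-all : ∀ {D s Q} → (∀ u → D u → Q u) → Near D s Q
  near-all q = 1# , 0<1 , λ u Du _ → q u Du

  Convex : Pred Carrier 0ℓ → Set
  Convex D = ∀ {x y z} → D x → D z → x ≤ y → y ≤ z → D y

  least-upper-bound-approached : ∀ {P : Pred Carrier 0ℓ} {s t} → (∀ {u} → UpperBound P u → s ≤ u) →
                                 t < s → ∃[ p ] P p × t < p
  least-upper-bound-approached {P} {s} {t} least t<s with em {∃[ p ] P p × t < p}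
  ... | yes found = found
  ... | no  none  = ⊥-elim (<⇒≱ t<s (least λ {p} Pp → case-≤ (≤-<-cases p t) Pp))
    where
    case-≤ : ∀ {p} → p ≤ t ⊎ t < p → P p → p ≤ t
    case-≤ (inj₁ p≤t) _ = p≤t
    case-≤ (inj₂ t<p) Pp = ⊥-elim (none (_ , Pp , t<p))

  small-below : ∀ {δ t r} → 0# < δ → r - δ < t → t ≤ r → Small δ (t - r)
  small-below {δ} {t} {r} 0<δ r-δ<t t≤r =
      0<⇒< (<⇒0< r-δ<t) (solve 3 (λ t r d → t :- (r :- d) := (t :- r) :- (:- d)) refl t r δ)
    , ≤-<-trans (0≤⇒≤ (≤⇒0≤ t≤r) (solve 2 (λ t r → r :- t := :0 :- (t :- r)) refl t r)) 0<δ

  small-above : ∀ {δ t r} → 0# < δ → r ≤ t → t ≤ r + half δ → Small δ (t - r)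
  small-above {δ} {t} {r} 0<δ r≤t t≤r+δ/2 =
      <-≤-trans (pos-neg 0<δ) (≤⇒0≤ r≤t)
    , ≤-<-trans (0≤⇒≤ (≤⇒0≤ t≤r+δ/2) (solve 3 (λ t r h → (r :+ h) :- t := h :- (t :- r)) refl t r (half δ)))
        (half< 0<δ)

  -- A connectedness argument: the supremum of the points related to `a` is itself related to `a` by
  -- the left half of the local condition, and the right half leads past it unless it has reached
  -- `b`. Instances yield constancy of sign, strict increase from a positive derivative, and bounds
  -- on growth.
  local⇒global : ∀ (Φ : Carrier → Carrier → Set) {D} → Convex D →
    (∀ {u v w} → D u → D v → D w → Φ u v → Φ v w → Φ u w) →
    (∀ {s} → D s → Near D s (λ u → (u ≤ s → Φ u s) × (s ≤ u → Φ s u))) →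
    ∀ {a b} → D a → D b → a ≤ b → Φ a b
  local⇒global Φ {D} convex Φ-trans local {a} {b} Da Db a≤b =
    from-supremum (supremum P (a , a∈P) (b , λ (_ , t≤b , _) → t≤b))
    where
    P : Pred Carrier 0ℓ
    P t = a ≤ t × t ≤ b × Φ a t

    a∈P : P a
    a∈P with local Da
    ... | δ , 0<δ , q = ≤-refl , a≤b , proj₁ (q a Da (small-self refl 0<δ)) ≤-refl

    from-supremum : ∃[ s ] UpperBound P s × (∀ {u} → UpperBound P u → s ≤ u) → Φ a b
    from-supremum (s , bounded , least) = conclude (≤-<-cases b s)
      where
      a≤s : a ≤ s
      a≤s = bounded a∈P
      s≤b : s ≤ b
      s≤b = least λ (_ , t≤b , _) → t≤b
      Ds : D s
      Ds = convex Da Db a≤s s≤b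

      -- Here `r` is `≈ s`, but `Φ` is not assumed to respect `≈`, so the local condition is taken
      -- at `r` itself; the uses are `r = b` and `r = s`.
      reach : ∀ {r} → s ≤ r → r ≤ b → r ≤ s → Φ a r
      reach {r} s≤r r≤b r≤s with local (convex Da Db (≤-trans a≤s s≤r) r≤b)
      ... | δ , 0<δ , q with least-upper-bound-approached {P} {t = r - δ} least (<-≤-trans (a-b<a 0<δ) r≤s)
      ... | t , t∈P@(a≤t , t≤b , Φat) , r-δ<t =
        Φ-trans Da Dt (convex Da Db (≤-trans a≤s s≤r) r≤b) Φat
          (proj₁ (q t Dt (small-below 0<δ r-δ<t t≤r)) t≤r)
        where
        Dt : D t
        Dt = convex Da Db a≤t t≤b
        t≤r : t ≤ r
        t≤r = ≤-trans (bounded t∈P) s≤r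

      conclude : b ≤ s ⊎ s < b → Φ a b
      conclude (inj₁ b≤s) = reach s≤b ≤-refl b≤s
      conclude (inj₂ s<b) with local Ds
      ... | δ , 0<δ , q = ⊥-elim (<⇒≱ s<v (bounded (a≤v , v≤b , Φ-trans Da Ds Dv (reach ≤-refl s≤b ≤-refl)
              (proj₂ (q v Dv (small-above 0<δ (<⇒≤ s<v) (⊓≤ʳ b (s + half δ)))) (<⇒≤ s<v)))))
        where
        v : Carrier
        v = b ⊓ (s + half δ)
        s<v : s < v
        s<v = ⊓-elim (s <_) s<b (a+b>a (0<half 0<δ))
        v≤b : v ≤ b
        v≤b = ⊓≤ˡ b (s + half δ)
        a≤v : a ≤ v
        a≤v = ≤-trans a≤s (<⇒≤ s<v)
        Dv : D v
        Dv = convex Da Db a≤v v≤b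

  -- The trace of continuity that sign arguments consume: both strict signs are open conditions, and
  -- nothing is demanded at zeros.
  SignLocal : Fun → Pred Carrier 0ℓ → Set
  SignLocal f D = ∀ {s} → D s →
    (0# < f s → Near D s (λ u → 0# < f u)) × (f s < 0# → Near D s (λ u → f u < 0#))

  signLocal-neg : ∀ {f D} → SignLocal f D → SignLocal (λ x → - f x) D
  signLocal-neg local Ds =
      (λ 0<-f → near-map (λ _ _ → neg-pos) (proj₂ (local Ds) (neg-pos⁻¹ 0<-f)))
    , (λ -f<0 → near-map (λ _ _ → pos-neg) (proj₁ (local Ds)
        (<-respʳ (-‿involutive _) (neg-pos -f<0))))

  constant-sign-≤ : ∀ {f D} → Convex D → SignLocal f D → (∀ {s} → D s → ¬ f s ≈ 0#) →
                    ∀ {a b} → D a → D b → a ≤ b → 0# < f a → 0# < f b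
  constant-sign-≤ {f} {D} convex signLocal f≉0 =
    local⇒global (λ u v → 0# < f u → 0# < f v) convex (λ _ _ _ p q → q ∘ p) local
    where
    local : ∀ {s} → D s → Near D s (λ u → (u ≤ s → 0# < f u → 0# < f s) × (s ≤ u → 0# < f s → 0# < f u))
    local {s} Ds with compare (f s) 0#
    ... | eq f≈0 = ⊥-elim (f≉0 Ds f≈0)
    ... | gt 0<f = near-map (λ _ _ p → (λ _ _ → 0<f) , (λ _ _ → p)) (proj₁ (signLocal Ds) 0<f)
    -- Where `f` is negative, both implications hold because their premises fail.
    ... | lt f<0 = near-map (λ _ _ n → (λ _ p → ⊥-elim (<-irrefl (<-trans n p)))
                                     , (λ _ p → ⊥-elim (<-irrefl (<-trans f<0 p)))) (proj₂ (signLocal Ds) f<0)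

  constant-sign : ∀ {f D} → Convex D → SignLocal f D → (∀ {s} → D s → ¬ f s ≈ 0#) →
                  ∀ {a b} → D a → D b → 0# < f a → 0# < f b
  constant-sign {f} convex signLocal f≉0 {a} {b} Da Db 0<fa with total a b
  ... | inj₁ a≤b = constant-sign-≤ convex signLocal f≉0 Da Db a≤b 0<fa
  ... | inj₂ b≤a with compare (f b) 0#
  ...   | gt 0<fb = 0<fb
  ...   | eq fb≈0 = ⊥-elim (f≉0 Db fb≈0)
  ...   | lt fb<0 = ⊥-elim (<-irrefl (<-trans 0<fa (neg-pos⁻¹
    (constant-sign-≤ convex (signLocal-neg signLocal)
      (λ Ds -f≈0 → f≉0 Ds (trans (sym (-‿involutive _)) (trans (-‿cong -f≈0) -0#≈0#)))
      Db Da b≤a (neg-pos fb<0)))))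

  constant-sign-cases : ∀ {f D} → Convex D → SignLocal f D → (∀ {s} → D s → ¬ f s ≈ 0#) →
                        (∀ {s} → D s → 0# < f s) ⊎ (∀ {s} → D s → f s < 0#)
  constant-sign-cases {f} {D} convex signLocal f≉0 with em {∃[ s ] D s × 0# < f s}
  ... | yes (_ , Ds , 0<f) = inj₁ λ Du → constant-sign convex signLocal f≉0 Ds Du 0<f
  ... | no  none = inj₂ λ {s} Ds → negative s Ds
    where
    negative : ∀ s → D s → f s < 0#
    negative s Ds with compare (f s) 0#
    ... | lt n = n
    ... | eq z = ⊥-elim (f≉0 Ds z)
    ... | gt p = ⊥-elim (none (s , Ds , p))

  Interval : Carrier → Carrier → Pred Carrier 0ℓ
  Interval a b x = a ≤ x × x ≤ b

  interval-convex : ∀ {a b} → Convex (Interval a b)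
  interval-convex (a≤x , _) (_ , z≤b) x≤y y≤z = ≤-trans a≤x x≤y , ≤-trans y≤z z≤b

  intermediate-value : ∀ {f a b} → a ≤ b → SignLocal f (Interval a b) → f a < 0# → 0# < f b →
                       ∃[ c ] Interval a b c × f c ≈ 0#
  intermediate-value {f} {a} {b} a≤b signLocal fa<0 0<fb with em {∃[ c ] Interval a b c × f c ≈ 0#}
  ... | yes found = found
  ... | no  none  = ⊥-elim (<-irrefl (<-trans fa<0
    (constant-sign interval-convex signLocal (λ I z → none (_ , I , z)) (a≤b , ≤-refl) (≤-refl , a≤b) 0<fb)))

  Near₂ : Carrier → Carrier → (Carrier → Carrier → Set) → Set
  Near₂ x₀ m₀ Q = ∃[ δ ] 0# < δ × (∀ x m → Small δ (x - x₀) → Small δ (m - m₀) → Q x m)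

  near₂-map : ∀ {x₀ m₀ Q R} → (∀ x m → Q x m → R x m) → Near₂ x₀ m₀ Q → Near₂ x₀ m₀ R
  near₂-map f (δ , 0<δ , q) = δ , 0<δ , λ x m sx sm → f x m (q x m sx sm)

  near₂-× : ∀ {x₀ m₀ Q R} → Near₂ x₀ m₀ Q → Near₂ x₀ m₀ R → Near₂ x₀ m₀ (λ x m → Q x m × R x m)
  near₂-× (δ , 0<δ , q) (δ′ , 0<δ′ , r) = δ ⊓ δ′ , ⊓-elim (0# <_) 0<δ 0<δ′ , λ x m sx sm →
      q x m (small-≤ (⊓≤ˡ δ δ′) sx) (small-≤ (⊓≤ˡ δ δ′) sm)
    , r x m (small-≤ (⊓≤ʳ δ δ′) sx) (small-≤ (⊓≤ʳ δ δ′) sm)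

  record Continuous₂ (x₀ m₀ : Carrier) (F : Fun₂) : Set where
    field
      near : ∀ {ε} → 0# < ε → Near₂ x₀ m₀ (λ x m → Small ε (F x m - F x₀ m₀))
  open Continuous₂

  module _ {x₀ m₀ : Carrier} where

    continuous-resp : ∀ {F G} → (∀ x m → F x m ≈ G x m) → Continuous₂ x₀ m₀ F → Continuous₂ x₀ m₀ G
    continuous-resp F≈G cF .near 0<ε =
      near₂-map (λ x m → small-resp (+-cong (F≈G x m) (-‿cong (F≈G x₀ m₀)))) (cF .near 0<ε)

    continuous-const : ∀ c → Continuous₂ x₀ m₀ (λ _ _ → c)
    continuous-const c .near 0<ε = 1# , 0<1 , λ _ _ _ _ → small-self refl 0<ε

    continuous-x : Continuous₂ x₀ m₀ (λ x _ → x)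
    continuous-x .near 0<ε = _ , 0<ε , λ _ _ sx _ → sx

    continuous-m : Continuous₂ x₀ m₀ (λ _ m → m)
    continuous-m .near 0<ε = _ , 0<ε , λ _ _ _ sm → sm

    continuous-+ : ∀ {F G} → Continuous₂ x₀ m₀ F → Continuous₂ x₀ m₀ G →
                   Continuous₂ x₀ m₀ (λ x m → F x m + G x m)
    continuous-+ {F} {G} cF cG .near {ε} 0<ε = near₂-map
      (λ x m (sF , sG) → small-≤ (≤-reflexive (half-sum ε)) (small-resp
        (regroup (F x m) (F x₀ m₀) (G x m) (G x₀ m₀)) (small-+ sF sG)))
      (near₂-× (cF .near (0<half 0<ε)) (cG .near (0<half 0<ε)))
      where
      regroup : ∀ a b c d → (a - b) + (c - d) ≈ (a + c) - (b + d)
      regroup = solve 4 (λ a b c d → (a :- b) :+ (c :- d) := (a :+ c) :- (b :+ d)) refl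

    continuous-scale : ∀ c {F} → Continuous₂ x₀ m₀ F → Continuous₂ x₀ m₀ (λ x m → c * F x m)
    continuous-scale c {F} cF .near {ε} 0<ε = rescale (small-scale c 0<ε)
      where
      rescale : ∃[ δ ] 0# < δ × (∀ {u} → Small δ u → Small ε (c * u)) →
                Near₂ x₀ m₀ (λ x m → Small ε (c * F x m - c * F x₀ m₀))
      rescale (δ , 0<δ , scale) = near₂-map
        (λ x m s → small-resp (x[y-z]≈xy-xz c (F x m) (F x₀ m₀)) (scale s)) (cF .near 0<δ)

    -- Expanding around the base point leaves `(F - F₀) * (G - G₀)` plus terms already continuous.
    -- That product is small because one factor is kept below 1 and the other below `ε`.
    continuous-* : ∀ {F G} → Continuous₂ x₀ m₀ F → Continuous₂ x₀ m₀ G →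
                   Continuous₂ x₀ m₀ (λ x m → F x m * G x m)
    continuous-* {F} {G} cF cG =
      continuous-resp {F = λ x m → (F x m - F x₀ m₀) * (G x m - G x₀ m₀)
          + ((F x₀ m₀ * G x m + G x₀ m₀ * F x m) + - (F x₀ m₀ * G x₀ m₀))}
        (λ x m → expand (F x m) (G x m) (F x₀ m₀) (G x₀ m₀))
        (continuous-+ product (continuous-+
          (continuous-+ (continuous-scale (F x₀ m₀) cG) (continuous-scale (G x₀ m₀) cF))
          (continuous-const (- (F x₀ m₀ * G x₀ m₀)))))
      where
      expand : ∀ f g f₀ g₀ → (f - f₀) * (g - g₀) + ((f₀ * g + g₀ * f) + - (f₀ * g₀)) ≈ f * g
      expand = solve 4 (λ f g f₀ g₀ → (f :- f₀) :* (g :- g₀) :+ ((f₀ :* g :+ g₀ :* f) :+ (:- (f₀ :* g₀)))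
                                    := f :* g) refl
      vanishes : ∀ u f g → u ≈ u - (f - f) * (g - g)
      vanishes = solve 3 (λ u f g → u := u :- (f :- f) :* (g :- g)) refl
      product : Continuous₂ x₀ m₀ (λ x m → (F x m - F x₀ m₀) * (G x m - G x₀ m₀))
      product .near {ε} 0<ε = near₂-map (λ x m (sF , sG) → small-≤ (≤-reflexive (*-identityˡ ε))
        (small-resp (vanishes _ (F x₀ m₀) (G x₀ m₀)) (small-* sF sG)))
        (near₂-× (cF .near 0<1) (cG .near 0<ε))

    continuous-positive : ∀ {F} → Continuous₂ x₀ m₀ F → 0# < F x₀ m₀ → Near₂ x₀ m₀ (λ x m → 0# < F x m)
    continuous-positive {F} cF 0<F₀ = near₂-map
      (λ x m s → 0<⇒< (<⇒0< (lower s)) (cancel (F x m) (F x₀ m₀))) (cF .near 0<F₀)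
      where
      cancel : ∀ f f₀ → (f - f₀) - (- f₀) ≈ f - 0#
      cancel = solve 2 (λ f f₀ → (f :- f₀) :- (:- f₀) := f :- :0) refl

    continuous-neg : ∀ {F} → Continuous₂ x₀ m₀ F → Continuous₂ x₀ m₀ (λ x m → - F x m)
    continuous-neg {F} cF = continuous-resp (λ x m → -1*x≈-x (F x m)) (continuous-scale (- 1#) cF)

    continuous-negative : ∀ {F} → Continuous₂ x₀ m₀ F → F x₀ m₀ < 0# → Near₂ x₀ m₀ (λ x m → F x m < 0#)
    continuous-negative {F} cF F₀<0 =
      near₂-map (λ _ _ → neg-pos⁻¹) (continuous-positive (continuous-neg cF) (neg-pos F₀<0))

  -- Carathéodory's form of differentiability.
  record Slopes (F : Fun₂) (x₀ m₀ p q : Carrier) : Set where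
    field
      A B    : Fun₂
      A-cont : Continuous₂ x₀ m₀ A
      B-cont : Continuous₂ x₀ m₀ B
      expand : ∀ x m → F x m ≈ F x₀ m₀ + ((x - x₀) * A x m + (m - m₀) * B x m)
      A₀     : A x₀ m₀ ≈ p
      B₀     : B x₀ m₀ ≈ q

  record Derivative (F Fx Fm : Fun₂) : Set where
    field
      slopes : ∀ x₀ m₀ → Slopes F x₀ m₀ (Fx x₀ m₀) (Fm x₀ m₀)
  open Derivative

  derivative-resp : ∀ {F G Fx Fm Gx Gm} → (∀ x m → F x m ≈ G x m) → (∀ x m → Fx x m ≈ Gx x m) →
                    (∀ x m → Fm x m ≈ Gm x m) → Derivative F Fx Fm → Derivative G Gx Gm
  derivative-resp F≈G Fx≈Gx Fm≈Gm dF .slopes x₀ m₀ = record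
    { A = A ; B = B ; A-cont = A-cont ; B-cont = B-cont
    ; expand = λ x m → trans (sym (F≈G x m)) (trans (expand x m) (+-congʳ (F≈G x₀ m₀)))
    ; A₀ = trans A₀ (Fx≈Gx x₀ m₀)
    ; B₀ = trans B₀ (Fm≈Gm x₀ m₀)
    }
    where open Slopes (dF .slopes x₀ m₀)

  derivative-const : ∀ c → Derivative (λ _ _ → c) (λ _ _ → 0#) (λ _ _ → 0#)
  derivative-const c .slopes x₀ m₀ = record
    { A = λ _ _ → 0# ; B = λ _ _ → 0# ; A-cont = continuous-const 0# ; B-cont = continuous-const 0#
    ; expand = λ x m → identity c (x - x₀) (m - m₀) ; A₀ = refl ; B₀ = refl
    }
    where
    identity : ∀ c u v → c ≈ c + (u * 0# + v * 0#)
    identity = solve 3 (λ c u v → c := c :+ (u :* :0 :+ v :* :0)) refl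

  derivative-x : Derivative (λ x _ → x) (λ _ _ → 1#) (λ _ _ → 0#)
  derivative-x .slopes x₀ m₀ = record
    { A = λ _ _ → 1# ; B = λ _ _ → 0# ; A-cont = continuous-const 1# ; B-cont = continuous-const 0#
    ; expand = λ x m → identity x x₀ (m - m₀) ; A₀ = refl ; B₀ = refl
    }
    where
    identity : ∀ x x₀ v → x ≈ x₀ + ((x - x₀) * 1# + v * 0#)
    identity = solve 3 (λ x x₀ v → x := x₀ :+ ((x :- x₀) :* :1 :+ v :* :0)) refl

  derivative-m : Derivative (λ _ m → m) (λ _ _ → 0#) (λ _ _ → 1#)
  derivative-m .slopes x₀ m₀ = record
    { A = λ _ _ → 0# ; B = λ _ _ → 1# ; A-cont = continuous-const 0# ; B-cont = continuous-const 1#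
    ; expand = λ x m → identity m m₀ (x - x₀) ; A₀ = refl ; B₀ = refl
    }
    where
    identity : ∀ m m₀ u → m ≈ m₀ + (u * 0# + (m - m₀) * 1#)
    identity = solve 3 (λ m m₀ u → m := m₀ :+ (u :* :0 :+ (m :- m₀) :* :1)) refl

  derivative-+ : ∀ {F Fx Fm G Gx Gm} → Derivative F Fx Fm → Derivative G Gx Gm →
    Derivative (λ x m → F x m + G x m) (λ x m → Fx x m + Gx x m) (λ x m → Fm x m + Gm x m)
  derivative-+ {F} {G = G} dF dG .slopes x₀ m₀ = record
    { A = λ x m → S.A x m + T.A x m
    ; B = λ x m → S.B x m + T.B x m
    ; A-cont = continuous-+ S.A-cont T.A-cont
    ; B-cont = continuous-+ S.B-cont T.B-cont
    ; expand = λ x m → trans (+-cong (S.expand x m) (T.expand x m))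
        (regroup (F x₀ m₀) (x - x₀) (S.A x m) (m - m₀) (S.B x m) (G x₀ m₀) (T.A x m) (T.B x m))
    ; A₀ = +-cong S.A₀ T.A₀
    ; B₀ = +-cong S.B₀ T.B₀
    }
    where
    module S = Slopes (dF .slopes x₀ m₀)
    module T = Slopes (dG .slopes x₀ m₀)
    regroup : ∀ f u a v b g c d → (f + (u * a + v * b)) + (g + (u * c + v * d))
                                ≈ (f + g) + (u * (a + c) + v * (b + d))
    regroup = solve 8 (λ f u a v b g c d → (f :+ (u :* a :+ v :* b)) :+ (g :+ (u :* c :+ v :* d))
                                        := (f :+ g) :+ (u :* (a :+ c) :+ v :* (b :+ d))) refl

  continuous-derivative : ∀ {F Fx Fm} → Derivative F Fx Fm → ∀ x₀ m₀ → Continuous₂ x₀ m₀ F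
  continuous-derivative {F} dF x₀ m₀ = continuous-resp (λ x m → sym (expand x m))
    (continuous-+ (continuous-const (F x₀ m₀)) (continuous-+
      (continuous-* (continuous-+ continuous-x (continuous-const (- x₀))) A-cont)
      (continuous-* (continuous-+ continuous-m (continuous-const (- m₀))) B-cont)))
    where open Slopes (dF .slopes x₀ m₀)

  derivative-* : ∀ {F Fx Fm G Gx Gm} → Derivative F Fx Fm → Derivative G Gx Gm →
    Derivative (λ x m → F x m * G x m)
      (λ x m → F x m * Gx x m + G x m * Fx x m) (λ x m → F x m * Gm x m + G x m * Fm x m)
  derivative-* {F} {G = G} dF dG .slopes x₀ m₀ = record
    -- From `F G - F₀ G₀ = F (G - G₀) + G₀ (F - F₀)`; one factor stays at the moving point, hence
    -- the appeal to `F-cont`.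
    { A = λ x m → F x m * T.A x m + G x₀ m₀ * S.A x m
    ; B = λ x m → F x m * T.B x m + G x₀ m₀ * S.B x m
    ; A-cont = continuous-+ (continuous-* F-cont T.A-cont) (continuous-scale (G x₀ m₀) S.A-cont)
    ; B-cont = continuous-+ (continuous-* F-cont T.B-cont) (continuous-scale (G x₀ m₀) S.B-cont)
    ; expand = λ x m → trans (*-congˡ (T.expand x m))
        (trans (distribˡ (F x m) (G x₀ m₀) ((x - x₀) * T.A x m + (m - m₀) * T.B x m))
        (trans (+-congʳ (*-congʳ (S.expand x m)))
        (regroup (F x m) (F x₀ m₀) (G x₀ m₀) (x - x₀) (m - m₀) (S.A x m) (S.B x m) (T.A x m) (T.B x m))))
    ; A₀ = +-cong (*-congˡ T.A₀) (*-congˡ S.A₀)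
    ; B₀ = +-cong (*-congˡ T.B₀) (*-congˡ S.B₀)
    }
    where
    module S = Slopes (dF .slopes x₀ m₀)
    module T = Slopes (dG .slopes x₀ m₀)
    F-cont : Continuous₂ x₀ m₀ F
    F-cont = continuous-derivative dF x₀ m₀
    inner : ∀ f u v c d → f * (u * c + v * d) ≈ u * (f * c) + v * (f * d)
    inner = solve 5 (λ f u v c d → f :* (u :* c :+ v :* d) := u :* (f :* c) :+ v :* (f :* d)) refl
    outer : ∀ f₀ g₀ u v a b → (f₀ + (u * a + v * b)) * g₀ ≈ f₀ * g₀ + (u * (g₀ * a) + v * (g₀ * b))
    outer = solve 6 (λ f₀ g₀ u v a b → (f₀ :+ (u :* a :+ v :* b)) :* g₀
                                    := f₀ :* g₀ :+ (u :* (g₀ :* a) :+ v :* (g₀ :* b))) refl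
    collect : ∀ h u v p q r s → (h + (u * p + v * q)) + (u * r + v * s) ≈ h + (u * (r + p) + v * (s + q))
    collect = solve 7 (λ h u v p q r s → (h :+ (u :* p :+ v :* q)) :+ (u :* r :+ v :* s)
                                      := h :+ (u :* (r :+ p) :+ v :* (s :+ q))) refl
    regroup : ∀ f f₀ g₀ u v a b c d → (f₀ + (u * a + v * b)) * g₀ + f * (u * c + v * d)
            ≈ f₀ * g₀ + (u * (f * c + g₀ * a) + v * (f * d + g₀ * b))
    regroup f f₀ g₀ u v a b c d = trans (+-cong (outer f₀ g₀ u v a b) (inner f u v c d))
      (collect (f₀ * g₀) u v (g₀ * a) (g₀ * b) (f * c) (f * d))

  derivative-neg : ∀ {F Fx Fm} → Derivative F Fx Fm →
                   Derivative (λ x m → - F x m) (λ x m → - Fx x m) (λ x m → - Fm x m)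
  derivative-neg {F} {Fx} {Fm} dF = derivative-resp
    (λ x m → -1*x≈-x (F x m)) (λ x m → ∂≈ (F x m) (Fx x m)) (λ x m → ∂≈ (F x m) (Fm x m))
    (derivative-* (derivative-const (- 1#)) dF)
    where
    ∂≈ : ∀ f g → - 1# * g + f * 0# ≈ - g
    ∂≈ = solve 2 (λ f g → (:- :1) :* g :+ f :* :0 := :- g) refl

  -- Along direction `(d , e)` the increment is `h` times `d * A + e * B`, a continuous function
  -- that is positive at the base point, so near it the increment has the sign of `h`. The vertical
  -- direction serves slices, the directions `(1 , e)` and `(-1 , e)` serve the tracing of roots.
  directional : ∀ {F Fx Fm} → Derivative F Fx Fm → ∀ x₀ m₀ d e → 0# < d * Fx x₀ m₀ + e * Fm x₀ m₀ →
    ∃[ δ ] 0# < δ × (∀ {h x m} → Small δ h → x - x₀ ≈ d * h → m - m₀ ≈ e * h →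
                     (0# < h → F x₀ m₀ < F x m) × (h < 0# → F x m < F x₀ m₀))
  directional {F} dF x₀ m₀ d e 0<slope = conclude (small-scale d 0<δ) (small-scale e 0<δ)
    where
    open Slopes (dF .slopes x₀ m₀)
    nearby : Near₂ x₀ m₀ (λ x m → 0# < d * A x m + e * B x m)
    nearby = continuous-positive (continuous-+ (continuous-scale d A-cont) (continuous-scale e B-cont))
      (<-respʳ (+-cong (*-congˡ (sym A₀)) (*-congˡ (sym B₀))) 0<slope)
    δ : Carrier
    δ = proj₁ nearby
    0<δ : 0# < δ
    0<δ = proj₁ (proj₂ nearby)
    factor : ∀ f₀ a b h → h * (d * a + e * b) ≈ (f₀ + ((d * h) * a + (e * h) * b)) - f₀
    factor f₀ a b h = solve 6 (λ f₀ a b h d e → h :* (d :* a :+ e :* b)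
      := (f₀ :+ ((d :* h) :* a :+ (e :* h) :* b)) :- f₀) refl f₀ a b h d e
    flip : ∀ a b → - (a - b) ≈ b - a
    flip = solve 2 (λ a b → :- (a :- b) := b :- a) refl
    conclude : ∃[ δ₁ ] 0# < δ₁ × (∀ {u} → Small δ₁ u → Small δ (d * u)) →
               ∃[ δ₂ ] 0# < δ₂ × (∀ {u} → Small δ₂ u → Small δ (e * u)) →
               ∃[ δ′ ] 0# < δ′ × (∀ {h x m} → Small δ′ h → x - x₀ ≈ d * h → m - m₀ ≈ e * h →
                 (0# < h → F x₀ m₀ < F x m) × (h < 0# → F x m < F x₀ m₀))
    conclude (δ₁ , 0<δ₁ , q₁) (δ₂ , 0<δ₂ , q₂) =
      δ₁ ⊓ δ₂ , ⊓-elim (0# <_) 0<δ₁ 0<δ₂ , λ {h} {x} {m} → increase h x m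
      where
      increase : ∀ h x m → Small (δ₁ ⊓ δ₂) h → x - x₀ ≈ d * h → m - m₀ ≈ e * h →
                 (0# < h → F x₀ m₀ < F x m) × (h < 0# → F x m < F x₀ m₀)
      increase h x m sh x≈ m≈ =
          (λ 0<h → 0<⇒< (0<* 0<h slope) product)
        , (λ h<0 → 0<⇒< (0<* (neg-pos h<0) slope)
            (trans (sym (-‿distribˡ-* h (d * A x m + e * B x m))) (trans (-‿cong product) (flip (F x m) (F x₀ m₀)))))
        where
        slope : 0# < d * A x m + e * B x m
        slope = proj₂ (proj₂ nearby) x m (small-resp (sym x≈) (q₁ (small-≤ (⊓≤ˡ δ₁ δ₂) sh)))
                                         (small-resp (sym m≈) (q₂ (small-≤ (⊓≤ʳ δ₁ δ₂) sh)))
        product : h * (d * A x m + e * B x m) ≈ F x m - F x₀ m₀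
        product = trans (factor (F x₀ m₀) (A x m) (B x m) h)
          (+-congʳ (sym (trans (expand x m) (+-congˡ (+-cong (*-congʳ x≈) (*-congʳ m≈))))))

-- Polynomial functions of x and m.

module Polynomials (em : ExcludedMiddle 0ℓ) (ℝ : RealNumbers) where

  import Algebra.Properties.Semiring.Exp as Exp
  open import Data.Nat.Base as ℕ using (ℕ; zero; suc; pred)
  open OrderedField em ℝ
  open Calculus em ℝ
  open RealNumbers ℝ renaming (zero to *-zero)
  open RawSemiringDefs (Semiring.rawSemiring semiring) using (_^_) renaming (_×_ to _·_)
  open Exp semiring using (^-congˡ)

  -- A Horner scheme certifying a function. The objects are functions, not coefficient lists, so
  -- `nil` means vanishing as a function, and the same function may have several certificates.
  data PolyX : Fun → Set where
    nil  : ∀ {f} → (∀ x → f x ≈ 0#) → PolyX f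
    cons : ∀ {f g} c → PolyX g → (∀ x → f x ≈ c + x * g x) → PolyX f

  polyX-resp : ∀ {f g} → (∀ x → f x ≈ g x) → PolyX f → PolyX g
  polyX-resp f≈g (nil f≈0)      = nil λ x → trans (sym (f≈g x)) (f≈0 x)
  polyX-resp f≈g (cons c p f≈) = cons c p λ x → trans (sym (f≈g x)) (f≈ x)

  polyX-0 : PolyX (λ _ → 0#)
  polyX-0 = nil λ _ → refl

  polyX-const : ∀ c → PolyX (λ _ → c)
  polyX-const c = cons c polyX-0 λ x → solve 2 (λ c x → c := c :+ x :* :0) refl c x

  polyX-shift : ∀ {f} → PolyX f → PolyX (λ x → x * f x)
  polyX-shift p = cons 0# p λ x → sym (+-identityˡ _)

  polyX-x : PolyX (λ x → x)
  polyX-x = polyX-resp (λ x → *-identityʳ x) (polyX-shift (polyX-const 1#))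

  polyX-+ : ∀ {f g} → PolyX f → PolyX g → PolyX (λ x → f x + g x)
  polyX-+ (nil f≈0) q = polyX-resp (λ x → trans (sym (+-identityˡ _)) (+-congʳ (sym (f≈0 x)))) q
  polyX-+ p@(cons _ _ _) (nil g≈0) = polyX-resp (λ x → trans (sym (+-identityʳ _)) (+-congˡ (sym (g≈0 x)))) p
  polyX-+ (cons c p f≈) (cons d q g≈) = cons (c + d) (polyX-+ p q) λ x →
    trans (+-cong (f≈ x) (g≈ x)) (regroup c d x _ _)
    where
    regroup : ∀ c d x u v → (c + x * u) + (d + x * v) ≈ (c + d) + x * (u + v)
    regroup = solve 5 (λ c d x u v → (c :+ x :* u) :+ (d :+ x :* v) := (c :+ d) :+ x :* (u :+ v)) refl

  polyX-scale : ∀ c {f} → PolyX f → PolyX (λ x → c * f x)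
  polyX-scale c (nil f≈0) = nil λ x → trans (*-congˡ (f≈0 x)) (zeroʳ c)
  polyX-scale c (cons d p f≈) = cons (c * d) (polyX-scale c p) λ x →
    trans (*-congˡ (f≈ x)) (regroup c d x _)
    where
    regroup : ∀ c d x u → c * (d + x * u) ≈ c * d + x * (c * u)
    regroup = solve 4 (λ c d x u → c :* (d :+ x :* u) := c :* d :+ x :* (c :* u)) refl

  polyX-* : ∀ {f g} → PolyX f → PolyX g → PolyX (λ x → f x * g x)
  polyX-* (nil f≈0) q = nil λ x → trans (*-congʳ (f≈0 x)) (zeroˡ _)
  polyX-* (cons c p f≈) q = polyX-resp
    (λ x → trans (regroup c x _ _) (*-congʳ (sym (f≈ x))))
    (polyX-+ (polyX-scale c q) (polyX-shift (polyX-* p q)))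
    where
    regroup : ∀ c x u v → c * v + x * (u * v) ≈ (c + x * u) * v
    regroup = solve 4 (λ c x u v → c :* v :+ x :* (u :* v) := (c :+ x :* u) :* v) refl

  polyX-neg : ∀ {f} → PolyX f → PolyX (λ x → - f x)
  polyX-neg p = polyX-resp (λ x → -1*x≈-x _) (polyX-scale (- 1#) p)

  polyX-^ : ∀ {f} → PolyX f → ∀ n → PolyX (λ x → f x ^ n)
  polyX-^ p zero    = polyX-const 1#
  polyX-^ p (suc n) = polyX-* p (polyX-^ p n)

  polyX-cong : ∀ {f} → PolyX f → ∀ {x y} → x ≈ y → f x ≈ f y
  polyX-cong (nil f≈0)     x≈y = trans (f≈0 _) (sym (f≈0 _))
  polyX-cong (cons c p f≈) x≈y =
    trans (f≈ _) (trans (+-congˡ (*-cong x≈y (polyX-cong p x≈y))) (sym (f≈ _)))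

  polyX-derivative : ∀ {f} → PolyX f →
    ∃[ f′ ] PolyX f′ × Derivative (λ x _ → f x) (λ x _ → f′ x) (λ _ _ → 0#)
  polyX-derivative (nil f≈0) = (λ _ → 0#) , polyX-0 ,
    derivative-resp (λ x _ → sym (f≈0 x)) (λ _ _ → refl) (λ _ _ → refl) (derivative-const 0#)
  polyX-derivative (cons {g = g} c p f≈) with polyX-derivative p
  ... | g′ , p′ , dg = (λ x → x * g′ x + g x) , polyX-+ (polyX-shift p′) p
    , derivative-resp (λ x _ → sym (f≈ x)) (λ x _ → ∂x x (g′ x) (g x)) (λ x _ → ∂m x (g x))
        (derivative-+ (derivative-const c) (derivative-* derivative-x dg))
    where
    ∂x : ∀ x u v → 0# + (x * u + v * 1#) ≈ x * u + v
    ∂x = solve 3 (λ x u v → :0 :+ (x :* u :+ v :* :1) := x :* u :+ v) refl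
    ∂m : ∀ x v → 0# + (x * 0# + v * 0#) ≈ 0#
    ∂m = solve 2 (λ x v → :0 :+ (x :* :0 :+ v :* :0) := :0) refl

  -- Polynomials of degree less than n in m over the polynomials in x.
  data PolyM : ℕ → (Fun₂) → Set where
    nil  : ∀ {F} → (∀ x m → F x m ≈ 0#) → PolyM 0 F
    cons : ∀ {F G a n} → PolyX a → PolyM n G → (∀ x m → F x m ≈ a x * m ^ n + G x m) → PolyM (suc n) F

  polyM-resp : ∀ {F G n} → (∀ x m → F x m ≈ G x m) → PolyM n F → PolyM n G
  polyM-resp F≈G (nil F≈0)     = nil λ x m → trans (sym (F≈G x m)) (F≈0 x m)
  polyM-resp F≈G (cons a p F≈) = cons a p λ x m → trans (sym (F≈G x m)) (F≈ x m)

  polyM-suc : ∀ {F n} → PolyM n F → PolyM (suc n) F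
  polyM-suc p = cons polyX-0 p λ x m → sym (trans (+-congʳ (zeroˡ _)) (+-identityˡ _))

  polyM-0 : ∀ {F} n → (∀ x m → F x m ≈ 0#) → PolyM n F
  polyM-0 zero    F≈0 = nil F≈0
  polyM-0 (suc n) F≈0 = polyM-suc (polyM-0 n F≈0)

  polyM-≤ : ∀ {F n k} → n ℕ.≤ k → PolyM n F → PolyM k F
  polyM-≤ ℕ.z≤n     (nil F≈0)     = polyM-0 _ F≈0
  polyM-≤ {k = suc k} (ℕ.s≤s n≤k) p = raise (ℕ.≤⇒≤′ (ℕ.s≤s n≤k)) p
    where
    raise : ∀ {F n k} → n ℕ.≤′ k → PolyM n F → PolyM k F
    raise (ℕ.≤′-reflexive ≡.refl) p = p
    raise (ℕ.≤′-step n≤k)         p = polyM-suc (raise n≤k p)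

  polyM-+ : ∀ {F G n} → PolyM n F → PolyM n G → PolyM n (λ x m → F x m + G x m)
  polyM-+ (nil F≈0) (nil G≈0) = nil λ x m → trans (+-cong (F≈0 x m) (G≈0 x m)) (+-identityˡ 0#)
  polyM-+ (cons a p F≈) (cons b q G≈) = cons (polyX-+ a b) (polyM-+ p q) λ x m →
    trans (+-cong (F≈ x m) (G≈ x m)) (regroup _ _ _ _ _)
    where
    regroup : ∀ a b t u v → (a * t + u) + (b * t + v) ≈ (a + b) * t + (u + v)
    regroup = solve 5 (λ a b t u v → (a :* t :+ u) :+ (b :* t :+ v) := (a :+ b) :* t :+ (u :+ v)) refl

  polyM-scale : ∀ {c F n} → PolyX c → PolyM n F → PolyM n (λ x m → c x * F x m)
  polyM-scale c (nil F≈0) = nil λ x m → trans (*-congˡ (F≈0 x m)) (zeroʳ _)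
  polyM-scale c (cons a p F≈) = cons (polyX-* c a) (polyM-scale c p) λ x m →
    trans (*-congˡ (F≈ x m)) (regroup _ _ _ _)
    where
    regroup : ∀ c a t u → c * (a * t + u) ≈ (c * a) * t + c * u
    regroup = solve 4 (λ c a t u → c :* (a :* t :+ u) := (c :* a) :* t :+ c :* u) refl

  polyM-neg : ∀ {F n} → PolyM n F → PolyM n (λ x m → - F x m)
  polyM-neg p = polyM-resp (λ x m → -1*x≈-x _) (polyM-scale (polyX-const (- 1#)) p)

  polyM-shift : ∀ {F n} → PolyM n F → PolyM (suc n) (λ x m → m * F x m)
  polyM-shift (nil F≈0) = polyM-0 1 λ x m → trans (*-congˡ (F≈0 x m)) (zeroʳ m)
  polyM-shift (cons a p F≈) = cons a (polyM-shift p) λ x m → trans (*-congˡ (F≈ x m)) (regroup _ _ _ _)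
    where
    regroup : ∀ m a t u → m * (a * t + u) ≈ a * (m * t) + m * u
    regroup = solve 4 (λ m a t u → m :* (a :* t :+ u) := a :* (m :* t) :+ m :* u) refl

  polyM-^* : ∀ {F n} j → PolyM n F → PolyM (j ℕ.+ n) (λ x m → m ^ j * F x m)
  polyM-^* zero    p = polyM-resp (λ x m → sym (*-identityˡ _)) p
  polyM-^* (suc j) p = polyM-resp (λ x m → sym (*-assoc m _ _)) (polyM-shift (polyM-^* j p))

  polyM-monomial : ∀ {a} → PolyX a → ∀ n → PolyM (suc n) (λ x m → a x * m ^ n)
  polyM-monomial a n = cons a (polyM-0 n λ _ _ → refl) λ x m → sym (+-identityʳ _)

  sign^ : ℕ → Carrier
  sign^ zero    = 1#
  sign^ (suc n) = - sign^ n

  neg-^ : ∀ m n → (- m) ^ n ≈ sign^ n * m ^ n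
  neg-^ m zero    = sym (*-identityˡ 1#)
  neg-^ m (suc n) = trans (*-congˡ (neg-^ m n))
    (solve 3 (λ m s t → (:- m) :* (s :* t) := (:- s) :* (m :* t)) refl m (sign^ n) (m ^ n))

  polyM-reflect : ∀ {F n} → PolyM n F → PolyM n (λ x m → F x (- m))
  polyM-reflect (nil F≈0) = nil λ x m → F≈0 x (- m)
  polyM-reflect (cons {n = n} a p F≈) = cons (polyX-scale (sign^ n) a) (polyM-reflect p) λ x m →
    trans (F≈ x (- m)) (+-congʳ (trans (*-congˡ (neg-^ m n)) (regroup _ _ _)))
    where
    regroup : ∀ a s t → a * (s * t) ≈ (s * a) * t
    regroup = solve 3 (λ a s t → a :* (s :* t) := (s :* a) :* t) refl

  polyM-cong : ∀ {F n} → PolyM n F → ∀ {x y m k} → x ≈ y → m ≈ k → F x m ≈ F y k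
  polyM-cong (nil F≈0) _ _ = trans (F≈0 _ _) (sym (F≈0 _ _))
  polyM-cong (cons {n = n} a p F≈) x≈y m≈k = trans (F≈ _ _)
    (trans (+-cong (*-cong (polyX-cong a x≈y) (^-congˡ n m≈k)) (polyM-cong p x≈y m≈k)) (sym (F≈ _ _)))

  derivative-^ : ∀ n → Derivative (λ _ m → m ^ suc n) (λ _ _ → 0#) (λ _ m → (suc n · 1#) * m ^ n)
  derivative-^ zero = derivative-resp (λ _ m → sym (*-identityʳ m)) (λ _ _ → refl)
    (λ _ _ → solve 0 (:1 := (:1 :+ :0) :* :1) refl) derivative-m
  derivative-^ (suc n) = derivative-resp (λ _ _ → refl)
    (λ _ m → ∂x m (m ^ suc n)) (λ _ m → ∂m m (m ^ n) (n · 1#))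
    (derivative-* derivative-m (derivative-^ n))
    where
    ∂x : ∀ m t → m * 0# + t * 0# ≈ 0#
    ∂x = solve 2 (λ m t → m :* :0 :+ t :* :0 := :0) refl
    ∂m : ∀ m t k → m * ((1# + k) * t) + (m * t) * 1# ≈ (1# + (1# + k)) * (m * t)
    ∂m = solve 3 (λ m t k → m :* ((:1 :+ k) :* t) :+ (m :* t) :* :1 := (:1 :+ (:1 :+ k)) :* (m :* t)) refl

  -- The number `n` is the true degree only where `a` is nonzero; that is later supplied by
  -- `Signed`.
  record Leading (n : ℕ) (a : Fun) (F : Fun₂) : Set where
    field
      coefficient : PolyX a
      {rest}      : Fun₂
      lower       : PolyM n rest
      expansion   : ∀ x m → F x m ≈ a x * m ^ n + rest x m
  open Leading

  leading⇒polyM : ∀ {n a F} → Leading n a F → PolyM (suc n) F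
  leading⇒polyM L = cons (coefficient L) (lower L) (expansion L)

  record Differentiable (n : ℕ) (F : Fun₂) : Set where
    field
      ∂x ∂m      : Fun₂
      derivative : Derivative F ∂x ∂m
      ∂x-polyM   : PolyM n ∂x
      ∂m-polyM   : PolyM (pred n) ∂m
  open Differentiable

  private
    module Term {a : Fun} {F G : Fun₂} {n : ℕ} (pa : PolyX a)
                (F≈ : ∀ x m → F x m ≈ a x * m ^ suc n + G x m) (dG : Differentiable (suc n) G) where

      a′ : Fun
      a′ = proj₁ (polyX-derivative pa)
      pa′ : PolyX a′
      pa′ = proj₁ (proj₂ (polyX-derivative pa))

      ∂x′ ∂m′ : Fun₂
      ∂x′ x m = a′ x * m ^ suc n + ∂x dG x m
      ∂m′ x m = ((suc n · 1#) * a x) * m ^ n + ∂m dG x m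

      derivative′ : Derivative F ∂x′ ∂m′
      derivative′ = derivative-resp (λ x m → sym (F≈ x m))
        (λ x m → +-congʳ (simplify-x (a x) (m ^ suc n) (a′ x)))
        (λ x m → +-congʳ (simplify-m (a x) (m ^ suc n) (m ^ n) (suc n · 1#)))
        (derivative-+ (derivative-* (proj₂ (proj₂ (polyX-derivative pa))) (derivative-^ n)) (derivative dG))
        where
        simplify-x : ∀ a t b → a * 0# + t * b ≈ b * t
        simplify-x = solve 3 (λ a t b → a :* :0 :+ t :* b := b :* t) refl
        simplify-m : ∀ a t u k → a * (k * u) + t * 0# ≈ (k * a) * u
        simplify-m = solve 4 (λ a t u k → a :* (k :* u) :+ t :* :0 := (k :* a) :* u) refl

  polyM-differentiable : ∀ {F n} → PolyM n F → Differentiable n F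
  polyM-differentiable (nil F≈0) = record
    { derivative = derivative-resp (λ x m → sym (F≈0 x m)) (λ _ _ → refl) (λ _ _ → refl) (derivative-const 0#)
    ; ∂x-polyM = nil λ _ _ → refl
    ; ∂m-polyM = nil λ _ _ → refl
    }
  polyM-differentiable (cons {a = a} {n = zero} pa (nil G≈0) F≈) = record
    { derivative = derivative-resp
        (λ x m → sym (trans (F≈ x m) (trans (+-cong (*-identityʳ (a x)) (G≈0 x m)) (+-identityʳ (a x)))))
        (λ _ _ → refl) (λ _ _ → refl) (proj₂ (proj₂ (polyX-derivative pa)))
    ; ∂x-polyM = cons (proj₁ (proj₂ (polyX-derivative pa))) (nil λ _ _ → refl)
        λ x m → sym (trans (+-identityʳ _) (*-identityʳ _))
    ; ∂m-polyM = nil λ _ _ → refl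
    }
  polyM-differentiable (cons {n = suc n} pa p F≈) = record
    { derivative = derivative′
    ; ∂x-polyM = cons pa′ (∂x-polyM dG) λ _ _ → refl
    ; ∂m-polyM = cons (polyX-scale (suc n · 1#) pa) (∂m-polyM dG) λ _ _ → refl
    }
    where
    dG = polyM-differentiable p
    open Term pa F≈ dG

  record LeadingDerivatives (n : ℕ) (a : Fun) (F : Fun₂) : Set where
    field
      {a′}       : Fun
      {∂x ∂m}    : Fun₂
      derivative : Derivative F ∂x ∂m
      ∂x-leading : Leading (suc n) a′ ∂x
      ∂m-leading : Leading n (λ x → (suc n · 1#) * a x) ∂m

  leading-derivatives : ∀ {n a F} → Leading (suc n) a F → LeadingDerivatives n a F
  leading-derivatives {n} L = record
    { derivative = derivative′
    ; ∂x-leading = record { coefficient = pa′ ; lower = ∂x-polyM dG ; expansion = λ _ _ → refl }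
    ; ∂m-leading = record { coefficient = polyX-scale (suc n · 1#) (coefficient L)
                          ; lower = ∂m-polyM dG ; expansion = λ _ _ → refl }
    }
    where
    dG = polyM-differentiable (lower L)
    open Term (coefficient L) (expansion L) dG

  0<·1 : ∀ n → 0# < suc n · 1#
  0<·1 zero    = 0<+ 0<1 ≤-refl
  0<·1 (suc n) = 0<+ 0<1 (<⇒≤ (0<·1 n))

  0<^ : ∀ {m} → 0# < m → ∀ n → 0# < m ^ n
  0<^ 0<m zero    = 0<1
  0<^ 0<m (suc n) = 0<* 0<m (0<^ 0<m n)

  -- Induction on the degree bound. The coefficient `α` is left free because the recursive call
  -- takes it to be `1#`: `α m^(n+1) + b m^n + G′` splits as `(m^n + G′) + (α m + b - 1) m^n`.
  leading-term-dominates : ∀ {G n} → PolyM n G → ∀ x {α} → 0# < α →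
                           ∃[ M ] 0# < M × (∀ {m} → M ≤ m → 0# < α * m ^ n + G x m)
  leading-term-dominates (nil G≈0) x {α} 0<α = 1# , 0<1 , λ _ →
    <-respʳ (trans (sym (+-identityʳ α)) (+-cong (sym (*-identityʳ α)) (sym (G≈0 x _)))) 0<α
  leading-term-dominates (cons {G = G′} {a = b} {n = n} _ p G≈) x {α} 0<α =
    combine (leading-term-dominates p x 0<1) (bound (b x))
    where
    combine : ∃[ M ] 0# < M × (∀ {m} → M ≤ m → 0# < 1# * m ^ n + G′ x m) → ∃[ B ] 0# < B × Small B (b x) →
              ∃[ M ] 0# < M × (∀ {m} → M ≤ m → 0# < α * m ^ suc n + _)
    combine (M , 0<M , positive) (B , 0<B , small) = M ⊔ N , <-≤-trans 0<M (≤⊔ˡ M N) , λ {m} M⊔N≤m →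
      <-respʳ (trans (regroup α m (b x) (m ^ n) (G′ x m)) (+-congˡ (sym (G≈ x m))))
        (0<+ (positive (≤-trans (≤⊔ˡ M N) M⊔N≤m))
          (*-nonNeg (factor (≤-trans (≤⊔ʳ M N) M⊔N≤m))
            (<⇒≤ (0<^ (<-≤-trans 0<M (≤-trans (≤⊔ˡ M N) M⊔N≤m)) n))))
      where
      -- Chosen so that `α * N = B + 1#`; as `b x > - B`, it gives `α * m + b x ≥ 1#` for `m ≥ N`.
      N : Carrier
      N = recip α * (B + 1#)
      αN≈ : ∀ m → α * (m - N) ≈ α * m - (B + 1#)
      αN≈ m = trans (solve 4 (λ a m r b → a :* (m :- r :* b) := a :* m :- (a :* r) :* b) refl α m (recip α) (B + 1#))
        (+-congˡ (-‿cong (trans (*-congʳ (*-recip (0<⇒≉0 0<α))) (*-identityˡ (B + 1#)))))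
      sum : ∀ u B c → (u - (B + 1#)) + (c - (- B)) ≈ (u + c) - 1#
      sum = solve 3 (λ u B c → (u :- (B :+ :1)) :+ (c :- (:- B)) := (u :+ c) :- :1) refl
      factor : ∀ {m} → N ≤ m → 0# ≤ (α * m + b x) - 1#
      factor {m} N≤m = ≤-respʳ-≈ (sum (α * m) B (b x))
        (0≤+ (≤-respʳ-≈ (αN≈ m) (*-nonNeg (<⇒≤ 0<α) (≤⇒0≤ N≤m))) (0≤b-a (Small.lower small)))
      regroup : ∀ a m b t g → (1# * t + g) + ((a * m + b) - 1#) * t ≈ a * (m * t) + (b * t + g)
      regroup = solve 5 (λ a m b t g → (:1 :* t :+ g) :+ ((a :* m :+ b) :- :1) :* t := a :* (m :* t) :+ (b :* t :+ g)) refl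

-- Monotone planar sets, and germs at 0 and ∞.

module Germs (em : ExcludedMiddle 0ℓ) (ℝ : RealNumbers) where

  open OrderedField em ℝ
  open Calculus em ℝ
  open Polynomials em ℝ
  open RealNumbers ℝ hiding (zero)

  Plane : Set
  Plane = Carrier × Carrier

  UpSet : (Carrier → Carrier → Set) → Pred (Pred Plane 0ℓ) 0ℓ
  UpSet _⊑_ W = ∀ {x m x′ m′} → W (x , m) → x ≤ x′ → m ⊑ m′ → W (x′ , m′)

  _≥_ : Carrier → Carrier → Set
  a ≥ b = b ≤ a

  NorthEast NorthWest : Pred (Pred Plane 0ℓ) 0ℓ
  NorthEast = UpSet _≤_
  NorthWest = UpSet _≥_

  𝔐 : Pred (Pred Plane 0ℓ) _
  𝔐 = SetAlgebra (NorthEast ∪ NorthWest)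

  𝔐-NE : ∀ {W} → NorthEast W → 𝔐 W
  𝔐-NE = generator ∘ inj₁

  𝔐-NW : ∀ {W} → NorthWest W → 𝔐 W
  𝔐-NW = generator ∘ inj₂

  𝔐-∅ : 𝔐 ∅
  𝔐-∅ = 𝔐-NE λ ()

  𝔐-U : 𝔐 U
  𝔐-U = 𝔐-NE _

  -- What the two ends of the positive axis share, so that one argument treats both. In `sign` the
  -- first alternative is vanishing everywhere, not just near the end, so a zero coefficient can be
  -- deleted from a global identity; the second makes every other coefficient invertible near the
  -- end.
  record Germ : Set₁ where
    field
      Nbhd     : Set
      _∋_      : Nbhd → Pred Carrier 0ℓ
      meet     : ∀ r s → ∃[ t ] (∀ {x} → t ∋ x → r ∋ x × s ∋ x)
      convex   : ∀ r → Convex (r ∋_)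
      positive : ∀ r {x} → r ∋ x → 0# < x
      member   : ∀ r → ∃[ x ] r ∋ x
      somewhere : Nbhd
      strip    : ∀ r → 𝔐 (λ (x , _) → r ∋ x)
      sign     : ∀ {f} → PolyX f → (∀ x → f x ≈ 0#) ⊎
                 ∃[ r ] ((∀ {x} → r ∋ x → 0# < f x) ⊎ (∀ {x} → r ∋ x → f x < 0#))

  -- A bound `ε` away from zero, unlike mere positivity, survives the Horner step `c + x * g`.
  Eventually≥ : Carrier → Carrier → Fun → Set
  Eventually≥ ε r f = ∀ {x} → 0# < x → r < x → ε ≤ f x

  eventually-grows : ∀ {f g : Fun} {c ε r} → (∀ x → f x ≈ c + x * g x) → 0# < ε →
                     Eventually≥ ε r g → ∃[ r′ ] Eventually≥ ε r′ f
  eventually-grows {f} {g} {c} {ε} {r} f≈ 0<ε ε≤g = choose (bound c)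
    where
    choose : ∃[ B ] 0# < B × Small B c → ∃[ r′ ] Eventually≥ ε r′ f
    choose (B , 0<B , small) = r ⊔ N , λ {x} 0<x r′<x →
      ≤-respʳ-≈ (sym (f≈ x)) (≤-trans
        (above x (<⇒≤ (≤-<-trans (≤⊔ʳ r N) r′<x)))
        (0≤⇒≤ (*-nonNeg (<⇒≤ 0<x) (≤⇒0≤ (ε≤g 0<x (≤-<-trans (≤⊔ˡ r N) r′<x)))) (difference c x (g x) ε)))
      where
      -- Since `ε * N = B + ε` and `c > - B`, the value `c + x * ε` is at least `ε` once `x ≥ N`.
      N : Carrier
      N = recip ε * (B + ε)
      difference : ∀ c x g ε → x * (g - ε) ≈ (c + x * g) - (c + x * ε)
      difference = solve 4 (λ c x g e → x :* (g :- e) := (c :+ x :* g) :- (c :+ x :* e)) refl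
      rearrange : ∀ ε x B c b → ε * (x - b) + (c - (- B)) ≈ (c + x * ε) - (ε * b - B)
      rearrange = solve 5 (λ e x B c b → e :* (x :- b) :+ (c :- (:- B)) := (c :+ x :* e) :- (e :* b :- B)) refl
      εN : ε * N - B ≈ ε
      εN = trans (+-congʳ (trans (sym (*-assoc ε _ _)) (trans (*-congʳ (*-recip (0<⇒≉0 0<ε))) (*-identityˡ _))))
        (solve 2 (λ B e → (B :+ e) :- B := e) refl B ε)
      above : ∀ x → N ≤ x → ε ≤ c + x * ε
      above x N≤x = 0≤⇒≤ (0≤+ (*-nonNeg (<⇒≤ 0<ε) (≤⇒0≤ N≤x)) (0≤b-a (Small.lower small)))
        (trans (rearrange ε x B c N) (+-congˡ (-‿cong εN)))

  eventually-sign : ∀ {f} → PolyX f → (∀ x → f x ≈ 0#) ⊎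
    ∃[ ε ] ∃[ r ] 0# < ε × (Eventually≥ ε r f ⊎ Eventually≥ ε r (λ x → - f x))
  eventually-sign (nil f≈0) = inj₁ f≈0
  eventually-sign {f} (cons {g = g} c p f≈) = extend (eventually-sign p)
    where
    neg-cons : ∀ {u} c x g → u ≈ c + x * g → - u ≈ - c + x * (- g)
    neg-cons c x g u≈ = trans (-‿cong u≈) (solve 3 (λ c x g → :- (c :+ x :* g) := :- c :+ x :* (:- g)) refl c x g)
    extend : (∀ x → g x ≈ 0#) ⊎ ∃[ ε ] ∃[ r ] 0# < ε × (Eventually≥ ε r g ⊎ Eventually≥ ε r (λ x → - g x)) →
             (∀ x → f x ≈ 0#) ⊎ ∃[ ε ] ∃[ r ] 0# < ε × (Eventually≥ ε r f ⊎ Eventually≥ ε r (λ x → - f x))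
    extend (inj₂ (ε , r , 0<ε , inj₁ ε≤g)) =
      let r′ , ε≤f = eventually-grows {f = f} {g = g} f≈ 0<ε ε≤g
      in inj₂ (ε , r′ , 0<ε , inj₁ ε≤f)
    extend (inj₂ (ε , r , 0<ε , inj₂ ε≤-g)) =
      let r′ , ε≤-f = eventually-grows {f = λ x → - f x} {g = λ x → - g x}
                        (λ x → neg-cons c x (g x) (f≈ x)) 0<ε ε≤-g
      in inj₂ (ε , r′ , 0<ε , inj₂ ε≤-f)
    extend (inj₁ g≈0) = constant (compare c 0#)
      where
      f≈c : ∀ x → f x ≈ c
      f≈c x = trans (f≈ x) (trans (+-congˡ (trans (*-congˡ (g≈0 x)) (zeroʳ x))) (+-identityʳ c))
      constant : Trichotomy c 0# → (∀ x → f x ≈ 0#) ⊎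
        ∃[ ε ] ∃[ r ] 0# < ε × (Eventually≥ ε r f ⊎ Eventually≥ ε r (λ x → - f x))
      constant (eq c≈0) = inj₁ λ x → trans (f≈c x) c≈0
      constant (gt 0<c) = inj₂ (c , 0# , 0<c , inj₁ λ _ _ → ≤-reflexive (sym (f≈c _)))
      constant (lt c<0) = inj₂ (- c , 0# , neg-pos c<0 , inj₂ λ _ _ → ≤-reflexive (-‿cong (sym (f≈c _))))

  at-infinity : Germ
  at-infinity = record
    { Nbhd      = Carrier
    ; _∋_       = λ r x → 0# < x × r < x
    ; meet      = λ r s → r ⊔ s , λ (0<x , m<x) →
                    (0<x , ≤-<-trans (≤⊔ˡ r s) m<x) , (0<x , ≤-<-trans (≤⊔ʳ r s) m<x)
    ; convex    = λ _ (0<x , r<x) _ x≤y _ → <-≤-trans 0<x x≤y , <-≤-trans r<x x≤y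
    ; positive  = λ _ → proj₁
    ; member    = λ r → (r ⊔ 0#) + 1# , ≤-<-trans (≤⊔ʳ r 0#) (a+b>a 0<1) , ≤-<-trans (≤⊔ˡ r 0#) (a+b>a 0<1)
    ; somewhere = 0#
    ; strip     = λ r → 𝔐-NE λ (0<x , r<x) x≤x′ _ → <-≤-trans 0<x x≤x′ , <-≤-trans r<x x≤x′
    ; sign      = λ p → sign (eventually-sign p)
    }
    where
    sign : ∀ {f} → (∀ x → f x ≈ 0#) ⊎
      (∃[ ε ] ∃[ r ] 0# < ε × (Eventually≥ ε r f ⊎ Eventually≥ ε r (λ x → - f x))) →
      (∀ x → f x ≈ 0#) ⊎
      ∃[ r ] ((∀ {x} → 0# < x × r < x → 0# < f x) ⊎ (∀ {x} → 0# < x × r < x → f x < 0#))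
    sign (inj₁ f≈0) = inj₁ f≈0
    sign (inj₂ (ε , r , 0<ε , inj₁ ε≤f)) = inj₂ (r , inj₁ λ (0<x , r<x) → <-≤-trans 0<ε (ε≤f 0<x r<x))
    sign (inj₂ (ε , r , 0<ε , inj₂ ε≤-f)) =
      inj₂ (r , inj₂ λ (0<x , r<x) → neg-pos⁻¹ (<-≤-trans 0<ε (ε≤-f 0<x r<x)))

  LocalSign : Fun → Set
  LocalSign f = (∀ x → f x ≈ 0#) ⊎
    ∃[ δ ] 0# < δ × ((∀ {x} → 0# < x → x < δ → 0# < f x) ⊎ (∀ {x} → 0# < x → x < δ → f x < 0#))

  positive-near-0 : ∀ {f} → PolyX f → 0# < f 0# → ∃[ δ ] 0# < δ × (∀ {x} → 0# < x → x < δ → 0# < f x)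
  positive-near-0 {f} p 0<f0 = at (continuous-positive
      (continuous-derivative (proj₂ (proj₂ (polyX-derivative p))) 0# 0#) 0<f0)
    where
    x≈x-0 : ∀ x → x ≈ x - 0#
    x≈x-0 = solve 1 (λ x → x := x :- :0) refl
    at : Near₂ 0# 0# (λ x _ → 0# < f x) → ∃[ δ ] 0# < δ × (∀ {x} → 0# < x → x < δ → 0# < f x)
    at (δ , 0<δ , pos) = δ , 0<δ , λ {x} 0<x x<δ → pos x 0#
      (small-resp (x≈x-0 x) (<-trans (pos-neg 0<δ) 0<x , x<δ)) (small-self refl 0<δ)

  -- A nonzero constant term fixes the sign near 0 by continuity; when it is zero, the factor `x` is
  -- positive and the Horner tail decides.
  local-sign : ∀ {f} → PolyX f → LocalSign f
  local-sign (nil f≈0) = inj₁ f≈0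
  local-sign {f} P@(cons {g = g} c p f≈) = by-constant-term (compare c 0#)
    where
    f0≈c : f 0# ≈ c
    f0≈c = trans (f≈ 0#) (trans (+-congˡ (zeroˡ _)) (+-identityʳ c))
    divide : (∀ x → f x ≈ x * g x) → LocalSign g → LocalSign f
    divide f≈xg (inj₁ g≈0) = inj₁ λ x → trans (f≈xg x) (trans (*-congˡ (g≈0 x)) (zeroʳ x))
    divide f≈xg (inj₂ (δ , 0<δ , inj₁ pos)) = inj₂ (δ , 0<δ , inj₁ λ {x} 0<x x<δ →
      <-respʳ (sym (f≈xg x)) (0<* 0<x (pos 0<x x<δ)))
    divide f≈xg (inj₂ (δ , 0<δ , inj₂ neg)) = inj₂ (δ , 0<δ , inj₂ λ {x} 0<x x<δ → neg-pos⁻¹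
      (<-respʳ (trans (sym (-‿distribʳ-* x (g x))) (-‿cong (sym (f≈xg x)))) (0<* 0<x (neg-pos (neg 0<x x<δ)))))
    by-constant-term : Trichotomy c 0# → LocalSign f
    by-constant-term (gt 0<c) =
      let δ , 0<δ , pos = positive-near-0 P (<-respʳ (sym f0≈c) 0<c)
      in inj₂ (δ , 0<δ , inj₁ pos)
    by-constant-term (lt c<0) =
      let δ , 0<δ , pos = positive-near-0 (polyX-neg P) (<-respʳ (-‿cong (sym f0≈c)) (neg-pos c<0))
      in inj₂ (δ , 0<δ , inj₂ λ 0<x x<δ → neg-pos⁻¹ (pos 0<x x<δ))
    by-constant-term (eq c≈0) =
      divide (λ x → trans (f≈ x) (trans (+-congʳ c≈0) (+-identityˡ _))) (local-sign p)

  at-zero : Germ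
  at-zero = record
    { Nbhd      = ∃[ δ ] 0# < δ
    ; _∋_       = λ (δ , _) x → 0# < x × x < δ
    ; meet      = λ (δ , 0<δ) (ε , 0<ε) → (δ ⊓ ε , ⊓-elim (0# <_) 0<δ 0<ε) , λ (0<x , x<m) →
                    (0<x , <-≤-trans x<m (⊓≤ˡ δ ε)) , (0<x , <-≤-trans x<m (⊓≤ʳ δ ε))
    ; convex    = λ _ (0<x , _) (_ , z<δ) x≤y y≤z → <-≤-trans 0<x x≤y , ≤-<-trans y≤z z<δ
    ; positive  = λ _ → proj₁
    ; member    = λ (δ , 0<δ) → half δ , 0<half 0<δ , half< 0<δ
    ; somewhere = 1# , 0<1
    ; strip     = λ (δ , _) → resp-≐
                    ( (λ (0<x , δ≰x) → 0<x , ≰⇒> δ≰x)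
                    , (λ (0<x , x<δ) → 0<x , <⇒≱ x<δ))
                    (intersection {X = λ (x , _) → 0# < x} {Y = ∁ (λ (x , _) → δ ≤ x)}
                      (𝔐-NE λ 0<x x≤x′ _ → <-≤-trans 0<x x≤x′)
                      (complement (𝔐-NE λ δ≤x x≤x′ _ → ≤-trans δ≤x x≤x′)))
    ; sign      = λ p → sign (local-sign p)
    }
    where
    sign : ∀ {f} → LocalSign f → (∀ x → f x ≈ 0#) ⊎
      ∃[ r ] ((∀ {x} → 0# < x × x < proj₁ r → 0# < f x) ⊎ (∀ {x} → 0# < x × x < proj₁ r → f x < 0#))
    sign (inj₁ f≈0) = inj₁ f≈0
    sign (inj₂ (δ , 0<δ , inj₁ pos)) = inj₂ ((δ , 0<δ) , inj₁ λ (0<x , x<δ) → pos 0<x x<δ)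
    sign (inj₂ (δ , 0<δ , inj₂ neg)) = inj₂ ((δ , 0<δ) , inj₂ λ (0<x , x<δ) → neg 0<x x<δ)

-- Pseudo-division and coprimality near a germ.

module Division (em : ExcludedMiddle 0ℓ) (ℝ : RealNumbers) (𝒢 : Germs.Germ em ℝ) where

  import Algebra.Properties.Semiring.Exp as Exp
  open import Data.Nat.Base as ℕ using (ℕ; zero; suc; _∸_)
  open ≡ using (_≡_)
  open OrderedField em ℝ
  open Calculus em ℝ
  open Polynomials em ℝ
  open Germs em ℝ
  open RealNumbers ℝ hiding (zero)
  open RawSemiringDefs (Semiring.rawSemiring semiring) using (_^_)
  open Exp semiring using (^-homo-*)
  open Germ 𝒢
  open Leading

  Signed : Fun → Set
  Signed f = ∃[ r ] ((∀ {x} → r ∋ x → 0# < f x) ⊎ (∀ {x} → r ∋ x → f x < 0#))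

  signed⇒≉0 : ∀ {f} (s : Signed f) → ∀ {x} → proj₁ s ∋ x → ¬ f x ≈ 0#
  signed⇒≉0 (r , inj₁ pos) x∈r = 0<⇒≉0 (pos x∈r)
  signed⇒≉0 (r , inj₂ neg) x∈r f≈0 = proj₂ (neg x∈r) f≈0

  leading-resp : ∀ {n a F G} → (∀ x m → F x m ≈ G x m) → Leading n a F → Leading n a G
  leading-resp F≈G L = record
    { coefficient = coefficient L ; lower = lower L
    ; expansion = λ x m → trans (sym (F≈G x m)) (expansion L x m) }

  Trimmed : ℕ → (Fun₂) → Set
  Trimmed n F = (∀ x m → F x m ≈ 0#) ⊎ ∃[ k ] ∃[ a ] k ℕ.< n × Signed a × Leading k a F

  -- `PolyM` merely bounds the degree. Identically vanishing leading coefficients are dropped until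
  -- one with a strict sign near the germ is met, and `k` is then the true degree over that
  -- neighbourhood.
  trim : ∀ {n F} → PolyM n F → Trimmed n F
  trim (nil F≈0) = inj₁ F≈0
  trim {F = F} (cons {G = G} {a = a} {n = n} pa p F≈) = step (sign pa)
    where
    skip : (∀ x m → F x m ≈ G x m) → Trimmed n G → Trimmed (suc n) F
    skip F≈G (inj₁ G≈0) = inj₁ λ x m → trans (F≈G x m) (G≈0 x m)
    skip F≈G (inj₂ (k , b , k<n , sb , L)) =
      inj₂ (k , b , ℕ.m<n⇒m<1+n k<n , sb , leading-resp (λ x m → sym (F≈G x m)) L)
    step : (∀ x → a x ≈ 0#) ⊎ Signed a → Trimmed (suc n) F
    step (inj₁ a≈0) = skip (λ x m → trans (F≈ x m) (trans (+-congʳ (trans (*-congʳ (a≈0 x)) (zeroˡ _))) (+-identityˡ _)))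
      (trim p)
    step (inj₂ sa) = inj₂ (n , a , ℕ.n<1+n n , sa , record { coefficient = pa ; lower = p ; expansion = F≈ })

  record PseudoDivision (j k : ℕ) (q : Fun) (F Q : Fun₂) : Set where
    field
      {c}       : Fun
      {A R}     : Fun₂
      multiplier : PolyX c
      quotient  : PolyM j A
      remainder : PolyM k R
      identity  : ∀ x m → c x * F x m ≈ A x m * Q x m + R x m
      nonzero   : ∀ {x} → ¬ q x ≈ 0# → ¬ c x ≈ 0#
  open PseudoDivision

  -- With `F = a m^(j+k) + G` and `Q = q m^k + Q₁`, the combination `q F - a m^j Q` equals
  -- `q G - a m^j Q₁`, which lowers the degree bound by one. Each step multiplies by `q`, so the
  -- final multiplier is a power of `q`; this is the source of `nonzero`.
  pseudo-divide : ∀ {k q Q} → Leading k q Q → ∀ j {F} → PolyM (j ℕ.+ k) F → PseudoDivision j k q F Q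
  pseudo-divide L zero {F} p = record
    { c = λ _ → 1# ; A = λ _ _ → 0# ; R = F
    ; multiplier = polyX-const 1#
    ; quotient   = nil λ _ _ → refl
    ; remainder  = p
    ; identity   = λ x m → unit (F x m) _
    ; nonzero    = λ _ 1≈0 → 0≉1 (sym 1≈0)
    }
    where
    unit : ∀ f q → 1# * f ≈ 0# * q + f
    unit = solve 2 (λ f q → :1 :* f := :0 :* q :+ f) refl
  pseudo-divide {k} {q} {Q} L (suc j) {F} (cons {G = G} {a = a} pa p F≈) = record
    { c = λ x → c D x * q x
    ; A = λ x m → A D x m + (c D x * a x) * m ^ j
    ; R = R D
    ; multiplier = polyX-* (multiplier D) (coefficient L)
    ; quotient   = polyM-resp (λ x m → +-comm _ _)
        (cons (polyX-* (multiplier D) pa) (quotient D) λ _ _ → refl)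
    ; remainder  = remainder D
    ; identity   = λ x m → combine (F≈′ x m) (expansion L x m) (identity D x m)
    ; nonzero    = λ q≉0 cq≈0 → q≉0 (*≈0 cq≈0 (nonzero D q≉0))
    }
    where
    Q₁ : Fun₂
    Q₁ = rest L
    D : PseudoDivision j k q (λ x m → q x * G x m + - (a x * (m ^ j * Q₁ x m))) Q
    D = pseudo-divide L j (polyM-+ (polyM-scale (coefficient L) p)
          (polyM-neg (polyM-scale pa (polyM-^* j (lower L)))))
    F≈′ : ∀ x m → F x m ≈ a x * (m ^ j * m ^ k) + G x m
    F≈′ x m = trans (F≈ x m) (+-congʳ (*-congˡ (^-homo-* m j k)))
    cancel : ∀ c q a s t g q₁ → (c * q) * (a * (s * t) + g)
           ≈ c * (q * g + - (a * (s * q₁))) + ((c * a) * s) * (q * t + q₁)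
    cancel = solve 7 (λ c q a s t g q₁ → (c :* q) :* (a :* (s :* t) :+ g)
      := c :* (q :* g :+ (:- (a :* (s :* q₁)))) :+ ((c :* a) :* s) :* (q :* t :+ q₁)) refl
    regroup : ∀ u v w z → (u * w + z) + v * w ≈ (u + v) * w + z
    regroup = solve 4 (λ u v w z → (u :* w :+ z) :+ v :* w := (u :+ v) :* w :+ z) refl
    combine : ∀ {f c q a s t g q₁ Q A R} → f ≈ a * (s * t) + g → Q ≈ q * t + q₁ →
              c * (q * g + - (a * (s * q₁))) ≈ A * Q + R → (c * q) * f ≈ (A + (c * a) * s) * Q + R
    combine {c = c} {q} {a} {s} {t} {g} {q₁} {Q} {A} {R} f≈ Q≈ e = trans (*-congˡ f≈)
      (trans (cancel c q a s t g q₁) (trans (+-cong e (*-congˡ (sym Q≈))) (regroup A ((c * a) * s) Q R)))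

  -- Reducibility over the rational functions of `x`, with denominators cleared into `c`. For `P` of
  -- degree exactly `n` the degree bounds force both factors to be nonconstant in `m`.
  record Reducible (n : ℕ) (P : Fun₂) : Set where
    field
      {c}      : Fun
      {P₁ P₂}  : Fun₂
      multiplier : PolyX c
      signed   : Signed c
      factor₁  : PolyM n P₁
      factor₂  : PolyM n P₂
      product  : ∀ x m → c x * P x m ≈ P₁ x m * P₂ x m

  NoCommonZero : (P Q : Fun₂) → Set
  NoCommonZero P Q = ∃[ r ] (∀ {x m} → r ∋ x → P x m ≈ 0# → Q x m ≈ 0# → ⊥)

  not-vanishing⇒signed : ∀ {f r} → PolyX f → (∀ {x} → r ∋ x → ¬ f x ≈ 0#) → Signed f
  not-vanishing⇒signed {f} {r} p f≉0 = decide (sign p)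
    where
    decide : (∀ x → f x ≈ 0#) ⊎ Signed f → Signed f
    decide (inj₁ f≈0) = ⊥-elim (f≉0 (proj₂ (member r)) (f≈0 _))
    decide (inj₂ s)   = s

  -- The Euclidean algorithm: if P and Q have a common zero over x, then so do
  -- P and its pseudo-remainder modulo Q.
  irreducible⇒coprime : ∀ {n P} → PolyM (suc n) P → ¬ Reducible n P → ∀ fuel {k q Q} → k ℕ.≤ fuel → k ℕ.< n →
                        Signed q → Leading k q Q → NoCommonZero P Q
  irreducible⇒coprime p irr fuel {zero} {q} {Q} _ _ sq L = proj₁ sq , λ x∈r _ Q≈0 →
    signed⇒≉0 sq x∈r (trans (sym (constant (lower L) (expansion L _ _))) Q≈0)
    where
    constant : ∀ {G x m v} → PolyM 0 G → v ≈ q x * 1# + G x m → v ≈ q x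
    constant (nil G≈0) v≈ = trans v≈ (trans (+-cong (*-identityʳ _) (G≈0 _ _)) (+-identityʳ _))
  irreducible⇒coprime {n} {P} p irr (suc fuel) {suc k} {q} {Q} (ℕ.s≤s k≤fuel) k<n sq L =
    by-remainder (trim (remainder D))
    where
    k≤n : k ℕ.≤ n
    k≤n = ℕ.<⇒≤ (ℕ.<⇒≤ k<n)
    degree : suc n ≡ (n ∸ k) ℕ.+ suc k
    degree = ≡.trans (≡.cong suc (≡.sym (ℕ.m∸n+n≡m k≤n))) (≡.sym (ℕ.+-suc (n ∸ k) k))
    D : PseudoDivision (n ∸ k) (suc k) q P Q
    D = pseudo-divide L (n ∸ k) (≡.subst (λ i → PolyM i P) degree p)
    common : ∀ {x m} → P x m ≈ 0# → Q x m ≈ 0# → R D x m ≈ 0#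
    common {x} {m} P≈0 Q≈0 = trans (sym (+-identityˡ _)) (trans (+-congʳ (sym (trans (*-congˡ Q≈0) (zeroʳ _))))
      (trans (sym (identity D x m)) (trans (*-congˡ P≈0) (zeroʳ _))))
    by-remainder : Trimmed (suc k) (R D) → NoCommonZero P Q
    -- It is `P`, not the previous divisor, that is divided at each stage, so a vanishing remainder
    -- at any stage factors `P` itself.
    by-remainder (inj₁ R≈0) = ⊥-elim (irr (record
      { multiplier = multiplier D
      ; signed  = not-vanishing⇒signed {r = proj₁ sq} (multiplier D) (λ x∈r → nonzero D (signed⇒≉0 sq x∈r))
      ; factor₁ = polyM-≤ (ℕ.m∸n≤m n k) (quotient D)
      ; factor₂ = polyM-≤ k<n (leading⇒polyM L)
      ; product = λ x m → trans (identity D x m) (trans (+-congˡ (R≈0 x m)) (+-identityʳ _))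
      }))
    by-remainder (inj₂ (i , b , i<suck , sb , L′)) =
      let r , none = irreducible⇒coprime p irr fuel (ℕ.≤-trans (ℕ.s≤s⁻¹ i<suck) k≤fuel)
                       (ℕ.<-trans i<suck k<n) sb L′
      in r , λ x∈r P≈0 Q≈0 → none x∈r P≈0 (common P≈0 Q≈0)

-- Root functions between consecutive zeros of the m-derivative.

module Branches (em : ExcludedMiddle 0ℓ) (ℝ : RealNumbers) where

  open OrderedField em ℝ
  open Calculus em ℝ
  open RealNumbers ℝ hiding (zero)
  open Derivative

  -- Continuity in terms of the order, a form that pointwise minima and maxima inherit at once.
  record ContinuousOn (D : Pred Carrier 0ℓ) (η : Fun) : Set where
    field
      stays-above : ∀ {s u} → D s → u < η s → Near D s (λ x → u < η x)
      stays-below : ∀ {s u} → D s → η s < u → Near D s (λ x → η x < u)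
  open ContinuousOn

  continuousOn-⊆ : ∀ {D E η} → (∀ x → E x → D x) → ContinuousOn D η → ContinuousOn E η
  continuousOn-⊆ E⊆D c .stays-above Es p = near-⊆ E⊆D (c .stays-above (E⊆D _ Es) p)
  continuousOn-⊆ E⊆D c .stays-below Es p = near-⊆ E⊆D (c .stays-below (E⊆D _ Es) p)

  continuousOn-⊓ : ∀ {D η ζ} → ContinuousOn D η → ContinuousOn D ζ → ContinuousOn D (λ x → η x ⊓ ζ x)
  continuousOn-⊓ {D} {η} {ζ} cη cζ .stays-above {s} {u} Ds u<⊓ = near-map
    (λ x _ (p , q) → ⊓-elim (u <_) p q)
    (near-× (cη .stays-above Ds (<-≤-trans u<⊓ (⊓≤ˡ (η s) (ζ s)))) (cζ .stays-above Ds (<-≤-trans u<⊓ (⊓≤ʳ (η s) (ζ s)))))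
  continuousOn-⊓ {D} {η} {ζ} cη cζ .stays-below {s} {u} Ds ⊓<u = by-cases (⊓-⊔-cases (η s) (ζ s))
    where
    by-cases : (η s ⊓ ζ s ≈ η s × η s ⊔ ζ s ≈ ζ s) ⊎ (η s ⊓ ζ s ≈ ζ s × η s ⊔ ζ s ≈ η s) →
               Near D s (λ x → η x ⊓ ζ x < u)
    by-cases (inj₁ (e , _)) = near-map (λ x _ p → ≤-<-trans (⊓≤ˡ (η x) (ζ x)) p) (cη .stays-below Ds (<-respˡ e ⊓<u))
    by-cases (inj₂ (e , _)) = near-map (λ x _ p → ≤-<-trans (⊓≤ʳ (η x) (ζ x)) p) (cζ .stays-below Ds (<-respˡ e ⊓<u))

  continuousOn-⊔ : ∀ {D η ζ} → ContinuousOn D η → ContinuousOn D ζ → ContinuousOn D (λ x → η x ⊔ ζ x)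
  continuousOn-⊔ {D} {η} {ζ} cη cζ .stays-below {s} {u} Ds ⊔<u = near-map
    (λ x _ (p , q) → ⊔-elim (_< u) p q)
    (near-× (cη .stays-below Ds (≤-<-trans (≤⊔ˡ (η s) (ζ s)) ⊔<u)) (cζ .stays-below Ds (≤-<-trans (≤⊔ʳ (η s) (ζ s)) ⊔<u)))
  continuousOn-⊔ {D} {η} {ζ} cη cζ .stays-above {s} {u} Ds u<⊔ = by-cases (⊓-⊔-cases (η s) (ζ s))
    where
    by-cases : (η s ⊓ ζ s ≈ η s × η s ⊔ ζ s ≈ ζ s) ⊎ (η s ⊓ ζ s ≈ ζ s × η s ⊔ ζ s ≈ η s) →
               Near D s (λ x → u < η x ⊔ ζ x)
    by-cases (inj₁ (_ , e)) = near-map (λ x _ p → <-≤-trans p (≤⊔ʳ (η x) (ζ x))) (cζ .stays-above Ds (<-respʳ e u<⊔))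
    by-cases (inj₂ (_ , e)) = near-map (λ x _ p → <-≤-trans p (≤⊔ˡ (η x) (ζ x))) (cη .stays-above Ds (<-respʳ e u<⊔))

  Continuous : (Fun₂) → Set
  Continuous F = ∀ x m → Continuous₂ x m F

  +-close : ∀ {m δ u} → m - δ < u → u < m + δ → Small δ (u - m)
  +-close {m} {δ} {u} l r =
      0<⇒< (<⇒0< l) (solve 3 (λ m d u → u :- (m :- d) := (u :- m) :- (:- d)) refl m δ u)
    , 0<⇒< (<⇒0< r) (solve 3 (λ m d u → (m :+ d) :- u := d :- (u :- m)) refl m δ u)

  near₂-curve : ∀ {D η Q s} → ContinuousOn D η → D s → Near₂ s (η s) Q → Near D s (λ x → Q x (η x))
  near₂-curve {D} {η} {Q} {s} cη Ds (δ , 0<δ , q) = near-map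
    (λ x _ ((l , r) , sx) → q x (η x) sx (+-close l r))
    (near-× (near-× (cη .stays-above Ds (a-b<a 0<δ)) (cη .stays-below Ds (a+b>a 0<δ))) (δ , 0<δ , λ _ _ sx → sx))

  curve-signLocal : ∀ {D η F} → ContinuousOn D η → Continuous F → SignLocal (λ x → F x (η x)) D
  curve-signLocal {η = η} cη cF {s} Ds =
      (λ pos → near₂-curve cη Ds (continuous-positive (cF s (η s)) pos))
    , (λ neg → near₂-curve cη Ds (continuous-negative (cF s (η s)) neg))

  near₂-slice : ∀ {E x m} {Q : Carrier → Carrier → Set} → Near₂ x m Q → Near E m (Q x)
  near₂-slice {x = x} (δ , 0<δ , q) = δ , 0<δ , λ u _ su → q x u (small-self refl 0<δ) su

  slice-signLocal : ∀ {E F} → Continuous F → ∀ x → SignLocal (F x) E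
  slice-signLocal {F = F} cF x {m} _ =
      (λ pos → near₂-slice {Q = λ x m → 0# < F x m} (continuous-positive (cF x m) pos))
    , (λ neg → near₂-slice {Q = λ x m → F x m < 0#} (continuous-negative (cF x m) neg))

  near-slice-increasing : ∀ {P ∂x ∂m E} → Derivative P ∂x ∂m → ∀ x s → 0# < ∂m x s →
    Near E s (λ u → (u < s → P x u < P x s) × (s < u → P x s < P x u))
  near-slice-increasing {P} {∂x} {∂m} {E} dP x s 0<∂m = use (directional dP x s 0# 1# (<-respʳ (slope _ _) 0<∂m))
    where
    slope : ∀ a b → b ≈ 0# * a + 1# * b
    slope = solve 2 (λ a b → b := :0 :* a :+ :1 :* b) refl
    still : ∀ x h → x - x ≈ 0# * h
    still = solve 2 (λ x h → x :- x := :0 :* h) refl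
    0<- : ∀ u s → s - u ≈ 0# - (u - s)
    0<- = solve 2 (λ u s → s :- u := :0 :- (u :- s)) refl
    use : ∃[ δ ] 0# < δ × (∀ {h x′ m} → Small δ h → x′ - x ≈ 0# * h → m - s ≈ 1# * h →
            (0# < h → P x s < P x′ m) × (h < 0# → P x′ m < P x s)) →
          Near E s (λ u → (u < s → P x u < P x s) × (s < u → P x s < P x u))
    use (δ , 0<δ , q) = δ , 0<δ , λ u _ su →
      let right , left = q su (still x (u - s)) (sym (*-identityˡ (u - s))) in
        (λ u<s → left (0<⇒< (<⇒0< u<s) (0<- u s)))
      , (λ s<u → right (<⇒0< s<u))

  -- The relation handed to `local⇒global` includes `u ≈ v`, because the local condition also
  -- concerns the base point itself, where a strict inequality fails.
  slice-increasing : ∀ {P ∂x ∂m E} → Derivative P ∂x ∂m → (∀ {x m k} → m ≈ k → P x m ≈ P x k) → Convex E →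
    ∀ x → (∀ {m} → E m → 0# < ∂m x m) → ∀ {u v} → E u → E v → u < v → P x u < P x v
  slice-increasing {P} {E = E} dP cong convex x 0<∂m {u} {v} Eu Ev u<v =
    strict (local⇒global Φ {E} convex (λ _ _ _ → Φ-trans) local Eu Ev (<⇒≤ u<v))
    where
    Φ : Carrier → Carrier → Set
    Φ u v = u ≈ v ⊎ P x u < P x v
    Φ-trans : ∀ {u v w} → Φ u v → Φ v w → Φ u w
    Φ-trans (inj₁ e) (inj₁ f) = inj₁ (trans e f)
    Φ-trans (inj₁ e) (inj₂ q) = inj₂ (<-respˡ (cong (sym e)) q)
    Φ-trans (inj₂ p) (inj₁ f) = inj₂ (<-respʳ (cong f) p)
    Φ-trans (inj₂ p) (inj₂ q) = inj₂ (<-trans p q)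
    weaken : ∀ {u v} → (u < v → P x u < P x v) → u ≤ v → Φ u v
    weaken {u} {v} f u≤v with em {u ≈ v}
    ... | yes u≈v = inj₁ u≈v
    ... | no  u≉v = inj₂ (f (u≤v , u≉v))
    local : ∀ {s} → E s → Near E s (λ u → (u ≤ s → Φ u s) × (s ≤ u → Φ s u))
    local {s} Es = near-map (λ u _ (l , r) → weaken l , weaken r) (near-slice-increasing dP x s (0<∂m Es))
    strict : Φ u v → P x u < P x v
    strict (inj₂ p)   = p
    strict (inj₁ u≈v) = ⊥-elim (proj₂ u<v u≈v)

  -- For every `e > 0` the local bounds chain to `ζ y ≤ ζ x + e * (y - x)`. A rise `ζ y - ζ x > 0`
  -- is refuted by an `e` so small that `(y - x) * e` falls below it.
  local-slopes⇒antitone : ∀ {D : Pred Carrier 0ℓ} {ζ : Fun} → Convex D →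
    (∀ {e} → 0# < e → ∀ {s} → D s →
      Near D s (λ u → (u ≤ s → ζ s ≤ ζ u + e * (s - u)) × (s ≤ u → ζ u ≤ ζ s + e * (u - s)))) →
    ∀ {x y} → D x → D y → x ≤ y → ζ y ≤ ζ x
  local-slopes⇒antitone {D} {ζ} convex local {x} {y} Dx Dy x≤y = conclude (≤-<-cases (ζ y) (ζ x))
    where
    join : ∀ u v w e z → (z + e * (v - u)) + e * (w - v) ≈ z + e * (w - u)
    join = solve 5 (λ u v w e z → (z :+ e :* (v :- u)) :+ e :* (w :- v) := z :+ e :* (w :- u)) refl
    global : ∀ {e} → 0# < e → ζ y ≤ ζ x + e * (y - x)
    global {e} 0<e = local⇒global (λ u v → ζ v ≤ ζ u + e * (v - u)) {D} convex
      (λ {u} {v} {w} _ _ _ p q → ≤-respʳ-≈ (join u v w e (ζ u)) (≤-trans q (+-monoˡ-≤ _ p)))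
      (local 0<e) Dx Dy x≤y
    cancel : ∀ a b e h → (b + e * h) - a ≈ h * e - (a - b)
    cancel = solve 4 (λ a b e h → (b :+ e :* h) :- a := h :* e :- (a :- b)) refl
    contradict : ∃[ δ ] 0# < δ × (∀ {u} → Small δ u → Small (ζ y - ζ x) ((y - x) * u)) → ⊥
    contradict (δ , 0<δ , scale) = <⇒≱ (Small.upper (scale {half δ} (<-trans (pos-neg 0<δ) (0<half 0<δ) , half< 0<δ)))
      (0≤⇒≤ (≤⇒0≤ (global (0<half 0<δ))) (cancel (ζ y) (ζ x) (half δ) (y - x)))
    conclude : ζ y ≤ ζ x ⊎ ζ x < ζ y → ζ y ≤ ζ x
    conclude (inj₁ p) = p
    conclude (inj₂ p) = ⊥-elim (contradict (small-scale (y - x) (<⇒0< p)))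

  flat : ∀ {a b u s} e → a ≈ b → u ≈ s → a ≤ b + e * (u - s)
  flat {a} {b} {u} {s} e a≈b u≈s = ≤-reflexive (trans a≈b (trans (sym (+-identityʳ b))
    (+-congˡ (trans (sym (zeroʳ e)) (*-congˡ (trans (sym (-‿inverseʳ s)) (+-congʳ (sym u≈s))))))))

  -- Sg s v: v has the strict sign s, true standing for positive.
  Sg : Bool → Carrier → Set
  Sg true  v = 0# < v
  Sg false v = v < 0#

  sg-resp : ∀ s {u v} → u ≈ v → Sg s u → Sg s v
  sg-resp true  = <-respʳ
  sg-resp false = <-respˡ

  sg-neg : ∀ s {v} → Sg s v → Sg (not s) (- v)
  sg-neg true  = pos-neg
  sg-neg false = neg-pos

  sg-neg⁻¹ : ∀ s {v} → Sg s (- v) → Sg (not s) v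
  sg-neg⁻¹ true  p = neg-pos⁻¹ p
  sg-neg⁻¹ false p = <-respʳ (-‿involutive _) (neg-pos p)

  sg-opposite : ∀ s {v} → Sg s v → Sg (not s) v → ⊥
  sg-opposite true  p n = <-irrefl (<-trans p n)
  sg-opposite false n p = <-irrefl (<-trans p n)

  sg-≉0 : ∀ s {v} → Sg s v → ¬ v ≈ 0#
  sg-≉0 true  p     = 0<⇒≉0 p
  sg-≉0 false (_ , v≉0) = v≉0

  sg⇒0< : ∀ s {v} → Sg s v → T s → 0# < v
  sg⇒0< true p _ = p

  0<⇒sg : ∀ s {v} → Sg s v → 0# < v → T s
  0<⇒sg true  _ _ = _
  0<⇒sg false n p = <-irrefl (<-trans p n)

  -- The field `∂x-zero` is the form in which the reduction of `∂x` modulo `P` enters: the first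
  -- case when it vanishes identically, the second when it has no zero in common with `P`.
  record Setting (D : Pred Carrier 0ℓ) (P ∂x ∂m : Fun₂) : Set where
    field
      convex     : Convex D
      derivative : Derivative P ∂x ∂m
      cong       : ∀ {x m k} → m ≈ k → P x m ≈ P x k
      ∂x-cont    : Continuous ∂x
      ∂m-cont    : Continuous ∂m
      ∂x-zero    : (∀ {x m} → D x → P x m ≈ 0# → ∂x x m ≈ 0#) ⊎ (∀ {x m} → D x → P x m ≈ 0# → ¬ ∂x x m ≈ 0#)

  -- The region between two consecutive zeros of ∂m; Lo and Up say that a point
  -- lies beyond the lower end and before the upper end.
  record Gap (D : Pred Carrier 0ℓ) (P ∂m : Fun₂)
             (Lo Up : Carrier → Carrier → Set) (s s′ : Bool) : Set where
    field
      lo-persists : ∀ {x m} → D x → Lo x m → Near D x (λ y → Lo y m)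
      up-persists : ∀ {x m} → D x → Up x m → Near D x (λ y → Up y m)
      lo-closed   : ∀ {x m k} → Lo x m → m ≤ k → Lo x k
      up-closed   : ∀ {x m k} → Up x m → k ≤ m → Up x k
      ∂m≉0        : ∀ {x m} → D x → Lo x m → Up x m → ¬ ∂m x m ≈ 0#
      start       : ∀ {x m} → D x → Lo x m → Up x m → ∃[ p ] p ≤ m × Lo x p × Sg s (P x p)
      end         : ∀ {x m} → D x → Lo x m → Up x m → ∃[ q ] m ≤ q × Up x q × Sg s′ (P x q)

  neg≈0 : ∀ {a} → a ≈ 0# → - a ≈ 0#
  neg≈0 a≈0 = trans (-‿cong a≈0) -0#≈0#

  neg≈0⁻¹ : ∀ {a} → - a ≈ 0# → a ≈ 0#
  neg≈0⁻¹ {a} -a≈0 = trans (sym (-‿involutive a)) (neg≈0 -a≈0)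

  setting-neg : ∀ {D P ∂x ∂m} → Setting D P ∂x ∂m →
                Setting D (λ x m → - P x m) (λ x m → - ∂x x m) (λ x m → - ∂m x m)
  setting-neg S = record
    { convex     = convex
    ; derivative = derivative-neg derivative
    ; cong       = λ e → -‿cong (cong e)
    ; ∂x-cont    = λ x m → continuous-neg (∂x-cont x m)
    ; ∂m-cont    = λ x m → continuous-neg (∂m-cont x m)
    ; ∂x-zero    = Sum.map (λ f Dx z → neg≈0 (f Dx (neg≈0⁻¹ z))) (λ f Dx z → f Dx (neg≈0⁻¹ z) ∘ neg≈0⁻¹) ∂x-zero
    }
    where open Setting S

  gap-neg : ∀ {D P ∂m Lo Up s s′} → Gap D P ∂m Lo Up s s′ →
            Gap D (λ x m → - P x m) (λ x m → - ∂m x m) Lo Up (not s) (not s′)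
  gap-neg {s = s} {s′} G = record
    { lo-persists = lo-persists
    ; up-persists = up-persists
    ; lo-closed   = lo-closed
    ; up-closed   = up-closed
    ; ∂m≉0        = λ Dx lo up z → ∂m≉0 Dx lo up (neg≈0⁻¹ z)
    ; start       = λ Dx lo up → let p , p≤m , lo′ , sg = start Dx lo up in p , p≤m , lo′ , sg-neg s sg
    ; end         = λ Dx lo up → let q , m≤q , up′ , sg = end Dx lo up in q , m≤q , up′ , sg-neg s′ sg
    }
    where open Gap G

  record GapRoot (D : Pred Carrier 0ℓ) (P : Fun₂)
                 (Lo Up : Carrier → Carrier → Set) (s : Bool) : Set where
    field
      η          : Fun
      lo         : ∀ {x} → D x → Lo x (η x)
      up         : ∀ {x} → D x → Up x (η x)
      root       : ∀ {x} → D x → P x (η x) ≈ 0#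
      before     : ∀ {x m} → D x → Lo x m → m < η x → Sg s (P x m)
      after      : ∀ {x m} → D x → Up x m → η x < m → Sg (not s) (P x m)
      continuous : ContinuousOn D η
      monotone   : (∀ {x y} → D x → D y → x ≤ y → η y ≤ η x) ⊎ (∀ {x y} → D x → D y → x ≤ y → η x ≤ η y)

  gapRoot-neg : ∀ {D P Lo Up s} → GapRoot D (λ x m → - P x m) Lo Up s → GapRoot D P Lo Up (not s)
  gapRoot-neg {s = s} R = record
    { η = η ; lo = lo ; up = up
    ; root       = λ Dx → neg≈0⁻¹ (root Dx)
    ; before     = λ Dx l m<η → sg-neg⁻¹ s (before Dx l m<η)
    ; after      = λ Dx u η<m → sg-neg⁻¹ (not s) (after Dx u η<m)
    ; continuous = continuous
    ; monotone   = monotone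
    }
    where open GapRoot R

  module _ {D : Pred Carrier 0ℓ} {P ∂x ∂m : Fun₂} (S : Setting D P ∂x ∂m) where
    open Setting S

    Rising Falling : Carrier → Carrier → Carrier → Set
    Rising x p q = (∀ {m} → Interval p q m → 0# < ∂m x m) ×
                   (∀ {u v} → Interval p q u → Interval p q v → u < v → P x u < P x v)
    Falling x p q = ∀ {u v} → Interval p q u → Interval p q v → u < v → P x v < P x u

    -- A segment inside the gap avoids the zeros of `∂m`, so `∂m` keeps one sign on it. `Rising`
    -- also records that sign, which `0<∂m` reads off at the root.
    gap-slice : ∀ {Lo Up s s′} → Gap D P ∂m Lo Up s s′ → ∀ {x p q} → D x → Lo x p → Up x q →
                Rising x p q ⊎ Falling x p q
    gap-slice G {x} {p} {q} Dx lo up = by-sign (constant-sign-cases interval-convex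
        (slice-signLocal ∂m-cont x) (λ (p≤m , m≤q) → ∂m≉0 Dx (lo-closed lo p≤m) (up-closed up m≤q)))
      where
      open Gap G
      by-sign : (∀ {m} → Interval p q m → 0# < ∂m x m) ⊎ (∀ {m} → Interval p q m → ∂m x m < 0#) →
                Rising x p q ⊎ Falling x p q
      by-sign (inj₁ pos) = inj₁ (pos , slice-increasing derivative cong interval-convex x pos)
      by-sign (inj₂ neg) = inj₂ λ Iu Iv u<v → flip (slice-increasing (derivative-neg derivative)
        (λ e → -‿cong (cong e)) interval-convex x (λ I → neg-pos (neg I)) Iu Iv u<v)
        where
        flip : ∀ {a b} → - a < - b → b < a
        flip {a} {b} l = 0<⇒< (<⇒0< l) (solve 2 (λ a b → (:- b) :- (:- a) := a :- b) refl a b)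

    -- A monotone function lies between its end values, and both have the sign `s`. The ends
    -- `p ≤ m ≤ q` are chosen inside the gap for the given `m`, so curves and infinite ends are
    -- treated alike.
    no-root : ∀ {Lo Up s} → Gap D P ∂m Lo Up s s → ∀ {x m} → D x → Lo x m → Up x m → Sg s (P x m)
    no-root {Lo} {Up} {s} G {x} {m} Dx lo up = squeeze (start Dx lo up) (end Dx lo up)
      where
      open Gap G
      squeeze : ∃[ p ] p ≤ m × Lo x p × Sg s (P x p) → ∃[ q ] m ≤ q × Up x q × Sg s (P x q) → Sg s (P x m)
      squeeze (p , p≤m , lo-p , sg-p) (q , m≤q , up-q , sg-q) with em {p ≈ m} | em {m ≈ q}
      ... | yes p≈m | _       = sg-resp s (cong p≈m) sg-p
      ... | no _    | yes m≈q = sg-resp s (cong (sym m≈q)) sg-q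
      ... | no p≉m  | no m≉q  = by-slice s sg-p sg-q (gap-slice G Dx lo-p up-q)
        where
        p≤q : p ≤ q
        p≤q = ≤-trans p≤m m≤q
        by-slice : ∀ s → Sg s (P x p) → Sg s (P x q) → Rising x p q ⊎ Falling x p q → Sg s (P x m)
        by-slice true  0<p 0<q (inj₁ (_ , inc)) = <-trans 0<p (inc (≤-refl , p≤q) (p≤m , m≤q) (p≤m , p≉m))
        by-slice true  0<p 0<q (inj₂ dec) = <-trans 0<q (dec (p≤m , m≤q) (p≤q , ≤-refl) (m≤q , m≉q))
        by-slice false p<0 q<0 (inj₁ (_ , inc)) = <-trans (inc (p≤m , m≤q) (p≤q , ≤-refl) (m≤q , m≉q)) q<0
        by-slice false p<0 q<0 (inj₂ dec) = <-trans (dec (≤-refl , p≤q) (p≤m , m≤q) (p≤m , p≉m)) p<0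

    module RisingGap {Lo Up : Carrier → Carrier → Set} (G : Gap D P ∂m Lo Up false true)
                     (inhabited : ∀ {x} → D x → ∃[ m ] Lo x m × Up x m) where
      open Gap G

      record IsRoot (x c : Carrier) : Set where
        field
          lo     : Lo x c
          up     : Up x c
          root   : P x c ≈ 0#
          before : ∀ {m} → Lo x m → m < c → P x m < 0#
          after  : ∀ {m} → Up x m → c < m → 0# < P x m
      open IsRoot

      root-at : ∀ {x} → D x → ∃[ c ] IsRoot x c
      root-at {x} Dx = from-point (inhabited Dx)
        where
        is-root : ∀ {c} → Lo x c → Up x c → P x c ≈ 0# → IsRoot x c
        is-root {c} lo-c up-c Pc≈0 = record
          { lo = lo-c ; up = up-c ; root = Pc≈0
          ; before = λ lo-m m<c → below m<c (start Dx lo-m (up-closed up-c (<⇒≤ m<c)))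
          ; after = λ up-m c<m → above c<m (end Dx (lo-closed lo-c (<⇒≤ c<m)) up-m)
          }
          where
          below : ∀ {m} → m < c → ∃[ p ] p ≤ m × Lo x p × P x p < 0# → P x m < 0#
          below {m} m<c (p , p≤m , lo-p , p<0) = by-slice (gap-slice G Dx lo-p up-c)
            where
            p<c : p < c
            p<c = ≤-<-trans p≤m m<c
            by-slice : Rising x p c ⊎ Falling x p c → P x m < 0#
            by-slice (inj₁ (_ , inc)) = <-respʳ Pc≈0 (inc (p≤m , <⇒≤ m<c) (<⇒≤ p<c , ≤-refl) m<c)
            by-slice (inj₂ dec) = ⊥-elim (<-irrefl (<-trans p<0 (<-respˡ Pc≈0
              (dec (≤-refl , <⇒≤ p<c) (<⇒≤ p<c , ≤-refl) p<c))))
          above : ∀ {m} → c < m → ∃[ q ] m ≤ q × Up x q × 0# < P x q → 0# < P x m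
          above {m} c<m (q , m≤q , up-q , 0<q) = by-slice (gap-slice G Dx lo-c up-q)
            where
            c<q : c < q
            c<q = <-≤-trans c<m m≤q
            by-slice : Rising x c q ⊎ Falling x c q → 0# < P x m
            by-slice (inj₁ (_ , inc)) = <-respˡ Pc≈0 (inc (≤-refl , <⇒≤ c<q) (<⇒≤ c<m , m≤q) c<m)
            by-slice (inj₂ dec) = ⊥-elim (<-irrefl (<-trans 0<q (<-respʳ Pc≈0
              (dec (≤-refl , <⇒≤ c<q) (<⇒≤ c<q , ≤-refl) c<q))))
        between-ends : ∃[ p ] ∃[ q ] p ≤ q × Lo x p × Up x q × P x p < 0# × 0# < P x q → ∃[ c ] IsRoot x c
        between-ends (p , q , p≤q , lo-p , up-q , p<0 , 0<q) =
          from-zero (intermediate-value {f = P x} p≤q (slice-signLocal {F = P} (continuous-derivative derivative) x) p<0 0<q)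
          where
          from-zero : ∃[ c ] Interval p q c × P x c ≈ 0# → ∃[ c ] IsRoot x c
          from-zero (c , (p≤c , c≤q) , Pc≈0) = c , is-root (lo-closed lo-p p≤c) (up-closed up-q c≤q) Pc≈0
        from-point : ∃[ m ] Lo x m × Up x m → ∃[ c ] IsRoot x c
        from-point (m , lo-m , up-m) =
          let p , p≤m , lo-p , p<0 = start Dx lo-m up-m
              q , m≤q , up-q , 0<q = end Dx lo-m up-m
          in between-ends (p , q , ≤-trans p≤m m≤q , lo-p , up-q , p<0 , 0<q)

      abstract
        η : Fun
        η x with em {D x}
        ... | yes Dx = proj₁ (root-at Dx)
        -- An arbitrary default; the root properties of `η` all assume membership in `D`.
        ... | no  _  = 0#

        is-root : ∀ {x} → D x → IsRoot x (η x)
        is-root {x} Dx with em {D x}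
        ... | yes Dx′ = proj₂ (root-at Dx′)
        ... | no  ¬Dx = ⊥-elim (¬Dx Dx)

      left-of-root : ∀ {x m} → D x → Up x m → P x m < 0# → m < η x
      left-of-root {x} {m} Dx up-m neg with compare m (η x)
      ... | lt m<η = m<η
      ... | eq m≈η = ⊥-elim (proj₂ neg (trans (cong m≈η) (root (is-root Dx))))
      ... | gt η<m = ⊥-elim (<-irrefl (<-trans neg (after (is-root Dx) up-m η<m)))

      right-of-root : ∀ {x m} → D x → Lo x m → 0# < P x m → η x < m
      right-of-root {x} {m} Dx lo-m pos with compare m (η x)
      ... | gt η<m = η<m
      ... | eq m≈η = ⊥-elim (0<⇒≉0 pos (trans (cong m≈η) (root (is-root Dx))))
      ... | lt m<η = ⊥-elim (<-irrefl (<-trans pos (before (is-root Dx) lo-m m<η)))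

      below-root : ∀ {s} → D s → ∃[ p ] p < η s × Lo s p
      below-root {s} Ds =
        let p , p≤η , lo-p , p<0 = start Ds (lo (is-root Ds)) (up (is-root Ds))
        in p , (p≤η , λ p≈η → proj₂ p<0 (trans (cong p≈η) (root (is-root Ds)))) , lo-p

      above-root : ∀ {s} → D s → ∃[ q ] η s < q × Up s q
      above-root {s} Ds =
        let q , η≤q , up-q , 0<q = end Ds (lo (is-root Ds)) (up (is-root Ds))
        in q , (η≤q , λ η≈q → 0<⇒≉0 0<q (trans (cong (sym η≈q)) (root (is-root Ds)))) , up-q

      near₂-level : ∀ {s m} {Q : Carrier → Carrier → Set} → Near₂ s m Q → Near D s (λ x → Q x m)
      near₂-level {m = m} (δ , 0<δ , q) = δ , 0<δ , λ x _ sx → q x m sx (small-self refl 0<δ)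

      -- A level just below `η s` makes `P` negative; this persists at the same level for nearby
      -- `x`, and negativity puts the level below `η x`. The other half is symmetric.
      η-continuous : ContinuousOn D η
      η-continuous .ContinuousOn.stays-above {s} {u} Ds u<η = from-point (below-root Ds)
        where
        from-point : ∃[ p ] p < η s × Lo s p → Near D s (λ x → u < η x)
        from-point (p , p<η , lo-p) = near-map
          (λ x Dx (neg , up-x) → ≤-<-trans (≤⊔ˡ u p) (left-of-root Dx up-x neg))
          (near-× (near₂-level {Q = λ x m → P x m < 0#}
                    (continuous-negative (continuous-derivative derivative s (u ⊔ p)) neg-s))
                  (up-persists Ds (up-closed (up (is-root Ds)) (<⇒≤ v<η))))
          where
          -- The level `u` may lie below the gap; raising it to at least `p` brings it inside, still
          -- under the root.
          v<η : u ⊔ p < η s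
          v<η = ⊔-elim (_< η s) u<η p<η
          neg-s : P s (u ⊔ p) < 0#
          neg-s = before (is-root Ds) (lo-closed lo-p (≤⊔ʳ u p)) v<η
      η-continuous .ContinuousOn.stays-below {s} {u} Ds η<u = from-point (above-root Ds)
        where
        from-point : ∃[ q ] η s < q × Up s q → Near D s (λ x → η x < u)
        from-point (q , η<q , up-q) = near-map
          (λ x Dx (pos , lo-x) → <-≤-trans (right-of-root Dx lo-x pos) (⊓≤ˡ u q))
          (near-× (near₂-level {Q = λ x m → 0# < P x m}
                    (continuous-positive (continuous-derivative derivative s (u ⊓ q)) pos-s))
                  (lo-persists Ds (lo-closed (lo (is-root Ds)) (<⇒≤ η<v))))
          where
          η<v : η s < u ⊓ q
          η<v = ⊓-elim (η s <_) η<u η<q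
          pos-s : 0# < P s (u ⊓ q)
          pos-s = after (is-root Ds) (up-closed up-q (⊓≤ʳ u q)) η<v

      0<∂m : ∀ {s} → D s → 0# < ∂m s (η s)
      0<∂m {s} Ds = positive (below-root Ds) (above-root Ds)
        where
        positive : ∃[ p ] p < η s × Lo s p → ∃[ q ] η s < q × Up s q → 0# < ∂m s (η s)
        positive (p , p<η , lo-p) (q , η<q , up-q) = by-slice (gap-slice G Ds lo-p up-q)
          where
          by-slice : Rising s p q ⊎ Falling s p q → 0# < ∂m s (η s)
          by-slice (inj₁ (pos , _)) = pos (<⇒≤ p<η , <⇒≤ η<q)
          by-slice (inj₂ dec) = ⊥-elim (<-irrefl (<-trans (before (is-root Ds) lo-p p<η)
            (<-respˡ (root (is-root Ds)) (dec (≤-refl , <⇒≤ (<-trans p<η η<q)) (<⇒≤ p<η , <⇒≤ η<q) p<η))))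

      -- Passes through `(s , η s)` with slope `e * d`; it is written so that, for `d * d ≈ 1#`, the
      -- parameter along direction `(d , e)` is `h = d * (u - s)`.
      line : Carrier → Carrier → Carrier → Fun
      line s d e u = η s + e * (d * (u - s))

      near-line : ∀ {s ε} d e → 0# < ε → Near D s (λ u → Small ε (line s d e u - η s))
      near-line {s} {ε} d e 0<ε =
        let δ , 0<δ , scale = small-scale (e * d) 0<ε
        in δ , 0<δ , λ u _ su → small-resp (offset (η s) e d (u - s)) (scale su)
        where
        offset : ∀ k e d h → (e * d) * h ≈ (k + e * (d * h)) - k
        offset = solve 4 (λ k e d h → (e :* d) :* h := (k :+ e :* (d :* h)) :- k) refl

      near-line-lo : ∀ {s} d e → D s → Near D s (λ u → Lo u (line s d e u))
      near-line-lo {s} d e Ds = from-point (below-root Ds)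
        where
        cancel : ∀ l k p → (l - k) - (- (k - p)) ≈ l - p
        cancel = solve 3 (λ l k p → (l :- k) :- (:- (k :- p)) := l :- p) refl
        from-point : ∃[ p ] p < η s × Lo s p → Near D s (λ u → Lo u (line s d e u))
        from-point (p , p<η , lo-p) = near-map
          (λ u _ (lo-u , small) → lo-closed lo-u (<⇒≤ (0<⇒< (<⇒0< (Small.lower small)) (cancel (line s d e u) (η s) p))))
          (near-× (lo-persists Ds lo-p) (near-line d e (<⇒0< p<η)))

      near-line-up : ∀ {s} d e → D s → Near D s (λ u → Up u (line s d e u))
      near-line-up {s} d e Ds = from-point (above-root Ds)
        where
        cancel : ∀ l k q → (q - k) - (l - k) ≈ q - l
        cancel = solve 3 (λ l k q → (q :- k) :- (l :- k) := q :- l) refl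
        from-point : ∃[ q ] η s < q × Up s q → Near D s (λ u → Up u (line s d e u))
        from-point (q , η<q , up-q) = near-map
          (λ u _ (up-u , small) → up-closed up-u (<⇒≤ (0<⇒< (<⇒0< (Small.upper small)) (cancel (line s d e u) (η s) q))))
          (near-× (up-persists Ds up-q) (near-line d e (<⇒0< η<q)))

      -- Along the line `P` changes in the sense of `h`, and the sign of `P` at a point of the gap
      -- tells on which side of the root it lies. As `∂m` is positive at the root, the hypothesis
      -- says that `d` times the expected slope -∂x/∂m is less than `e`.
      slope-bound : ∀ {s} d e → d * d ≈ 1# → D s → 0# < d * ∂x s (η s) + e * ∂m s (η s) →
        Near D s (λ u → (0# < d * (u - s) → η u < line s d e u) × (d * (u - s) < 0# → line s d e u < η u))
      slope-bound {s} d e dd≈1 Ds 0<slope = use (directional derivative s (η s) d e 0<slope)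
        where
        along : ∀ d h → d * d ≈ 1# → h ≈ d * (d * h)
        along d h dd≈1 = trans (sym (*-identityˡ h)) (trans (*-congʳ (sym dd≈1)) (*-assoc d d h))
        offset : ∀ k z → (k + z) - k ≈ z
        offset = solve 2 (λ k z → (k :+ z) :- k := z) refl
        use : ∃[ δ ] 0# < δ × (∀ {h x m} → Small δ h → x - s ≈ d * h → m - η s ≈ e * h →
                (0# < h → P s (η s) < P x m) × (h < 0# → P x m < P s (η s))) →
              Near D s (λ u → (0# < d * (u - s) → η u < line s d e u) × (d * (u - s) < 0# → line s d e u < η u))
        use (δ , 0<δ , q) = near-map
          (λ u Du ((lo-u , up-u) , small) →
            let right , left = q small (along d (u - s) dd≈1) (offset (η s) (e * (d * (u - s)))) in
              (λ 0<h → right-of-root Du lo-u (<-respˡ (root (is-root Ds)) (right 0<h)))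
            , (λ h<0 → left-of-root Du up-u (<-respʳ (root (is-root Ds)) (left h<0))))
          (near-× (near-× (near-line-lo d e Ds) (near-line-up d e Ds))
            (let δ′ , 0<δ′ , scale = small-scale d 0<δ in δ′ , 0<δ′ , λ u _ su → scale su))

      -- The choice of `η` carries no respect for `≈`; continuity rules out two values at equal
      -- arguments.
      η-cong : ∀ {s u} → D s → D u → u ≈ s → η u ≈ η s
      η-cong {s} {u} Ds Du u≈s with compare (η u) (η s)
      ... | eq e = e
      ... | lt ηu<ηs = ⊥-elim (at (η-continuous .ContinuousOn.stays-above Ds ηu<ηs))
        where
        at : Near D s (λ x → η u < η x) → ⊥
        at (δ , 0<δ , q) = <-irrefl (q u Du (small-self u≈s 0<δ))
      ... | gt ηs<ηu = ⊥-elim (at (η-continuous .ContinuousOn.stays-below Ds ηs<ηu))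
        where
        at : Near D s (λ x → η x < η u) → ⊥
        at (δ , 0<δ , q) = <-irrefl (q u Du (small-self u≈s 0<δ))

      u<s⇒d<0 : ∀ {u s} → u < s → 1# * (u - s) < 0#
      u<s⇒d<0 {u} {s} u<s = 0<⇒< (<⇒0< u<s) (solve 2 (λ u s → s :- u := :0 :- :1 :* (u :- s)) refl u s)

      s<u⇒d<0 : ∀ {u s} → s < u → - 1# * (u - s) < 0#
      s<u⇒d<0 {u} {s} s<u = 0<⇒< (<⇒0< s<u) (solve 2 (λ u s → u :- s := :0 :- (:- :1) :* (u :- s)) refl u s)

      u<s⇒0<d : ∀ {u s} → u < s → 0# < - 1# * (u - s)
      u<s⇒0<d {u} {s} u<s = <-respʳ (solve 2 (λ u s → s :- u := (:- :1) :* (u :- s)) refl u s) (<⇒0< u<s)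

      -- Since `∂m` is strictly positive at the root, every `e > 0` satisfies the condition of
      -- `slope-bound` with `d = 1#`, even where `∂x` vanishes.
      antitone : (∀ {s} → D s → 0# ≤ ∂x s (η s)) → ∀ {x y} → D x → D y → x ≤ y → η y ≤ η x
      antitone 0≤∂x = local-slopes⇒antitone {D} {η} convex λ {e} 0<e {s} Ds → near-map
        (λ u Du (below , above) → left e Ds Du above , right e Ds Du below)
        (slope-bound 1# e (*-identityˡ 1#) Ds (<-respʳ (+-comm _ _)
          (0<+ (0<* 0<e (0<∂m Ds)) (≤-respʳ-≈ (sym (*-identityˡ _)) (0≤∂x Ds)))))
        where
        right : ∀ {s u} e → D s → D u → (0# < 1# * (u - s) → η u < line s 1# e u) → s ≤ u → η u ≤ η s + e * (u - s)
        right {s} {u} e Ds Du f s≤u with em {u ≈ s}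
        ... | yes u≈s = flat e (η-cong Ds Du u≈s) u≈s
        ... | no  u≉s = <⇒≤ (<-respʳ (+-congˡ (*-congˡ (*-identityˡ _)))
          (f (<-respʳ (sym (*-identityˡ _)) (<⇒0< (s≤u , u≉s ∘ sym)))))
        difference : ∀ a b e u s → b - (a + e * (1# * (u - s))) ≈ (b + e * (s - u)) - a
        difference = solve 5 (λ a b e u s → b :- (a :+ e :* (:1 :* (u :- s))) := (b :+ e :* (s :- u)) :- a) refl
        left : ∀ {s u} e → D s → D u → (1# * (u - s) < 0# → line s 1# e u < η u) → u ≤ s → η s ≤ η u + e * (s - u)
        left {s} {u} e Ds Du f u≤s with em {u ≈ s}
        ... | yes u≈s = flat e (sym (η-cong Ds Du u≈s)) (sym u≈s)
        ... | no  u≉s = 0≤⇒≤ (0≤b-a (f (u<s⇒d<0 (u≤s , u≉s)))) (difference (η s) (η u) e u s)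

      -- With `d = - 1#` the tracing lines have slope `- e`; the resulting bounds, read for `- η`,
      -- are those of the antitone criterion.
      monotone : (∀ {s} → D s → ∂x s (η s) ≤ 0#) → ∀ {x y} → D x → D y → x ≤ y → η x ≤ η y
      monotone ∂x≤0 {x} {y} Dx Dy x≤y = 0≤⇒≤ (≤⇒0≤ (neg-antitone Dx Dy x≤y)) (swap (η x) (η y))
        where
        swap : ∀ a b → - a - (- b) ≈ b - a
        swap = solve 2 (λ a b → :- a :- (:- b) := b :- a) refl
        0≤-1* : ∀ {a} → a ≤ 0# → 0# ≤ - 1# * a
        0≤-1* {a} a≤0 = ≤-respʳ-≈ (solve 1 (λ a → :0 :- a := (:- :1) :* a) refl a) (≤⇒0≤ a≤0)
        right-difference : ∀ a b e u s → b - (a + e * (- 1# * (u - s))) ≈ (- a + e * (u - s)) - (- b)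
        right-difference = solve 5 (λ a b e u s → b :- (a :+ e :* ((:- :1) :* (u :- s)))
          := (:- a :+ e :* (u :- s)) :- (:- b)) refl
        left-difference : ∀ a b e u s → (a + e * (- 1# * (u - s))) - b ≈ (- b + e * (s - u)) - (- a)
        left-difference = solve 5 (λ a b e u s → (a :+ e :* ((:- :1) :* (u :- s))) :- b
          := (:- b :+ e :* (s :- u)) :- (:- a)) refl
        right : ∀ {s u} e → D s → D u → (- 1# * (u - s) < 0# → line s (- 1#) e u < η u) →
                s ≤ u → - η u ≤ - η s + e * (u - s)
        right {s} {u} e Ds Du f s≤u with em {u ≈ s}
        ... | yes u≈s = flat e (-‿cong (η-cong Ds Du u≈s)) u≈s
        ... | no  u≉s = 0≤⇒≤ (0≤b-a (f (s<u⇒d<0 (s≤u , u≉s ∘ sym)))) (right-difference (η s) (η u) e u s)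
        left : ∀ {s u} e → D s → D u → (0# < - 1# * (u - s) → η u < line s (- 1#) e u) →
               u ≤ s → - η s ≤ - η u + e * (s - u)
        left {s} {u} e Ds Du f u≤s with em {u ≈ s}
        ... | yes u≈s = flat e (-‿cong (sym (η-cong Ds Du u≈s))) (sym u≈s)
        ... | no  u≉s = 0≤⇒≤ (0≤b-a (f (u<s⇒0<d (u≤s , u≉s)))) (left-difference (η s) (η u) e u s)
        neg-antitone : ∀ {x y} → D x → D y → x ≤ y → - η y ≤ - η x
        neg-antitone = local-slopes⇒antitone {D} {λ x → - η x} convex λ {e} 0<e {s} Ds → near-map
          (λ u Du (below , above) → left e Ds Du below , right e Ds Du above)
          (slope-bound (- 1#) e (solve 0 ((:- :1) :* (:- :1) := :1) refl) Ds (<-respʳ (+-comm _ _)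
            (0<+ (0<* 0<e (0<∂m Ds)) (0≤-1* (∂x≤0 Ds)))))

      ∂x-weak-sign : (∀ {s} → D s → 0# ≤ ∂x s (η s)) ⊎ (∀ {s} → D s → ∂x s (η s) ≤ 0#)
      ∂x-weak-sign = by-cases ∂x-zero
        where
        by-cases : (∀ {x m} → D x → P x m ≈ 0# → ∂x x m ≈ 0#) ⊎ (∀ {x m} → D x → P x m ≈ 0# → ¬ ∂x x m ≈ 0#) →
                   (∀ {s} → D s → 0# ≤ ∂x s (η s)) ⊎ (∀ {s} → D s → ∂x s (η s) ≤ 0#)
        by-cases (inj₁ zero) = inj₁ λ Ds → ≤-reflexive (sym (zero Ds (root (is-root Ds))))
        by-cases (inj₂ nonzero) = Sum.map (λ pos Ds → <⇒≤ (pos Ds)) (λ neg Ds → <⇒≤ (neg Ds))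
          (constant-sign-cases {f = λ x → ∂x x (η x)} convex (curve-signLocal {η = η} {F = ∂x} η-continuous ∂x-cont)
            (λ Ds → nonzero Ds (root (is-root Ds))))

      rising-root : GapRoot D P Lo Up false
      rising-root = record
        { η = η
        ; lo         = λ Dx → lo (is-root Dx)
        ; up         = λ Dx → up (is-root Dx)
        ; root       = λ Dx → root (is-root Dx)
        ; before     = λ Dx → before (is-root Dx)
        ; after      = λ Dx → after (is-root Dx)
        ; continuous = η-continuous
        ; monotone   = Sum.map antitone monotone ∂x-weak-sign
        }

  gap-root : ∀ {D P ∂x ∂m Lo Up} s → Setting D P ∂x ∂m → Gap D P ∂m Lo Up s (not s) →
             (∀ {x} → D x → ∃[ m ] Lo x m × Up x m) → GapRoot D P Lo Up s
  gap-root false S G inhabited = RisingGap.rising-root S G inhabited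
  gap-root true  S G inhabited = gapRoot-neg (RisingGap.rising-root (setting-neg S) (gap-neg G) inhabited)

-- Sign sets of polynomials near a germ, by induction on the degree in m.

module Tame (em : ExcludedMiddle 0ℓ) (ℝ : RealNumbers) (𝒢 : Germs.Germ em ℝ) where

  open import Data.Nat.Base as ℕ using (ℕ; zero; suc)
  open import Data.List.Base using (List; []; _∷_; _++_)
  open import Data.List.Relation.Unary.All as All using (All; []; _∷_)
  import Data.List.Relation.Unary.All.Properties as All
  open import Data.List.Relation.Unary.Any as Any using (Any; here; there)
  import Data.List.Relation.Unary.Any.Properties as Any
  open import Data.List.Relation.Unary.AllPairs using (AllPairs; []; _∷_)
  open ≡ using (_≢_)
  open OrderedField em ℝ
  open Calculus em ℝ
  open Polynomials em ℝ
  open Branches em ℝ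
  open Division em ℝ 𝒢
  open Germs em ℝ
  open RealNumbers ℝ hiding (zero)
  open RawSemiringDefs (Semiring.rawSemiring semiring) using (_^_) renaming (_×_ to _·_)
  open Germ 𝒢 hiding (convex)
  open Leading

  𝔐-resp : ∀ {V W : Pred Plane 0ℓ} → (∀ {z} → V z → W z) → (∀ {z} → W z → V z) → 𝔐 V → 𝔐 W
  𝔐-resp f g = resp-≐ (f , g)

  module _ {_⊑_ : Carrier → Carrier → Set} (generate : ∀ {W} → UpSet _⊑_ W → 𝔐 W)
           (⊑-refl : ∀ {m} → m ⊑ m) (⊑-trans : ∀ {k m n} → k ⊑ m → m ⊑ n → k ⊑ n) where

    -- A set that is closed upwards only within a strip is that strip intersected with the upward
    -- closure of the set in the whole plane.
    strip-up : ∀ r {W : Pred Plane 0ℓ} → (∀ {x m} → W (x , m) → r ∋ x) →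
      (∀ {x m x′ m′} → W (x , m) → r ∋ x′ → x ≤ x′ → m ⊑ m′ → W (x′ , m′)) → 𝔐 W
    strip-up r {W} W⊆r up = 𝔐-resp
      (λ (x∈r , (x , m) , w , x≤ , m⊑) → up w x∈r x≤ m⊑)
      (λ {z} w → W⊆r w , z , w , ≤-refl , ⊑-refl)
      (intersection (strip r) (generate {λ (x′ , m′) → ∃[ z ] W z × proj₁ z ≤ x′ × proj₂ z ⊑ m′}
        λ (z , w , x≤ , m⊑) x≤x′ m⊑m′ → z , w , ≤-trans x≤ x≤x′ , ⊑-trans m⊑ m⊑m′))

  strip-NE : ∀ r {W : Pred Plane 0ℓ} → (∀ {x m} → W (x , m) → r ∋ x) →
    (∀ {x m x′ m′} → W (x , m) → r ∋ x′ → x ≤ x′ → m ≤ m′ → W (x′ , m′)) → 𝔐 W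
  strip-NE = strip-up 𝔐-NE ≤-refl ≤-trans

  strip-NW : ∀ r {W : Pred Plane 0ℓ} → (∀ {x m} → W (x , m) → r ∋ x) →
    (∀ {x m x′ m′} → W (x , m) → r ∋ x′ → x ≤ x′ → m′ ≤ m → W (x′ , m′)) → 𝔐 W
  strip-NW = strip-up 𝔐-NW ≤-refl (λ p q → ≤-trans q p)

  Below Above Graph : Nbhd → Fun → Pred Plane 0ℓ
  Below r η (x , m) = r ∋ x × m < η x
  Above r η (x , m) = r ∋ x × η x < m
  Graph r η (x , m) = r ∋ x × m ≈ η x

  -- Above a non-increasing function the region is closed upwards in both coordinates; below a
  -- non-decreasing one it is closed upwards in `x` and downwards in `m`. The opposite region is the
  -- complement within the strip of a set of the same kind that includes the graph.
  below-and-above : ∀ r {η} →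
    (∀ {x y} → r ∋ x → r ∋ y → x ≤ y → η y ≤ η x) ⊎ (∀ {x y} → r ∋ x → r ∋ y → x ≤ y → η x ≤ η y) →
    𝔐 (Below r η) × 𝔐 (Above r η)
  below-and-above r {η} (inj₁ anti) =
      𝔐-resp (λ (x∈r , ¬η≤m) → x∈r , ≰⇒> (λ η≤m → ¬η≤m (x∈r , η≤m)))
             (λ (x∈r , m<η) → x∈r , λ (_ , η≤m) → <⇒≱ m<η η≤m)
        (intersection (strip r) (complement (strip-NE r {λ (x , m) → r ∋ x × η x ≤ m} proj₁
          λ (x∈r , η≤m) x′∈r x≤ m≤ → x′∈r , ≤-trans (anti x∈r x′∈r x≤) (≤-trans η≤m m≤))))
    , strip-NE r proj₁ (λ (x∈r , η<m) x′∈r x≤ m≤ → x′∈r , ≤-<-trans (anti x∈r x′∈r x≤) (<-≤-trans η<m m≤))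
  below-and-above r {η} (inj₂ mono) =
      strip-NW r proj₁ (λ (x∈r , m<η) x′∈r x≤ m≥ → x′∈r , ≤-<-trans m≥ (<-≤-trans m<η (mono x∈r x′∈r x≤)))
    , 𝔐-resp (λ (x∈r , ¬m≤η) → x∈r , ≰⇒> (λ m≤η → ¬m≤η (x∈r , m≤η)))
             (λ (x∈r , η<m) → x∈r , λ (_ , m≤η) → <⇒≱ η<m m≤η)
        (intersection (strip r) (complement (strip-NW r {λ (x , m) → r ∋ x × m ≤ η x} proj₁
          λ (x∈r , m≤η) x′∈r x≤ m≥ → x′∈r , ≤-trans m≥ (≤-trans m≤η (mono x∈r x′∈r x≤)))))

  graph∈𝔐 : ∀ r {η} → 𝔐 (Below r η) × 𝔐 (Above r η) → 𝔐 (Graph r η)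
  graph∈𝔐 r {η} (b , a) = 𝔐-resp
    (λ {(x , m)} (x∈r , ¬b , ¬a) → x∈r , level (compare m (η x)) (λ p → ¬b (x∈r , p)) (λ p → ¬a (x∈r , p)))
    (λ (x∈r , m≈η) → x∈r , (λ (_ , m<η) → proj₂ m<η m≈η) , (λ (_ , η<m) → proj₂ η<m (sym m≈η)))
    (intersection (strip r) (intersection (complement b) (complement a)))
    where
    level : ∀ {m k} → Trichotomy m k → ¬ m < k → ¬ k < m → m ≈ k
    level (lt m<k) ¬lt _ = ⊥-elim (¬lt m<k)
    level (eq m≈k) _ _   = m≈k
    level (gt k<m) _ ¬gt = ⊥-elim (¬gt k<m)

  OneOf : Carrier → Carrier → List Fun → Set
  OneOf x m = Any (λ η → m ≈ η x)

  _≤ᶠ_ : (ν τ : Fun) → Set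
  ν ≤ᶠ τ = ∀ x → ν x ≤ τ x

  -- The zeros of P beyond Lo, and a set in 𝔐 which beyond Lo is the set where P
  -- is positive and before Lo extends the sign s that P has just beyond Lo.
  record Description (r : Nbhd) (P : Fun₂)
                     (Lo : Carrier → Carrier → Set) (s : Bool) : Set₁ where
    field
      roots      : List Fun
      continuous : All (ContinuousOn (r ∋_)) roots
      graphs     : All (λ η → 𝔐 (Graph r η)) roots
      sound      : ∀ {x m} → r ∋ x → OneOf x m roots → P x m ≈ 0#
      complete   : ∀ {x m} → r ∋ x → Lo x m → P x m ≈ 0# → OneOf x m roots
      W          : Pred Plane 0ℓ
      W∈𝔐        : 𝔐 W
      inside⇒    : ∀ {x m} → r ∋ x → Lo x m → W (x , m) → 0# < P x m
      inside⇐    : ∀ {x m} → r ∋ x → Lo x m → 0# < P x m → W (x , m)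
      outside⇒   : ∀ {x m} → r ∋ x → ¬ Lo x m → W (x , m) → T s
      outside⇐   : ∀ {x m} → r ∋ x → ¬ Lo x m → T s → W (x , m)

  ¬¬-elim : ∀ {A : Set} → ¬ ¬ A → A
  ¬¬-elim {A} ¬¬a with em {A}
  ... | yes a = a
  ... | no ¬a = ⊥-elim (¬¬a ¬a)

  module Describe (r : Nbhd) {P ∂x ∂m : Fun₂} (S : Setting (r ∋_) P ∂x ∂m)
                  (unbounded : ∀ {x} → r ∋ x → ∀ m → ∃[ q ] m ≤ q × 0# < P x q) where
    open Setting S

    -- The gap has no root, so the old `W` serves: before `Up` it already continues the sign `s`.
    -- The hypothesis `edge` concerns points neither beyond `Lo` nor before `Up`, which appear where
    -- the gap closes up.
    extend-same : ∀ {Lo Up s} → Gap (r ∋_) P ∂m Lo Up s s →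
      (∀ {x m} → r ∋ x → ¬ Lo x m → ¬ Up x m → Sg s (P x m)) →
      Description r P (λ x m → ¬ Up x m) s → Description r P Lo s
    extend-same {Lo} {Up} {s} G edge R = record
      { roots = roots ; continuous = continuous ; graphs = graphs ; sound = sound ; W = W ; W∈𝔐 = W∈𝔐
      ; complete = complete′
      ; inside⇒  = inside⇒′
      ; inside⇐  = inside⇐′
      ; outside⇒ = outside⇒′
      ; outside⇐ = outside⇐′
      }
      where
      open Description R
      complete′ : ∀ {x m} → r ∋ x → Lo x m → P x m ≈ 0# → OneOf x m roots
      complete′ {x} {m} x∈r lo z with em {Up x m}
      ... | yes up = ⊥-elim (sg-≉0 s (no-root S G x∈r lo up) z)
      ... | no ¬up = complete x∈r ¬up z
      inside⇒′ : ∀ {x m} → r ∋ x → Lo x m → W (x , m) → 0# < P x m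
      inside⇒′ {x} {m} x∈r lo w with em {Up x m}
      ... | yes up = sg⇒0< s (no-root S G x∈r lo up) (outside⇒ x∈r (λ ¬up → ¬up up) w)
      ... | no ¬up = inside⇒ x∈r ¬up w
      inside⇐′ : ∀ {x m} → r ∋ x → Lo x m → 0# < P x m → W (x , m)
      inside⇐′ {x} {m} x∈r lo p with em {Up x m}
      ... | yes up = outside⇐ x∈r (λ ¬up → ¬up up) (0<⇒sg s (no-root S G x∈r lo up) p)
      ... | no ¬up = inside⇐ x∈r ¬up p
      outside⇒′ : ∀ {x m} → r ∋ x → ¬ Lo x m → W (x , m) → T s
      outside⇒′ {x} {m} x∈r ¬lo w with em {Up x m}
      ... | yes up = outside⇒ x∈r (λ ¬up → ¬up up) w
      ... | no ¬up = 0<⇒sg s (edge x∈r ¬lo ¬up) (inside⇒ x∈r ¬up w)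
      outside⇐′ : ∀ {x m} → r ∋ x → ¬ Lo x m → T s → W (x , m)
      outside⇐′ {x} {m} x∈r ¬lo t with em {Up x m}
      ... | yes up = outside⇐ x∈r (λ ¬up → ¬up up) t
      ... | no ¬up = inside⇐ x∈r ¬up (sg⇒0< s (edge x∈r ¬lo ¬up) t)

    const∈𝔐 : ∀ s → 𝔐 (λ _ → T s)
    const∈𝔐 true  = 𝔐-resp id id 𝔐-U
    const∈𝔐 false = 𝔐-resp id id 𝔐-∅

    -- Below the root `η` the new set has the constant sign `s`, also before `Lo`; above `η` it is
    -- the old `W`, which continues `not s` down past `Up`. The only new boundary is the graph of
    -- the monotone `η`, never that of a node.
    extend-differ : ∀ {Lo Up s} → (∀ {x m k} → Lo x m → m ≤ k → Lo x k) →
      GapRoot (r ∋_) P Lo Up s → Description r P (λ x m → ¬ Up x m) (not s) → Description r P Lo s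
    extend-differ {Lo} {Up} {s} lo-closed G R = record
      { roots      = η ∷ roots
      ; continuous = continuous-η ∷ continuous
      ; graphs     = graph∈𝔐 r sides ∷ graphs
      ; sound      = sound′
      ; complete   = complete′
      ; W          = W′
      ; W∈𝔐        = union (intersection (const∈𝔐 s) (proj₁ sides)) (intersection (proj₂ sides) W∈𝔐)
      ; inside⇒    = inside⇒′
      ; inside⇐    = inside⇐′
      ; outside⇒   = outside⇒′
      ; outside⇐   = λ x∈r ¬lo t → inj₁ (t , x∈r , before-root x∈r ¬lo)
      }
      where
      open Description R
      open GapRoot G renaming (continuous to continuous-η)
      sides : 𝔐 (Below r η) × 𝔐 (Above r η)
      sides = below-and-above r monotone
      W′ : Pred Plane 0ℓ
      W′ z = (T s × Below r η z) ⊎ (Above r η z × W z)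
      before-root : ∀ {x m} → r ∋ x → ¬ Lo x m → m < η x
      before-root x∈r ¬lo = ≰⇒> λ η≤m → ¬lo (lo-closed (lo x∈r) η≤m)
      sound′ : ∀ {x m} → r ∋ x → OneOf x m (η ∷ roots) → P x m ≈ 0#
      sound′ x∈r (here m≈η) = trans (cong m≈η) (root x∈r)
      sound′ x∈r (there a)  = sound x∈r a
      complete′ : ∀ {x m} → r ∋ x → Lo x m → P x m ≈ 0# → OneOf x m (η ∷ roots)
      complete′ {x} {m} x∈r lo z with compare m (η x) | em {Up x m}
      ... | lt m<η | _      = ⊥-elim (sg-≉0 s (before x∈r lo m<η) z)
      ... | eq m≈η | _      = here m≈η
      ... | gt η<m | yes up = ⊥-elim (sg-≉0 (not s) (after x∈r up η<m) z)
      ... | gt η<m | no ¬up = there (complete x∈r ¬up z)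
      beyond⇒ : ∀ {x m} → r ∋ x → η x < m → W (x , m) → 0# < P x m
      beyond⇒ {x} {m} x∈r η<m w with em {Up x m}
      ... | yes up = sg⇒0< (not s) (after x∈r up η<m) (outside⇒ x∈r (λ ¬up → ¬up up) w)
      ... | no ¬up = inside⇒ x∈r ¬up w
      beyond⇐ : ∀ {x m} → r ∋ x → η x < m → 0# < P x m → W (x , m)
      beyond⇐ {x} {m} x∈r η<m p with em {Up x m}
      ... | yes up = outside⇐ x∈r (λ ¬up → ¬up up) (0<⇒sg (not s) (after x∈r up η<m) p)
      ... | no ¬up = inside⇐ x∈r ¬up p
      inside⇒′ : ∀ {x m} → r ∋ x → Lo x m → W′ (x , m) → 0# < P x m
      inside⇒′ x∈r lo (inj₁ (t , _ , m<η)) = sg⇒0< s (before x∈r lo m<η) t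
      inside⇒′ x∈r lo (inj₂ ((_ , η<m) , w)) = beyond⇒ x∈r η<m w
      inside⇐′ : ∀ {x m} → r ∋ x → Lo x m → 0# < P x m → W′ (x , m)
      inside⇐′ {x} {m} x∈r lo p with compare m (η x)
      ... | lt m<η = inj₁ (0<⇒sg s (before x∈r lo m<η) p , x∈r , m<η)
      ... | eq m≈η = ⊥-elim (0<⇒≉0 p (trans (cong m≈η) (root x∈r)))
      ... | gt η<m = inj₂ ((x∈r , η<m) , beyond⇐ x∈r η<m p)
      outside⇒′ : ∀ {x m} → r ∋ x → ¬ Lo x m → W′ (x , m) → T s
      outside⇒′ x∈r ¬lo (inj₁ (t , _)) = t
      outside⇒′ x∈r ¬lo (inj₂ ((_ , η<m) , _)) = ⊥-elim (<-irrefl (<-trans η<m (before-root x∈r ¬lo)))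

    -- Points of the gap are asked for only when the signs differ: neighbouring nodes may touch over
    -- some `x`, and there `P` has the same sign at both.
    extend : ∀ {Lo Up} s s′ → Gap (r ∋_) P ∂m Lo Up s s′ →
      (∀ {x m} → r ∋ x → ¬ Lo x m → ¬ Up x m → Sg s′ (P x m)) →
      (∀ {x} → r ∋ x → s′ ≢ s → ∃[ m ] Lo x m × Up x m) →
      Description r P (λ x m → ¬ Up x m) s′ → Description r P Lo s
    extend true  true  G edge _ R = extend-same G edge R
    extend false false G edge _ R = extend-same G edge R
    extend true  false G _ inhabited R =
      extend-differ (Gap.lo-closed G) (gap-root true S G (λ x∈r → inhabited x∈r λ ())) R
    extend false true  G _ inhabited R =
      extend-differ (Gap.lo-closed G) (gap-root false S G (λ x∈r → inhabited x∈r λ ())) R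

    -- The invariant of the recursion over the sorted nodes: the list accounts for the zeros of `∂m`
    -- still ahead, and `s` is the sign of `P` just beyond the lower end. The field `gap` later
    -- shows that the next gap is inhabited if `P` changes sign across it.
    record LowerEnd (nodes : List Fun) (Lo : Carrier → Carrier → Set) (s : Bool) : Set where
      field
        persists  : ∀ {x m} → r ∋ x → Lo x m → Near (r ∋_) x (λ y → Lo y m)
        closed    : ∀ {x m k} → Lo x m → m ≤ k → Lo x k
        start     : ∀ {x m} → r ∋ x → Lo x m → ∃[ p ] p ≤ m × Lo x p × Sg s (P x p)
        zeros     : ∀ {x m} → r ∋ x → Lo x m → ∂m x m ≈ 0# → OneOf x m nodes
        inhabited : ∀ {x} → r ∋ x → ∃[ m ] Lo x m
        below     : All (λ ν → ∀ {x m} → r ∋ x → ¬ Lo x m → m ≤ ν x) nodes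
        gap       : All (λ ν → ∀ {x} → r ∋ x → Sg (not s) (P x (ν x)) → ∃[ m ] Lo x m × m < ν x) nodes

    record Nodes (nodes : List Fun) : Set where
      field
        continuous : All (ContinuousOn (r ∋_)) nodes
        nonzero    : All (λ ν → ∀ {x} → r ∋ x → ¬ P x (ν x) ≈ 0#) nodes
        sorted     : AllPairs _≤ᶠ_ nodes

    sg-differ : ∀ s s′ {v} → s′ ≢ s → Sg s′ v → Sg (not s) v
    sg-differ true  true  s≢ _ = ⊥-elim (s≢ ≡.refl)
    sg-differ true  false _ sg = sg
    sg-differ false true  _ sg = sg
    sg-differ false false s≢ _ = ⊥-elim (s≢ ≡.refl)

    near-sign : ∀ s {x m} → Sg s (P x m) → Near U m (λ k → Sg s (P x k))
    near-sign true  {x} {m} = proj₁ (slice-signLocal {E = U} {F = P} (continuous-derivative derivative) x {m} tt)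
    near-sign false {x} {m} = proj₂ (slice-signLocal {E = U} {F = P} (continuous-derivative derivative) x {m} tt)

    sign-just-above : ∀ s {x k m} → Sg s (P x k) → k < m → ∃[ p ] p ≤ m × k < p × Sg s (P x p)
    sign-just-above s {x} {k} {m} sg k<m = pick (near-sign s sg)
      where
      pick : Near U k (λ p → Sg s (P x p)) → ∃[ p ] p ≤ m × k < p × Sg s (P x p)
      pick (δ , 0<δ , q) = m ⊓ (k + half δ) , ⊓≤ˡ m (k + half δ) , k<p
        , q _ tt (small-above 0<δ (<⇒≤ k<p) (⊓≤ʳ m (k + half δ)))
        where
        k<p : k < m ⊓ (k + half δ)
        k<p = ⊓-elim (k <_) k<m (a+b>a (0<half 0<δ))

    sign-just-below : ∀ s {x k m} → Sg s (P x k) → m < k → ∃[ q ] m ≤ q × q < k × Sg s (P x q)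
    sign-just-below s {x} {k} {m} sg m<k = pick (near-sign s sg)
      where
      pick : Near U k (λ q → Sg s (P x q)) → ∃[ q ] m ≤ q × q < k × Sg s (P x q)
      pick (δ , 0<δ , near) = m ⊔ (k - half δ) , ≤⊔ˡ m (k - half δ) , q<k
        , near _ tt (small-below 0<δ (<-≤-trans k-δ< (≤⊔ʳ m (k - half δ))) (<⇒≤ q<k))
        where
        q<k : m ⊔ (k - half δ) < k
        q<k = ⊔-elim (_< k) m<k (a-b<a (0<half 0<δ))
        k-δ< : k - δ < k - half δ
        k-δ< = 0<⇒< (<⇒0< (half< 0<δ)) (difference k δ (half δ))
          where
          difference : ∀ k d h → d - h ≈ (k - h) - (k - d)
          difference = solve 3 (λ k d h → d :- h := (k :- h) :- (k :- d)) refl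

    module AtNode {ν : Fun} {nodes : List Fun} {Lo : Carrier → Carrier → Set} {s : Bool}
                  (N : Nodes (ν ∷ nodes)) (L : LowerEnd (ν ∷ nodes) Lo s)
                  (s′ : Bool) (sign-at : ∀ {x} → r ∋ x → Sg s′ (P x (ν x))) where
      open LowerEnd L

      ν-continuous : ContinuousOn (r ∋_) ν
      ν-continuous = All.head (Nodes.continuous N)

      ν≤ : All (ν ≤ᶠ_) nodes
      ν≤ with Nodes.sorted N
      ... | p ∷ _ = p

      tail : Nodes nodes
      tail = record
        { continuous = All.tail (Nodes.continuous N)
        ; nonzero    = All.tail (Nodes.nonzero N)
        ; sorted     = sorted-tail (Nodes.sorted N)
        }
        where
        sorted-tail : AllPairs _≤ᶠ_ (ν ∷ nodes) → AllPairs _≤ᶠ_ nodes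
        sorted-tail (_ ∷ p) = p

      above⇒lo : ∀ {x m} → r ∋ x → ν x < m → Lo x m
      above⇒lo x∈r ν<m = ¬¬-elim λ ¬lo → <⇒≱ ν<m (All.head below x∈r ¬lo)

      above-node : LowerEnd nodes (λ x m → ν x < m) s′
      above-node = record
        { persists  = ν-continuous .ContinuousOn.stays-below
        ; closed    = <-≤-trans
        ; start     = λ x∈r ν<m → sign-just-above s′ (sign-at x∈r) ν<m
        ; zeros     = λ x∈r ν<m z → beyond ν<m (zeros x∈r (above⇒lo x∈r ν<m) z)
        ; inhabited = λ {x} _ → ν x + 1# , a+b>a 0<1
        ; below     = All.map (λ ν≤τ {x} {m} _ ¬ν<m → ≤-trans (≮⇒≥ ¬ν<m) (ν≤τ x)) ν≤
        ; gap       = All.map (λ ν≤τ {x} x∈r sg → let c , ν<c , c<τ = between (apart (ν≤τ x) (sign-at x∈r) sg) in c , ν<c , c<τ) ν≤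
        }
        where
        ≮⇒≥ : ∀ {x y} → ¬ x < y → y ≤ x
        ≮⇒≥ {x} {y} x≮y with ≤-<-cases y x
        ... | inj₁ y≤x = y≤x
        ... | inj₂ x<y = ⊥-elim (x≮y x<y)
        beyond : ∀ {x m} → ν x < m → OneOf x m (ν ∷ nodes) → OneOf x m nodes
        beyond ν<m (here m≈ν) = ⊥-elim (proj₂ ν<m (sym m≈ν))
        beyond ν<m (there a)  = a
        apart : ∀ {x k l} → k ≤ l → Sg s′ (P x k) → Sg (not s′) (P x l) → k < l
        apart k≤l sg sg′ = k≤l , λ k≈l → sg-opposite s′ sg (sg-resp (not s′) (cong (sym k≈l)) sg′)

      gap-below : Gap (r ∋_) P ∂m Lo (λ x m → m < ν x) s s′
      gap-below = record
        { lo-persists = persists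
        ; up-persists = ν-continuous .ContinuousOn.stays-above
        ; lo-closed   = closed
        ; up-closed   = λ m<ν k≤m → ≤-<-trans k≤m m<ν
        ; ∂m≉0        = λ x∈r lo m<ν z → before m<ν (zeros x∈r lo z)
        ; start       = λ x∈r lo _ → start x∈r lo
        ; end         = λ x∈r _ m<ν → sign-just-below s′ (sign-at x∈r) m<ν
        }
        where
        not-later : ∀ {x m ns} → m < ν x → All (ν ≤ᶠ_) ns → OneOf x m ns → ⊥
        not-later {x} m<ν (ν≤τ ∷ _)  (here m≈τ) = <⇒≱ m<ν (≤-respʳ-≈ (sym m≈τ) (ν≤τ x))
        not-later     m<ν (_ ∷ rest) (there a)  = not-later m<ν rest a
        before : ∀ {x m} → m < ν x → OneOf x m (ν ∷ nodes) → ⊥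
        before m<ν (here m≈ν) = proj₂ m<ν m≈ν
        before m<ν (there a)  = not-later m<ν ν≤ a

      -- Fills in the node itself, where `P` has exactly the sign `s′` with which `W` is already
      -- continued.
      from-node : Description r P (λ x m → ν x < m) s′ → Description r P (λ x m → ¬ m < ν x) s′
      from-node R = record
        { roots = roots ; continuous = continuous ; graphs = graphs ; sound = sound ; W = W ; W∈𝔐 = W∈𝔐
        ; complete = λ x∈r m≮ν z → by-cases {OneOf _ _ _} m≮ν
            (λ m≈ν → ⊥-elim (sg-≉0 s′ (sg-resp s′ (cong (sym m≈ν)) (sign-at x∈r)) z))
            (λ ν<m → complete x∈r ν<m z)
        ; inside⇒  = λ x∈r m≮ν w → by-cases {0# < _} m≮ν
            (λ m≈ν → sg⇒0< s′ (sg-resp s′ (cong (sym m≈ν)) (sign-at x∈r)) (outside⇒ x∈r (proj₂′ m≈ν) w))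
            (λ ν<m → inside⇒ x∈r ν<m w)
        ; inside⇐  = λ {x} {m} x∈r m≮ν p → by-cases {W (x , m)} m≮ν
            (λ m≈ν → outside⇐ x∈r (proj₂′ m≈ν) (0<⇒sg s′ (sg-resp s′ (cong (sym m≈ν)) (sign-at x∈r)) p))
            (λ ν<m → inside⇐ x∈r ν<m p)
        ; outside⇒ = λ x∈r ¬m≮ν → outside⇒ x∈r (λ ν<m → <-irrefl (<-trans ν<m (¬¬-elim ¬m≮ν)))
        ; outside⇐ = λ x∈r ¬m≮ν → outside⇐ x∈r (λ ν<m → <-irrefl (<-trans ν<m (¬¬-elim ¬m≮ν)))
        }
        where
        open Description R
        proj₂′ : ∀ {m k} → m ≈ k → ¬ k < m
        proj₂′ m≈k k<m = proj₂ k<m (sym m≈k)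
        by-cases : ∀ {A : Set} {m k} → ¬ m < k → (m ≈ k → A) → (k < m → A) → A
        by-cases {A} {m} {k} m≮k f g with compare m k
        ... | lt m<k = ⊥-elim (m≮k m<k)
        ... | eq m≈k = f m≈k
        ... | gt k<m = g k<m

      description : Description r P (λ x m → ν x < m) s′ → Description r P Lo s
      description R = extend s s′ gap-below
        (λ {x} {m} x∈r ¬lo m≮ν → sg-resp s′ (cong (at-ν (All.head below x∈r ¬lo) m≮ν)) (sign-at x∈r))
        (λ x∈r s′≢s → All.head gap x∈r (sg-differ s s′ s′≢s (sign-at x∈r)))
        (from-node R)
        where
        at-ν : ∀ {m k} → m ≤ k → ¬ m < k → k ≈ m
        at-ν {m} {k} m≤k m≮k = ¬¬-elim λ k≉m → m≮k (m≤k , k≉m ∘ sym)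

    -- Along each node `P` is continuous without zeros, so its sign there does not depend on `x`.
    -- The description above the node comes from the recursive call and is then extended down
    -- through the gap. Past the last node the upper end is +∞, where `unbounded` gives the sign
    -- `true`.
    describe : ∀ nodes {Lo s} → Nodes nodes → LowerEnd nodes Lo s → Description r P Lo s
    describe [] {Lo} {s} _ L = extend s true (record
        { lo-persists = persists
        ; up-persists = λ _ _ → near-all (λ _ _ → tt)
        ; lo-closed   = closed
        ; up-closed   = λ _ _ → tt
        ; ∂m≉0        = λ x∈r lo _ z → none (zeros x∈r lo z)
        ; start       = λ x∈r lo _ → start x∈r lo
        ; end         = λ {x} {m} x∈r _ _ → let q , m≤q , p = unbounded x∈r m in q , m≤q , tt , p
        })
      (λ _ _ ¬⊤ → ⊥-elim (¬⊤ tt))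
      (λ x∈r _ → let m , lo = inhabited x∈r in m , lo , tt)
      (record
        { roots = [] ; continuous = [] ; graphs = [] ; sound = λ _ () ; W = U ; W∈𝔐 = 𝔐-U
        ; complete = λ _ ¬⊤ _ → ⊥-elim (¬⊤ tt)
        ; inside⇒  = λ _ ¬⊤ _ → ⊥-elim (¬⊤ tt)
        ; inside⇐  = λ _ ¬⊤ _ → tt
        ; outside⇒ = λ _ _ _ → tt
        ; outside⇐ = λ _ _ _ → tt
        })
      where
      open LowerEnd L
      none : ∀ {x m} → OneOf x m [] → ⊥
      none ()
    describe (ν ∷ nodes) {Lo} {s} N L = by-sign (constant-sign-cases {f = λ x → P x (ν x)} {D = r ∋_} convex
        (curve-signLocal {η = ν} {F = P} (All.head (Nodes.continuous N)) (continuous-derivative derivative))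
        (All.head (Nodes.nonzero N)))
      where
      at-node : ∀ s′ → (∀ {x} → r ∋ x → Sg s′ (P x (ν x))) → Description r P Lo s
      at-node s′ sign-at = description (describe nodes tail above-node)
        where open AtNode N L s′ sign-at
      by-sign : (∀ {x} → r ∋ x → 0# < P x (ν x)) ⊎ (∀ {x} → r ∋ x → P x (ν x) < 0#) → Description r P Lo s
      by-sign (inj₁ pos) = at-node true pos
      by-sign (inj₂ neg) = at-node false neg

  -- Insertion by pointwise minimum and maximum: the order of two roots may vary with `x`, and these
  -- operations keep continuity and the union of the graphs.
  insert : Fun → List Fun → List Fun
  insert ν []      = ν ∷ []
  insert ν (τ ∷ L) = (λ x → ν x ⊓ τ x) ∷ insert (λ x → ν x ⊔ τ x) L

  sort : List Fun → List Fun
  sort []      = []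
  sort (ν ∷ L) = insert ν (sort L)

  insert-all : ∀ {Q : Pred Fun 0ℓ} →
    (∀ {ν τ} → Q ν → Q τ → Q (λ x → ν x ⊓ τ x) × Q (λ x → ν x ⊔ τ x)) →
    ∀ {ν L} → Q ν → All Q L → All Q (insert ν L)
  insert-all closed q []       = q ∷ []
  insert-all closed q (p ∷ ps) = proj₁ (closed q p) ∷ insert-all closed (proj₂ (closed q p)) ps

  sort-all : ∀ {Q : Pred Fun 0ℓ} →
    (∀ {ν τ} → Q ν → Q τ → Q (λ x → ν x ⊓ τ x) × Q (λ x → ν x ⊔ τ x)) →
    ∀ {L} → All Q L → All Q (sort L)
  sort-all closed []       = []
  sort-all closed (q ∷ qs) = insert-all closed q (sort-all closed qs)

  insert-sorted : ∀ {ν L} → AllPairs _≤ᶠ_ L → AllPairs _≤ᶠ_ (insert ν L)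
  insert-sorted []                           = [] ∷ []
  insert-sorted {ν} {τ ∷ _} (τ≤ ∷ sorted) =
    insert-all (λ p q → (λ x → ⊓-elim (ν x ⊓ τ x ≤_) (p x) (q x)) , (λ x → ⊔-elim (ν x ⊓ τ x ≤_) (p x) (q x)))
      (λ x → ≤-trans (⊓≤ˡ (ν x) (τ x)) (≤⊔ˡ (ν x) (τ x)))
      (All.map (λ τ≤σ x → ≤-trans (⊓≤ʳ (ν x) (τ x)) (τ≤σ x)) τ≤)
    ∷ insert-sorted sorted

  sort-sorted : ∀ L → AllPairs _≤ᶠ_ (sort L)
  sort-sorted []      = []
  sort-sorted (ν ∷ L) = insert-sorted (sort-sorted L)

  insert-here : ∀ {x m ν} L → m ≈ ν x → OneOf x m (insert ν L)
  insert-here []      m≈ν = here m≈ν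
  insert-here {x} {m} {ν} (τ ∷ L) m≈ν = by-cases (⊓-⊔-cases (ν x) (τ x))
    where
    by-cases : (ν x ⊓ τ x ≈ ν x × ν x ⊔ τ x ≈ τ x) ⊎ (ν x ⊓ τ x ≈ τ x × ν x ⊔ τ x ≈ ν x) →
               OneOf x m (insert ν (τ ∷ L))
    by-cases (inj₁ (e , _)) = here (trans m≈ν (sym e))
    by-cases (inj₂ (_ , e)) = there (insert-here L (trans m≈ν (sym e)))

  insert-there : ∀ {x m ν L} → OneOf x m L → OneOf x m (insert ν L)
  insert-there {x} {m} {ν} {τ ∷ L} (here m≈τ) = by-cases (⊓-⊔-cases (ν x) (τ x))
    where
    by-cases : (ν x ⊓ τ x ≈ ν x × ν x ⊔ τ x ≈ τ x) ⊎ (ν x ⊓ τ x ≈ τ x × ν x ⊔ τ x ≈ ν x) →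
               OneOf x m (insert ν (τ ∷ L))
    by-cases (inj₁ (_ , e)) = there (insert-here L (trans m≈τ (sym e)))
    by-cases (inj₂ (e , _)) = here (trans m≈τ (sym e))
  insert-there (there a) = there (insert-there a)

  sort-oneOf : ∀ {x m L} → OneOf x m L → OneOf x m (sort L)
  sort-oneOf {L = _ ∷ L} (here m≈ν) = insert-here (sort L) m≈ν
  sort-oneOf             (there a)  = insert-there (sort-oneOf a)

  -- The root functions become the nodes when `F` is the m-derivative of a polynomial of higher
  -- degree. They are recorded as continuous only, since pointwise sorting need not preserve
  -- monotonicity.
  record Tame (F : Fun₂) : Set₁ where
    field
      nbhd       : Nbhd
      roots      : List Fun
      continuous : All (ContinuousOn (nbhd ∋_)) roots
      sound      : ∀ {x m} → nbhd ∋ x → OneOf x m roots → F x m ≈ 0#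
      complete   : ∀ {x m} → nbhd ∋ x → F x m ≈ 0# → OneOf x m roots
      pos        : 𝔐 (λ (x , m) → nbhd ∋ x × 0# < F x m)
      neg        : 𝔐 (λ (x , m) → nbhd ∋ x × F x m < 0#)

  tame-neg : ∀ {F} → Tame (λ x m → - F x m) → Tame F
  tame-neg t = record
    { nbhd = nbhd ; roots = roots ; continuous = continuous
    ; sound    = λ x∈r a → neg≈0⁻¹ (sound x∈r a)
    ; complete = λ x∈r z → complete x∈r (neg≈0 z)
    ; pos      = 𝔐-resp (λ (x∈r , n) → x∈r , sg-neg⁻¹ false n) (λ (x∈r , p) → x∈r , pos-neg p) neg
    ; neg      = 𝔐-resp (λ (x∈r , p) → x∈r , neg-pos⁻¹ p) (λ (x∈r , n) → x∈r , neg-pos n) pos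
    }
    where open Tame t

  0<*-neg : ∀ {a b} → a < 0# → b < 0# → 0# < a * b
  0<*-neg {a} {b} a<0 b<0 = <-respʳ (solve 2 (λ a b → :- a :* :- b := a :* b) refl a b) (0<* (neg-pos a<0) (neg-pos b<0))

  *<0ʳ : ∀ {a b} → 0# < a → b < 0# → a * b < 0#
  *<0ʳ {a} {b} 0<a b<0 = neg-pos⁻¹ (<-respʳ (sym (-‿distribʳ-* a b)) (0<* 0<a (neg-pos b<0)))

  *<0ˡ : ∀ {a b} → a < 0# → 0# < b → a * b < 0#
  *<0ˡ {a} {b} a<0 0<b = neg-pos⁻¹ (<-respʳ (sym (-‿distribˡ-* a b)) (0<* (neg-pos a<0) 0<b))

  0<*⁻¹ : ∀ {a b} → 0# < a * b → (0# < a × 0# < b) ⊎ (a < 0# × b < 0#)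
  0<*⁻¹ {a} {b} p with compare a 0# | compare b 0#
  ... | gt 0<a | gt 0<b = inj₁ (0<a , 0<b)
  ... | lt a<0 | lt b<0 = inj₂ (a<0 , b<0)
  ... | gt 0<a | lt b<0 = ⊥-elim (<-irrefl (<-trans p (*<0ʳ 0<a b<0)))
  ... | lt a<0 | gt 0<b = ⊥-elim (<-irrefl (<-trans p (*<0ˡ a<0 0<b)))
  ... | eq a≈0 | _      = ⊥-elim (0<⇒≉0 p (trans (*-congʳ a≈0) (zeroˡ b)))
  ... | _      | eq b≈0 = ⊥-elim (0<⇒≉0 p (trans (*-congˡ b≈0) (zeroʳ a)))

  *<0⁻¹ : ∀ {a b} → a * b < 0# → (0# < a × b < 0#) ⊎ (a < 0# × 0# < b)
  *<0⁻¹ {a} {b} n = Sum.map (λ (p , q) → p , neg-pos⁻¹ q) (λ (p , q) → p , sg-neg⁻¹ false q)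
    (0<*⁻¹ (<-respʳ (-‿distribʳ-* a b) (neg-pos n)))

  tame-* : ∀ {F G} → Tame F → Tame G → Tame (λ x m → F x m * G x m)
  tame-* {F} {G} s t = record
    { nbhd       = r
    ; roots      = S.roots ++ T.roots
    ; continuous = All.++⁺ (All.map (continuousOn-⊆ (λ _ → inS)) S.continuous)
                           (All.map (continuousOn-⊆ (λ _ → inT)) T.continuous)
    ; sound      = λ x∈r a → Sum.[ (λ b → trans (*-congʳ (S.sound (inS x∈r) b)) (zeroˡ _))
                                 , (λ b → trans (*-congˡ (T.sound (inT x∈r) b)) (zeroʳ _)) ]′ (Any.++⁻ S.roots a)
    ; complete   = complete
    ; pos        = 𝔐-resp
        (λ (x∈r , w) → x∈r , Sum.[ (λ ((_ , p) , (_ , q)) → 0<* p q) , (λ ((_ , p) , (_ , q)) → 0<*-neg p q) ]′ w)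
        (λ (x∈r , p) → x∈r , Sum.map (λ (p , q) → (inS x∈r , p) , (inT x∈r , q))
                                     (λ (p , q) → (inS x∈r , p) , (inT x∈r , q)) (0<*⁻¹ p))
        (intersection (strip r) (union (intersection S.pos T.pos) (intersection S.neg T.neg)))
    ; neg        = 𝔐-resp
        (λ (x∈r , w) → x∈r , Sum.[ (λ ((_ , p) , (_ , q)) → *<0ʳ p q) , (λ ((_ , p) , (_ , q)) → *<0ˡ p q) ]′ w)
        (λ (x∈r , n) → x∈r , Sum.map (λ (p , q) → (inS x∈r , p) , (inT x∈r , q))
                                     (λ (p , q) → (inS x∈r , p) , (inT x∈r , q)) (*<0⁻¹ n))
        (intersection (strip r) (union (intersection S.pos T.neg) (intersection S.neg T.pos)))
    }
    where
    module S = Tame s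
    module T = Tame t
    r : Nbhd
    r = proj₁ (meet S.nbhd T.nbhd)
    inS : ∀ {x} → r ∋ x → S.nbhd ∋ x
    inS x∈r = proj₁ (proj₂ (meet S.nbhd T.nbhd) x∈r)
    inT : ∀ {x} → r ∋ x → T.nbhd ∋ x
    inT x∈r = proj₂ (proj₂ (meet S.nbhd T.nbhd) x∈r)
    complete : ∀ {x m} → r ∋ x → F x m * G x m ≈ 0# → OneOf x m (S.roots ++ T.roots)
    complete {x} {m} x∈r z with em {F x m ≈ 0#}
    ... | yes F≈0 = Any.++⁺ˡ (S.complete (inS x∈r) F≈0)
    ... | no  F≉0 = Any.++⁺ʳ S.roots (T.complete (inT x∈r) (*≈0 z F≉0))

  tame-quotient : ∀ {c : Fun} {F G} r₀ → (∀ {x} → r₀ ∋ x → 0# < c x) → (∀ x m → c x * F x m ≈ G x m) → Tame G → Tame F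
  tame-quotient {c} {F} {G} r₀ 0<c cF≈G t = record
    { nbhd       = r
    ; roots      = roots
    ; continuous = All.map (continuousOn-⊆ (λ _ → inT)) continuous
    ; sound      = λ x∈r a → *≈0 (trans (cF≈G _ _) (sound (inT x∈r) a)) (0<⇒≉0 (0<c (in₀ x∈r)))
    ; complete   = λ x∈r z → complete (inT x∈r) (trans (sym (cF≈G _ _)) (trans (*-congˡ z) (zeroʳ _)))
    ; pos        = 𝔐-resp (λ (x∈r , (_ , g)) → x∈r , cancel⁺ (0<c (in₀ x∈r)) g)
        (λ (x∈r , f) → x∈r , inT x∈r , <-respʳ (cF≈G _ _) (0<* (0<c (in₀ x∈r)) f)) (intersection (strip r) pos)
    ; neg        = 𝔐-resp (λ (x∈r , (_ , g)) → x∈r , cancel⁻ (0<c (in₀ x∈r)) g)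
        (λ (x∈r , f) → x∈r , inT x∈r , <-respˡ (cF≈G _ _) (*<0ʳ (0<c (in₀ x∈r)) f)) (intersection (strip r) neg)
    }
    where
    open Tame t
    r : Nbhd
    r = proj₁ (meet r₀ nbhd)
    in₀ : ∀ {x} → r ∋ x → r₀ ∋ x
    in₀ x∈r = proj₁ (proj₂ (meet r₀ nbhd) x∈r)
    inT : ∀ {x} → r ∋ x → nbhd ∋ x
    inT x∈r = proj₂ (proj₂ (meet r₀ nbhd) x∈r)
    cancel⁺ : ∀ {x m} → 0# < c x → 0# < G x m → 0# < F x m
    cancel⁺ 0<cx p = Sum.[ proj₂ , (λ (cx<0 , _) → ⊥-elim (<-irrefl (<-trans 0<cx cx<0))) ]′
      (0<*⁻¹ (<-respʳ (sym (cF≈G _ _)) p))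
    cancel⁻ : ∀ {x m} → 0# < c x → G x m < 0# → F x m < 0#
    cancel⁻ 0<cx n = Sum.[ proj₂ , (λ (cx<0 , _) → ⊥-elim (<-irrefl (<-trans 0<cx cx<0))) ]′
      (*<0⁻¹ (<-respˡ (sym (cF≈G _ _)) n))

  leading-sign : ∀ s {G n} → PolyM n G → ∀ x {α} → Sg s α → ∃[ M ] (∀ {m} → M ≤ m → Sg s (α * m ^ n + G x m))
  leading-sign true p x sg =
    let M , _ , positive = leading-term-dominates p x sg in M , positive
  leading-sign false {G} {n} p x {α} sg =
    let M , _ , positive = leading-term-dominates (polyM-neg p) x (neg-pos sg)
    in M , λ {m} M≤m → neg-pos⁻¹ (<-respʳ (collect α (m ^ n) (G x m)) (positive M≤m))
    where
    collect : ∀ a t g → - a * t + - g ≈ - (a * t + g)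
    collect = solve 3 (λ a t g → :- a :* t :+ :- g := :- (a :* t :+ g)) refl

  sign-of : ∀ v → ¬ v ≈ 0# → ∃[ s ] Sg s v
  sign-of v v≉0 with compare v 0#
  ... | gt 0<v = true , 0<v
  ... | lt v<0 = false , v<0
  ... | eq v≈0 = ⊥-elim (v≉0 v≈0)

  leading-nonzero : ∀ {n a F} → Leading n a F → ∀ {x} → ¬ a x ≈ 0# → ¬ (∀ m → F x m ≈ 0#)
  leading-nonzero {a = a} L {x} a≉0 F≈0 =
    let s , sg    = sign-of (a x) a≉0
        M , large = leading-sign s (lower L) x sg
    in sg-≉0 s (large ≤-refl) (trans (sym (expansion L x M)) (F≈0 M))

  leading-neg : ∀ {n a F} → Leading n a F → Leading n (λ x → - a x) (λ x m → - F x m)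
  leading-neg L = record
    { coefficient = polyX-neg (coefficient L)
    ; lower       = polyM-neg (lower L)
    ; expansion   = λ x m → trans (-‿cong (expansion L x m)) (trans (sym (-‿+-comm _ _)) (+-congʳ (-‿distribˡ-* _ _)))
    }

  parity : ℕ → Bool
  parity zero    = true
  parity (suc n) = not (parity n)

  sg-sign^ : ∀ n → Sg (parity n) (sign^ n)
  sg-sign^ zero    = 0<1
  sg-sign^ (suc n) = sg-neg (parity n) (sg-sign^ n)

  sg-scale : ∀ s {a v} → 0# < a → Sg s v → Sg s (a * v)
  sg-scale true  0<a p = 0<* 0<a p
  sg-scale false 0<a n = *<0ʳ 0<a n

  polyM-continuous : ∀ {n F} → PolyM n F → Continuous F
  polyM-continuous p = continuous-derivative (Differentiable.derivative (polyM-differentiable p))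

  graphs∈𝔐 : ∀ {r L} → All (λ η → 𝔐 (Graph r η)) L → 𝔐 (λ (x , m) → r ∋ x × OneOf x m L)
  graphs∈𝔐 []       = 𝔐-resp (λ ()) (λ { (_ , ()) }) 𝔐-∅
  graphs∈𝔐 (g ∷ gs) = 𝔐-resp
    Sum.[ (λ (x∈r , e) → x∈r , here e) , (λ (x∈r , a) → x∈r , there a) ]′
    (λ { (x∈r , here e) → inj₁ (x∈r , e) ; (x∈r , there a) → inj₂ (x∈r , a) })
    (union g (graphs∈𝔐 gs))

  module Irreducible {n : ℕ} {a : Fun} {F : Fun₂}
                     (L : Leading (suc n) a F) (r₀ : Nbhd) (0<a : ∀ {x} → r₀ ∋ x → 0# < a x)
                     (irreducible : ¬ Reducible (suc n) F) where
    open LeadingDerivatives (leading-derivatives L)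

    private
      N : ℕ
      N = suc n

    ∂m-signed : Signed (λ x → (N · 1#) * a x)
    ∂m-signed = r₀ , inj₁ λ x∈r → 0<* (0<·1 n) (0<a x∈r)

    coprime-∂m : NoCommonZero F ∂m
    coprime-∂m = irreducible⇒coprime (leading⇒polyM L) irreducible n ℕ.≤-refl (ℕ.n<1+n n) ∂m-signed ∂m-leading

    -- a ∂x − a′ F, in which the leading terms cancel.
    reduced : Fun₂
    reduced x m = a x * rest ∂x-leading x m + - (a′ x * rest L x m)

    reduced-polyM : PolyM N reduced
    reduced-polyM = polyM-+ (polyM-scale (coefficient L) (lower ∂x-leading))
                            (polyM-neg (polyM-scale (coefficient ∂x-leading) (lower L)))

    reduced≈ : ∀ {x m} → F x m ≈ 0# → reduced x m ≈ a x * ∂x x m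
    reduced≈ {x} {m} F≈0 = trans (cancel (a x) (a′ x) (m ^ N) (rest ∂x-leading x m) (rest L x m))
      (trans (+-cong (*-congˡ (sym (expansion ∂x-leading x m)))
                     (-‿cong (trans (*-congˡ (trans (sym (expansion L x m)) F≈0)) (zeroʳ _))))
        (trans (+-congˡ (neg≈0 refl)) (+-identityʳ _)))
      where
      cancel : ∀ a b t u v → a * u + - (b * v) ≈ a * (b * t + u) + - (b * (a * t + v))
      cancel = solve 5 (λ a b t u v → a :* u :+ :- (b :* v) := a :* (b :* t :+ u) :+ :- (b :* (a :* t :+ v))) refl

    ∂x-Zero : Nbhd → Set
    ∂x-Zero r = (∀ {x m} → r ∋ x → F x m ≈ 0# → ∂x x m ≈ 0#) ⊎ (∀ {x m} → r ∋ x → F x m ≈ 0# → ¬ ∂x x m ≈ 0#)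

    -- On the zeros of `F` the reduction agrees with `a * ∂x`, and `a` is positive. Its degree is
    -- below `N`, so it is identically zero or has no common zero with the irreducible `F` near the
    -- germ.
    ∂x-dichotomy : ∃[ r ] ∂x-Zero r
    ∂x-dichotomy = by-reduced (trim reduced-polyM)
      where
      by-reduced : Trimmed N reduced → ∃[ r ] ∂x-Zero r
      by-reduced (inj₁ reduced≈0) = r₀ , inj₁ λ x∈r F≈0 →
        *≈0 (trans (sym (reduced≈ F≈0)) (reduced≈0 _ _)) (0<⇒≉0 (0<a x∈r))
      by-reduced (inj₂ (k , b , k<N , sb , L′)) =
        let r , none = irreducible⇒coprime (leading⇒polyM L) irreducible k ℕ.≤-refl k<N sb L′
        in r , inj₂ λ x∈r F≈0 ∂x≈0 →
             none x∈r F≈0 (trans (reduced≈ F≈0) (trans (*-congˡ ∂x≈0) (zeroʳ _)))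

    module _ (t : Tame ∂m) where
      private
        module T = Tame t

        r₁ r₂ r : Nbhd
        r₁ = proj₁ (meet r₀ T.nbhd)
        r₂ = proj₁ (meet (proj₁ coprime-∂m) (proj₁ ∂x-dichotomy))
        r  = proj₁ (meet r₁ r₂)

        in₁ : ∀ {x} → r ∋ x → r₁ ∋ x
        in₁ x∈r = proj₁ (proj₂ (meet r₁ r₂) x∈r)
        in₂ : ∀ {x} → r ∋ x → r₂ ∋ x
        in₂ x∈r = proj₂ (proj₂ (meet r₁ r₂) x∈r)
        in₀ : ∀ {x} → r ∋ x → r₀ ∋ x
        in₀ x∈r = proj₁ (proj₂ (meet r₀ T.nbhd) (in₁ x∈r))
        inT : ∀ {x} → r ∋ x → T.nbhd ∋ x
        inT x∈r = proj₂ (proj₂ (meet r₀ T.nbhd) (in₁ x∈r))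
        in-coprime : ∀ {x} → r ∋ x → proj₁ coprime-∂m ∋ x
        in-coprime x∈r = proj₁ (proj₂ (meet (proj₁ coprime-∂m) (proj₁ ∂x-dichotomy)) (in₂ x∈r))
        in-∂x : ∀ {x} → r ∋ x → proj₁ ∂x-dichotomy ∋ x
        in-∂x x∈r = proj₂ (proj₂ (meet (proj₁ coprime-∂m) (proj₁ ∂x-dichotomy)) (in₂ x∈r))

        setting : Setting (r ∋_) F ∂x ∂m
        setting = record
          { convex     = Germ.convex 𝒢 r
          ; derivative = derivative
          ; cong       = polyM-cong (leading⇒polyM L) refl
          ; ∂x-cont    = polyM-continuous (leading⇒polyM ∂x-leading)
          ; ∂m-cont    = polyM-continuous (leading⇒polyM ∂m-leading)
          ; ∂x-zero    = Sum.map (λ f x∈r → f (in-∂x x∈r)) (λ f x∈r → f (in-∂x x∈r)) (proj₂ ∂x-dichotomy)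
          }

        unbounded : ∀ {x} → r ∋ x → ∀ m → ∃[ q ] m ≤ q × 0# < F x q
        unbounded {x} x∈r m =
          let M , large = leading-sign true (lower L) x (0<a (in₀ x∈r))
          in m ⊔ M , ≤⊔ˡ m M , <-respʳ (sym (expansion L x (m ⊔ M))) (large (≤⊔ʳ m M))

        -- For a positive leading coefficient this is the sign of `F` as `m` tends to -∞.
        s₋ : Bool
        s₋ = parity N

        at-minus-infinity : ∀ {x} → r ∋ x → ∀ m → ∃[ p ] p ≤ m × Sg s₋ (F x p)
        at-minus-infinity {x} x∈r m = far (leading-sign s₋ (polyM-reflect (lower L)) x
            (sg-scale s₋ (0<a (in₀ x∈r)) (sg-sign^ N)))
          where
          swap : ∀ k m → k - (- m) ≈ m - (- k)
          swap = solve 2 (λ k m → k :- (:- m) := m :- (:- k)) refl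
          F-reflected : ∀ k → (a x * sign^ N) * k ^ N + rest L x (- k) ≈ F x (- k)
          F-reflected k = trans (+-congʳ (trans (*-assoc (a x) (sign^ N) (k ^ N)) (*-congˡ (sym (neg-^ k N)))))
            (sym (expansion L x (- k)))
          far : ∃[ M ] (∀ {k} → M ≤ k → Sg s₋ ((a x * sign^ N) * k ^ N + rest L x (- k))) →
                ∃[ p ] p ≤ m × Sg s₋ (F x p)
          far (M , large) = - k , 0≤⇒≤ (≤⇒0≤ (≤⊔ʳ M (- m))) (swap k m)
            , sg-resp s₋ (F-reflected k) (large (≤⊔ˡ M (- m)))
            where
            k : Carrier
            k = M ⊔ (- m)

        open Describe r setting unbounded

        nodes : List Fun
        nodes = sort T.roots

        Nonzero : Pred Fun 0ℓ
        Nonzero ν = ∀ {x} → r ∋ x → ¬ F x (ν x) ≈ 0#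

        each-root : All (λ ν → ∀ x → OneOf x (ν x) T.roots) T.roots
        each-root = All.tabulate λ ν∈roots x → Any.map (λ { ≡.refl → refl }) ν∈roots

        are-nodes : Nodes nodes
        are-nodes = record
          { continuous = sort-all (λ c d → continuousOn-⊓ c d , continuousOn-⊔ c d)
              (All.map (continuousOn-⊆ (λ _ → inT)) T.continuous)
          -- Over each `x` the minimum and the maximum are among the two given values, so sorting
          -- keeps the nodes off the zeros of `F`.
          ; nonzero    = sort-all {Nonzero}
              (λ {ν} {τ} p q → (λ {x} x∈r → ⊓-elim (λ k → ¬ F x k ≈ 0#) (p x∈r) (q x∈r))
                             , (λ {x} x∈r → ⊔-elim (λ k → ¬ F x k ≈ 0#) (p x∈r) (q x∈r)))
              (All.map (λ root {x} x∈r F≈0 → proj₂ coprime-∂m (in-coprime x∈r) F≈0 (T.sound (inT x∈r) (root x)))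
                each-root)
          ; sorted     = sort-sorted T.roots
          }

        from-minus-infinity : LowerEnd nodes (λ _ _ → ⊤) s₋
        from-minus-infinity = record
          { persists  = λ _ _ → near-all (λ _ _ → tt)
          ; closed    = λ _ _ → tt
          ; start     = λ {x} {m} x∈r _ → let p , p≤m , sg = at-minus-infinity x∈r m in p , p≤m , tt , sg
          ; zeros     = λ x∈r _ z → sort-oneOf (T.complete (inT x∈r) z)
          ; inhabited = λ _ → 0# , tt
          ; below     = All.universal (λ _ {_} {_} _ ¬⊤ → ⊥-elim (¬⊤ tt)) nodes
          ; gap       = All.universal (λ ν {x} _ _ → ν x - 1# , tt , a-b<a 0<1) nodes
          }

        description : Description r F (λ _ _ → ⊤) s₋
        description = describe nodes are-nodes from-minus-infinity

      tame-irreducible : Tame F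
      tame-irreducible = record
        { nbhd       = r
        ; roots      = roots
        ; continuous = continuous
        ; sound      = sound
        ; complete   = λ x∈r z → complete x∈r tt z
        ; pos        = 𝔐-resp (λ (x∈r , w) → x∈r , inside⇒ x∈r tt w) (λ (x∈r , p) → x∈r , inside⇐ x∈r tt p)
                         (intersection (strip r) W∈𝔐)
        ; neg        = 𝔐-resp
            (λ (x∈r , ¬w , ¬z) → x∈r , negative (λ p → ¬w (inside⇐ x∈r tt p)) (λ z → ¬z (x∈r , complete x∈r tt z)))
            (λ (x∈r , n) → x∈r , (λ w → <-irrefl (<-trans n (inside⇒ x∈r tt w))) , (λ (_ , a) → proj₂ n (sound x∈r a)))
            (intersection (strip r) (intersection (complement W∈𝔐) (complement (graphs∈𝔐 graphs))))
        }
        where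
        open Description description
        negative : ∀ {v} → ¬ 0# < v → ¬ v ≈ 0# → v < 0#
        negative {v} ¬p ¬z with compare v 0#
        ... | lt n = n
        ... | eq z = ⊥-elim (¬z z)
        ... | gt p = ⊥-elim (¬p p)

  tame-constant : ∀ {a F} → Signed a → Leading 0 a F → Tame F
  tame-constant {a} {F} (r , sa) L = record
    { nbhd = r ; roots = [] ; continuous = []
    ; sound    = λ _ ()
    ; complete = λ x∈r z → ⊥-elim (signed⇒≉0 (r , sa) x∈r (trans (sym (F≈a _ _)) z))
    ; pos      = proj₁ (signs sa)
    ; neg      = proj₂ (signs sa)
    }
    where
    vanish : ∀ {G} → PolyM 0 G → ∀ x m → G x m ≈ 0#
    vanish (nil G≈0) = G≈0
    F≈a : ∀ x m → F x m ≈ a x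
    F≈a x m = trans (expansion L x m) (trans (+-cong (*-identityʳ _) (vanish (lower L) x m)) (+-identityʳ _))
    signs : (∀ {x} → r ∋ x → 0# < a x) ⊎ (∀ {x} → r ∋ x → a x < 0#) →
            𝔐 (λ (x , m) → r ∋ x × 0# < F x m) × 𝔐 (λ (x , m) → r ∋ x × F x m < 0#)
    signs (inj₁ p) =
        𝔐-resp (λ x∈r → x∈r , <-respʳ (sym (F≈a _ _)) (p x∈r)) proj₁ (strip r)
      , 𝔐-resp (λ ()) (λ (x∈r , n) → <-irrefl (<-trans n (<-respʳ (sym (F≈a _ _)) (p x∈r)))) 𝔐-∅
    signs (inj₂ n) =
        𝔐-resp (λ ()) (λ (x∈r , p) → <-irrefl (<-trans p (<-respˡ (sym (F≈a _ _)) (n x∈r)))) 𝔐-∅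
      , 𝔐-resp (λ x∈r → x∈r , <-respˡ (sym (F≈a _ _)) (n x∈r)) proj₁ (strip r)

  TameBelow : ℕ → Set₁
  TameBelow n = ∀ {k b G} → k ℕ.< n → Signed b → Leading k b G → Tame G

  tame-reducible : ∀ {n a F} → TameBelow n → Signed a → Leading n a F → Reducible n F → Tame F
  tame-reducible {n} {a} {F} below sa L R = tame-quotient (proj₁ signed) (square (proj₂ signed)) product′
      (by-trimming (trim (polyM-scale multiplier factor₁)) (trim factor₂))
    where
    open Reducible R
    r : Nbhd
    r = proj₁ (meet (proj₁ sa) (proj₁ signed))
    x : Carrier
    x = proj₁ (member r)
    -- Multiplying once more by c makes the multiplier of F a positive square.
    product′ : ∀ x m → (c x * c x) * F x m ≈ (c x * P₁ x m) * P₂ x m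
    product′ x m = trans (*-assoc _ _ _) (trans (*-congˡ (product x m)) (sym (*-assoc _ _ _)))
    square : (∀ {x} → proj₁ signed ∋ x → 0# < c x) ⊎ (∀ {x} → proj₁ signed ∋ x → c x < 0#) →
             ∀ {x} → proj₁ signed ∋ x → 0# < c x * c x
    square (inj₁ p) x∈c = 0<* (p x∈c) (p x∈c)
    square (inj₂ n) x∈c = 0<*-neg (n x∈c) (n x∈c)
    -- A factor vanishing identically would make `F` zero on the vertical line over the sample
    -- point, against its nonzero leading coefficient there.
    product≉0 : ¬ (∀ m → (c x * P₁ x m) * P₂ x m ≈ 0#)
    product≉0 z =
      let x∈a , x∈c = proj₂ (meet (proj₁ sa) (proj₁ signed)) (proj₂ (member r))
      in leading-nonzero L (signed⇒≉0 sa x∈a) λ m →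
           *≈0 (trans (product′ x m) (z m)) (0<⇒≉0 (square (proj₂ signed) x∈c))
    by-trimming : Trimmed n (λ x m → c x * P₁ x m) → Trimmed n P₂ → Tame (λ x m → (c x * P₁ x m) * P₂ x m)
    by-trimming (inj₁ z) _ = ⊥-elim (product≉0 λ m → trans (*-congʳ (z x m)) (zeroˡ _))
    by-trimming _ (inj₁ z) = ⊥-elim (product≉0 λ m → trans (*-congˡ (z x m)) (zeroʳ _))
    by-trimming (inj₂ (_ , _ , k<n , sb , L₁)) (inj₂ (_ , _ , l<n , sc , L₂)) =
      tame-* (below k<n sb L₁) (below l<n sc L₂)

  tame-positive : ∀ {n a F} → TameBelow (suc n) → ∀ r → (∀ {x} → r ∋ x → 0# < a x) → Leading (suc n) a F → Tame F
  tame-positive {n} {a} {F} below r 0<a L = by-cases em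
    where
    by-cases : Dec (Reducible (suc n) F) → Tame F
    by-cases (yes R)  = tame-reducible below (r , inj₁ 0<a) L R
    by-cases (no irr) = tame-irreducible (below (ℕ.n<1+n n) ∂m-signed (LeadingDerivatives.∂m-leading (leading-derivatives L)))
      where open Irreducible L r 0<a irr

  tame-step : ∀ n → TameBelow n → ∀ {a F} → Signed a → Leading n a F → Tame F
  tame-step zero    below sa L = tame-constant sa L
  tame-step (suc n) below (r , inj₁ 0<a) L = tame-positive below r 0<a L
  tame-step (suc n) below (r , inj₂ a<0) L =
    tame-neg (tame-positive below r (λ x∈r → neg-pos (a<0 x∈r)) (leading-neg L))

  tame-below : ∀ n → TameBelow n
  tame-below (suc n) {k} k<n = tame-step k λ j<k → tame-below n (ℕ.<-≤-trans j<k (ℕ.s≤s⁻¹ k<n))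

  positivity-set : ∀ {n F} → PolyM n F → ∃[ r ] 𝔐 (λ (x , m) → r ∋ x × 0# < F x m)
  positivity-set {n} {F} p = by-trimming (trim p)
    where
    by-trimming : Trimmed n F → ∃[ r ] 𝔐 (λ (x , m) → r ∋ x × 0# < F x m)
    by-trimming (inj₁ F≈0) = somewhere , 𝔐-resp (λ ()) (λ (_ , p) → ⊥-elim (0<⇒≉0 p (F≈0 _ _))) 𝔐-∅
    by-trimming (inj₂ (k , _ , _ , sb , L)) =
      let t = tame-below (suc k) (ℕ.n<1+n k) sb L in Tame.nbhd t , Tame.pos t

-- Semigroups, slabs and the passage from germs to the whole space.

module Assembly (em : ExcludedMiddle 0ℓ) (ℝ : RealNumbers) where

  import Algebra.Properties.CommutativeSemiring.Exp as CommutativeExp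
  open import Data.Fin.Base using (zero; suc)
  open import Data.List.Base as List using (List; []; _∷_)
  open import Data.Nat.Base as ℕ using (ℕ; zero; suc)
  open import Data.Vec.Functional as Vector using (Vector)
  open import Relation.Binary.Definitions using (_Respects_)
  open OrderedField em ℝ
  open Polynomials em ℝ
  open Germs em ℝ
  open RealNumbers ℝ renaming (zero to *-zero)
  open RawSemiringDefs (Semiring.rawSemiring semiring) using (_^_; product)
  open CommutativeExp commutativeSemiring using (^-distrib-*; ^-congˡ)

  pow2 : ℕ → Carrier → Carrier
  pow2 zero    c = c
  pow2 (suc k) c = pow2 k (c + c)

  pow2-suc : ∀ k c → pow2 (suc k) c ≈ pow2 k c + pow2 k c
  pow2-suc zero    c = refl
  pow2-suc (suc k) c = pow2-suc k (c + c)

  0<c+c : ∀ {c} → 0# < c → 0# < c + c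
  0<c+c 0<c = 0<+ 0<c (<⇒≤ 0<c)

  c≤pow2 : ∀ k {c} → 0# < c → c ≤ pow2 k c
  c≤pow2 zero    0<c = ≤-refl
  c≤pow2 (suc k) 0<c = ≤-trans (<⇒≤ (a+b>a 0<c)) (c≤pow2 k (0<c+c 0<c))

  -- If the doublings of `c` were bounded with supremum `s`, the double of each would be at most
  -- `s`, so `half s` would bound them as well.
  archimedean : ∀ {c} → 0# < c → ∀ C → ∃[ k ] C < pow2 k c
  archimedean {c} 0<c C = by-cases em
    where
    P : Pred Carrier 0ℓ
    P x = ∃[ k ] x ≈ pow2 k c
    module _ (none : ¬ (∃[ k ] C < pow2 k c)) where
      bounded : UpperBound P C
      bounded {x} (k , x≈) = by-order (≤-<-cases x C)
        where
        by-order : x ≤ C ⊎ C < x → x ≤ C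
        by-order (inj₁ x≤C) = x≤C
        by-order (inj₂ C<x) = ⊥-elim (none (k , <-respʳ x≈ C<x))
      from-supremum : ∃[ s ] UpperBound P s × (∀ {u} → UpperBound P u → s ≤ u) → ⊥
      from-supremum (s , upper , least) = <⇒≱ (half< 0<s) (least below-half)
        where
        0<s : 0# < s
        0<s = <-≤-trans 0<c (upper (0 , refl))
        double≤ : ∀ {x} → P x → x + x ≤ s
        double≤ (k , x≈) = ≤-respˡ-≈ (trans (pow2-suc k c) (+-cong (sym x≈) (sym x≈))) (upper (suc k , refl))
        below-half : UpperBound P (half s)
        below-half {x} Px = by-order (≤-<-cases x (half s))
          where
          by-order : x ≤ half s ⊎ half s < x → x ≤ half s
          by-order (inj₁ p) = p
          by-order (inj₂ p) = ⊥-elim (<⇒≱ (<-respˡ (half-sum s) (double p)) (double≤ Px))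
            where
            difference : ∀ h x → (x - h) + (x - h) ≈ (x + x) - (h + h)
            difference = solve 2 (λ h x → (x :- h) :+ (x :- h) := (x :+ x) :- (h :+ h)) refl
            double : ∀ {h x} → h < x → h + h < x + x
            double {h} {x} h<x = 0<⇒< (0<+ (<⇒0< h<x) (0≤b-a h<x)) (difference h x)
    by-cases : Dec (∃[ k ] C < pow2 k c) → ∃[ k ] C < pow2 k c
    by-cases (yes found) = found
    by-cases (no none)   = ⊥-elim (from-supremum none (supremum P (c , 0 , refl) (C , bounded none)))

  module Sets (d : ℕ) where
    open Euclidean ℝ d
    open IsSemigroup

    𝔄-resp : ∀ {X Y : Pred ℝᵈ 0ℓ} → (∀ {v} → X v → Y v) → (∀ {v} → Y v → X v) → 𝔄 X → 𝔄 Y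
    𝔄-resp f g = resp-≐ (f , g)

    𝔄-∅ : ∀ {X : Pred ℝᵈ 0ℓ} → (∀ {v} → ¬ X v) → 𝔄 X
    𝔄-∅ empty = generator (record { resp-≋ = λ _ x → ⊥-elim (empty x) ; closed = λ x _ → ⊥-elim (empty x) })

    record Additive (l : ℝᵈ → Carrier) : Set where
      field
        cong     : ∀ {v w} → v ≋ w → l v ≈ l w
        additive : ∀ v w → l (v ⊕ w) ≈ l v + l w

    -- Relative to a semigroup `G`, so that the construction runs both on the whole space and on the
    -- axis `x = 0` of the plane.
    module Slabs {G : Pred ℝᵈ 0ℓ} (G-semigroup : IsSemigroup G) {l : ℝᵈ → Carrier} (l-additive : Additive l) where
      open Additive l-additive

      ray : ∀ (Q : Pred Carrier 0ℓ) → (∀ {a b} → a ≈ b → Q a → Q b) → (∀ {a b} → Q a → Q b → Q (a + b)) →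
            𝔄 (λ v → G v × Q (l v))
      ray Q Q-resp Q-closed = generator (record
        { resp-≋ = λ v≋w (g , q) → G-semigroup .resp-≋ v≋w g , Q-resp (cong v≋w) q
        ; closed = λ (g , q) (g′ , q′) → G-semigroup .closed g g′ , Q-resp (sym (additive _ _)) (Q-closed q q′)
        })

      at-least : ∀ {c} → 0# < c → 𝔄 (λ v → G v × c ≤ l v)
      at-least {c} 0<c = ray (c ≤_) ≤-respʳ-≈ λ c≤a c≤b → ≤-trans (<⇒≤ (a+b>a 0<c)) (+-mono-≤ c≤a c≤b)

      module _ {B : Pred ℝᵈ 0ℓ} (B-resp : B Respects _≋_) where

        -- Any part of the slab c ≤ l < 2c becomes a semigroup when l ≥ 2c is added.
        slab : ∀ {c} → 0# < c → 𝔄 (λ v → G v × B v × c ≤ l v × l v < c + c)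
        slab {c} 0<c = 𝔄-resp
          (λ { ((g , inj₁ (b , c≤l)) , not-far) → g , b , c≤l , ≰⇒> λ 2c≤l → not-far (g , 2c≤l)
             ; ((g , inj₂ 2c≤l) , not-far) → ⊥-elim (not-far (g , 2c≤l)) })
          (λ (g , b , c≤l , l<2c) → (g , inj₁ (b , c≤l)) , λ (_ , 2c≤l) → <⇒≱ l<2c 2c≤l)
          (intersection (generator filled) (complement (at-least (0<c+c 0<c))))
          where
          beyond : ∀ {v} → (B v × c ≤ l v) ⊎ (c + c ≤ l v) → c ≤ l v
          beyond (inj₁ (_ , c≤l)) = c≤l
          beyond (inj₂ 2c≤l)      = ≤-trans (<⇒≤ (a+b>a 0<c)) 2c≤l
          filled : IsSemigroup (λ v → G v × ((B v × c ≤ l v) ⊎ (c + c ≤ l v)))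
          filled = record
            { resp-≋ = λ v≋w (g , q) → G-semigroup .resp-≋ v≋w g ,
                Sum.map (λ (b , c≤l) → B-resp v≋w b , ≤-respʳ-≈ (cong v≋w) c≤l) (≤-respʳ-≈ (cong v≋w)) q
            ; closed = λ (g , q) (g′ , q′) → G-semigroup .closed g g′ ,
                inj₂ (≤-respʳ-≈ (sym (additive _ _)) (+-mono-≤ (beyond q) (beyond q′)))
            }

        slabs : ∀ k {c} → 0# < c → 𝔄 (λ v → G v × B v × c ≤ l v × l v < pow2 k c)
        slabs zero    0<c = 𝔄-∅ λ (_ , _ , c≤l , l<c) → <⇒≱ l<c c≤l
        slabs (suc k) {c} 0<c = 𝔄-resp
          Sum.[ (λ (g , b , c≤l , l<2c) → g , b , c≤l , <-≤-trans l<2c (c≤pow2 k (0<c+c 0<c)))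
              , (λ (g , b , 2c≤l , l<) → g , b , ≤-trans (<⇒≤ (a+b>a 0<c)) 2c≤l , l<) ]′
          (λ {v} (g , b , c≤l , l<) → Sum.[ (λ 2c≤l → inj₂ (g , b , 2c≤l , l<)) , (λ l<2c → inj₁ (g , b , c≤l , l<2c)) ]′
            (≤-<-cases (c + c) (l v)))
          (union (slab 0<c) (slabs k (0<c+c 0<c)))

        -- By the archimedean property finitely many slabs, each twice as far out as the last, cover
        -- the values from `δ` past `r`, and inside a slab any `B` that respects `≋` is admissible.
        between-germs : ∀ r s → 𝔄 (λ v → G v × B v × Germ._∋_ at-infinity r (l v)) →
                        𝔄 (λ v → G v × B v × Germ._∋_ at-zero s (l v)) → 𝔄 (λ v → G v × B v × 0# < l v)
        between-germs r (δ , 0<δ) far near = 𝔄-resp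
          Sum.[ (λ (g , b , 0<l , _) → g , b , 0<l)
              , Sum.[ (λ (g , b , 0<l , _) → g , b , 0<l) , (λ (g , b , δ≤l , _) → g , b , <-≤-trans 0<δ δ≤l) ]′ ]′
          cover
          (union far (union near (slabs k 0<δ)))
          where
          k : ℕ
          k = proj₁ (archimedean 0<δ r)
          r<pow : r < pow2 k δ
          r<pow = proj₂ (archimedean 0<δ r)
          cover : ∀ {v} → G v × B v × 0# < l v →
                  (G v × B v × 0# < l v × r < l v) ⊎ (G v × B v × 0# < l v × l v < δ) ⊎
                  (G v × B v × δ ≤ l v × l v < pow2 k δ)
          cover {v} (g , b , 0<l) = by-order (≤-<-cases δ (l v)) (≤-<-cases (pow2 k δ) (l v))
            where
            by-order : δ ≤ l v ⊎ l v < δ → pow2 k δ ≤ l v ⊎ l v < pow2 k δ →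
                       (G v × B v × 0# < l v × r < l v) ⊎ (G v × B v × 0# < l v × l v < δ) ⊎
                       (G v × B v × δ ≤ l v × l v < pow2 k δ)
            by-order (inj₂ l<δ) _          = inj₂ (inj₁ (g , b , 0<l , l<δ))
            by-order (inj₁ δ≤l) (inj₁ p≤l) = inj₁ (g , b , 0<l , <-≤-trans r<pow p≤l)
            by-order (inj₁ δ≤l) (inj₂ l<p) = inj₂ (inj₂ (g , b , δ≤l , l<p))

      positive-ray : 𝔄 (λ v → G v × 0# < l v)
      positive-ray = ray (0# <_) <-respʳ λ 0<a 0<b → 0<+ 0<a (<⇒≤ 0<b)

      far-strip : ∀ r → 𝔄 (λ v → G v × Germ._∋_ at-infinity r (l v))
      far-strip r = ray (λ a → 0# < a × r < a) (λ a≈b (p , q) → <-respʳ a≈b p , <-respʳ a≈b q)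
        λ (p , q) (p′ , _) → 0<+ p (<⇒≤ p′) , <-trans q (a+b>a p′)

      near-strip : ∀ s → 𝔄 (λ v → G v × Germ._∋_ at-zero s (l v))
      near-strip (δ , 0<δ) = 𝔄-resp
        (λ ((g , 0<l) , ¬δ≤l) → g , 0<l , ≰⇒> λ δ≤l → ¬δ≤l (g , δ≤l))
        (λ (g , 0<l , l<δ) → (g , 0<l) , λ (_ , δ≤l) → <⇒≱ l<δ δ≤l)
        (intersection positive-ray (complement (at-least 0<δ)))

      module _ {f : Fun} (p : PolyX f) where

        germ-part : ∀ (𝒢 : Germ) → (∀ r → 𝔄 (λ v → G v × Germ._∋_ 𝒢 r (l v))) →
                    ∃[ r ] 𝔄 (λ v → G v × 0# < f (l v) × Germ._∋_ 𝒢 r (l v))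
        germ-part 𝒢 strips = by-sign (sign p)
          where
          open Germ 𝒢 hiding (convex)
          by-sign : (∀ x → f x ≈ 0#) ⊎ ∃[ r ] ((∀ {x} → r ∋ x → 0# < f x) ⊎ (∀ {x} → r ∋ x → f x < 0#)) →
                    ∃[ r ] 𝔄 (λ v → G v × 0# < f (l v) × r ∋ l v)
          by-sign (inj₁ f≈0) = somewhere , 𝔄-∅ λ (_ , 0<f , _) → 0<⇒≉0 0<f (f≈0 _)
          by-sign (inj₂ (r , inj₁ pos)) = r , 𝔄-resp (λ (g , i) → g , pos i , i) (λ (g , _ , i) → g , i) (strips r)
          by-sign (inj₂ (r , inj₂ neg)) = r , 𝔄-∅ λ (_ , 0<f , i) → <-irrefl (<-trans 0<f (neg i))

        positive-part : 𝔄 (λ v → G v × 0# < f (l v) × 0# < l v)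
        positive-part =
          let r , far  = germ-part at-infinity far-strip
              s , near = germ-part at-zero near-strip
          in between-germs (λ v≋w → <-respʳ (polyX-cong p (cong v≋w))) r s far near

    polyX-reflect : ∀ {f} → PolyX f → PolyX (λ x → f (- x))
    polyX-reflect (nil f≈0) = nil λ x → f≈0 (- x)
    polyX-reflect (cons c p f≈) = cons c (polyX-neg (polyX-reflect p)) λ x →
      trans (f≈ (- x)) (+-congˡ (trans (sym (-‿distribˡ-* x _)) (-‿distribʳ-* x _)))

    neg-additive : ∀ {l} → Additive l → Additive (λ v → - l v)
    neg-additive a = record
      { cong     = λ e → -‿cong (Additive.cong a e)
      ; additive = λ v w → trans (-‿cong (Additive.additive a v w)) (sym (-‿+-comm _ _))
      }

    -- Split by the sign of `l`: the negative side is the positive side for `- l`, and on `l = 0`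
    -- the condition becomes `0# < f 0#`, which holds everywhere or nowhere.
    line : ∀ {G} → IsSemigroup G → ∀ {l} → Additive l → ∀ {f} → PolyX f → 𝔄 (λ v → G v × 0# < f (l v))
    line {G} G-semigroup {l} a {f} p = 𝔄-resp
      Sum.[ (λ (g , q , _) → g , q) , Sum.[ (λ (g , q , _) → g , <-respʳ (polyX-cong p (-‿involutive _)) q)
                                          , (λ ((g , e) , q) → g , <-respʳ (polyX-cong p (sym e)) q) ]′ ]′
      (λ {v} (g , q) → by-order (compare (l v) 0#) g q)
      (union (Slabs.positive-part G-semigroup a p)
      (union (Slabs.positive-part G-semigroup (neg-additive a) (polyX-reflect p))
             (intersection (Slabs.ray G-semigroup a (_≈ 0#) (λ a≈b a≈0 → trans (sym a≈b) a≈0)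
                              (λ a≈0 b≈0 → trans (+-cong a≈0 b≈0) (+-identityˡ 0#)))
                           (constant (compare (f 0#) 0#)))))
      where
      constant : Trichotomy (f 0#) 0# → 𝔄 (λ _ → 0# < f 0#)
      constant (gt q) = generator (record { resp-≋ = λ _ → id ; closed = λ q _ → q })
      constant (lt n) = 𝔄-∅ λ q → <-irrefl (<-trans q n)
      constant (eq z) = 𝔄-∅ λ q → 0<⇒≉0 q z
      by-order : ∀ {v} → Trichotomy (l v) 0# → G v → 0# < f (l v) →
        (G v × 0# < f (l v) × 0# < l v) ⊎ (G v × 0# < f (- (- l v)) × 0# < - l v) ⊎ ((G v × l v ≈ 0#) × 0# < f 0#)
      by-order (gt 0<l) g q = inj₁ (g , q , 0<l)
      by-order (lt l<0) g q = inj₂ (inj₁ (g , <-respʳ (polyX-cong p (sym (-‿involutive _))) q , neg-pos l<0))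
      by-order (eq l≈0) g q = inj₂ (inj₂ ((g , l≈0) , <-respʳ (polyX-cong p l≈0) q))

    product-cong : ∀ {n} {v w : Vector Carrier n} → (∀ i → v i ≈ w i) → product v ≈ product w
    product-cong {zero}  e = refl
    product-cong {suc n} e = *-cong (e zero) (product-cong (e ∘ suc))

    evaluate-cong : ∀ p {v w} → v ≋ w → ⟦ p ⟧ v ≈ ⟦ p ⟧ w
    evaluate-cong []            e = refl
    evaluate-cong ((c , α) ∷ p) e =
      +-cong (*-congˡ (product-cong λ i → ^-congˡ (α i) (e i))) (evaluate-cong p e)

    polyX-product : ∀ {n} {w : Carrier → Vector Carrier n} → (∀ i → PolyX (λ x → w x i)) → PolyX (λ x → product (w x))
    polyX-product {zero}  q = polyX-const 1#
    polyX-product {suc n} q = polyX-* (q zero) (polyX-product (q ∘ suc))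

    polyX-evaluate : ∀ p {w : Carrier → ℝᵈ} → (∀ i → PolyX (λ x → w x i)) → PolyX (λ x → ⟦ p ⟧ (w x))
    polyX-evaluate []            q = polyX-0
    polyX-evaluate ((c , α) ∷ p) q =
      polyX-+ (polyX-scale c (polyX-product λ i → polyX-^ (q i) (α i))) (polyX-evaluate p q)

    negate : Polynomial → Polynomial
    negate = List.map λ (c , α) → - c , α

    negate-evaluate : ∀ p v → ⟦ negate p ⟧ v ≈ - ⟦ p ⟧ v
    negate-evaluate []            v = sym -0#≈0#
    negate-evaluate ((c , α) ∷ p) v = trans (+-congˡ (negate-evaluate p v)) (trans (+-congʳ (sym (-‿distribˡ-* c _))) (-‿+-comm _ _))

    -- Each basic condition is a Boolean combination of strict positivity of `p` and of `negate p`.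
    semiAlgebraic⊆𝔄 : (∀ p → 𝔄 (λ v → 0# < ⟦ p ⟧ v)) → ∀ {S} → SemiAlgebraic S → 𝔄 S
    semiAlgebraic⊆𝔄 positive = go
      where
      neg<0 : ∀ p {v} → ⟦ p ⟧ v < 0# → 0# < ⟦ negate p ⟧ v
      neg<0 p n = <-respʳ (sym (negate-evaluate p _)) (neg-pos n)
      neg<0⁻¹ : ∀ p {v} → 0# < ⟦ negate p ⟧ v → ⟦ p ⟧ v < 0#
      neg<0⁻¹ p q = neg-pos⁻¹ (<-respʳ (negate-evaluate p _) q)
      not-negative : ∀ {a} → ¬ a < 0# → 0# ≤ a
      not-negative {a} ¬n with ≤-<-cases 0# a
      ... | inj₁ 0≤a = 0≤a
      ... | inj₂ a<0 = ⊥-elim (¬n a<0)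
      neither : ∀ {a} → ¬ 0# < a → ¬ a < 0# → a ≈ 0#
      neither {a} ¬p ¬n with compare a 0#
      ... | lt n = ⊥-elim (¬n n)
      ... | eq z = z
      ... | gt p = ⊥-elim (¬p p)
      condition : ∀ {S} → PolynomialCondition S → 𝔄 S
      condition (zero-set p) = 𝔄-resp
        (λ (¬p , ¬n) → neither ¬p λ n → ¬n (neg<0 p n))
        (λ z → (λ q → 0<⇒≉0 q z) , λ q → proj₂ (neg<0⁻¹ p q) z)
        (intersection (complement (positive p)) (complement (positive (negate p))))
      condition (nonneg-set p) = 𝔄-resp
        (λ ¬n → not-negative λ n → ¬n (neg<0 p n))
        (λ 0≤ q → <⇒≱ (neg<0⁻¹ p q) 0≤)
        (complement (positive (negate p)))
      condition (positive-set p) = positive p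
      go : ∀ {S} → SemiAlgebraic S → 𝔄 S
      go (generator c)      = condition c
      go (complement s)     = complement (go s)
      go (union s t)        = union (go s) (go t)
      go (intersection s t) = intersection (go s) (go t)
      go (resp-≐ e s)       = resp-≐ e (go s)

  open Sets

  -- Positivity sets on the line.

  module OneDimensional where
    open Euclidean ℝ 1

    whole : IsSemigroup (λ _ → ⊤)
    whole = record { resp-≋ = λ _ _ → tt ; closed = λ _ _ → tt }

    coordinate : Additive 1 (λ v → v zero)
    coordinate = record { cong = λ e → e zero ; additive = λ _ _ → refl }

    positive : ∀ p → 𝔄 (λ v → 0# < ⟦ p ⟧ v)
    positive p = 𝔄-resp 1
      (λ {v} (_ , q) → <-respʳ (evaluate-cong 1 p {λ _ → v zero} {v} λ { zero → refl }) q)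
      (λ {v} q → tt , <-respʳ (evaluate-cong 1 p {v} {λ _ → v zero} λ { zero → refl }) q)
      (line 1 whole coordinate (polyX-evaluate 1 p {λ x _ → x} λ _ → polyX-x))

  -- Positivity sets in the plane, by slopes on the two half-planes.

  module TwoDimensional where
    open Euclidean ℝ 2
    open IsSemigroup

    infix 5 _,,_
    _,,_ : Carrier → Carrier → ℝᵈ
    x ,, y = x Vector.∷ y Vector.∷ Vector.[]

    fst snd slope : ℝᵈ → Carrier
    fst v = v zero
    snd v = v (suc zero)
    slope v = snd v * recip (fst v)

    ,,-cong : ∀ {v x y} → fst v ≈ x → snd v ≈ y → v ≋ (x ,, y)
    ,,-cong e f zero       = e
    ,,-cong e f (suc zero) = f

    whole : IsSemigroup (λ _ → ⊤)
    whole = record { resp-≋ = λ _ _ → tt ; closed = λ _ _ → tt }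

    fst-additive : Additive 2 fst
    fst-additive = record { cong = λ e → e zero ; additive = λ _ _ → refl }

    snd-additive : Additive 2 snd
    snd-additive = record { cong = λ e → e (suc zero) ; additive = λ _ _ → refl }

    fst*slope : ∀ v → 0# < fst v → fst v * slope v ≈ snd v
    fst*slope v 0<x = trans (rotate (fst v) (snd v) (recip (fst v)))
      (trans (*-congˡ (*-recip (0<⇒≉0 0<x))) (*-identityʳ (snd v)))
      where
      rotate : ∀ x y r → x * (y * r) ≈ y * (x * r)
      rotate = solve 3 (λ x y r → x :* (y :* r) := y :* (x :* r)) refl

    slope-≤ : ∀ {k} v → 0# < fst v → k * fst v ≤ snd v → k ≤ slope v
    slope-≤ {k} v 0<x kx≤y = ≤-respˡ-≈ (trans (*-assoc k _ _) (trans (*-congˡ (*-recip (0<⇒≉0 0<x))) (*-identityʳ k)))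
      (0≤⇒≤ (*-nonNeg (≤⇒0≤ kx≤y) (<⇒≤ (0<recip 0<x))) ([y-z]x≈yx-zx (recip (fst v)) (snd v) (k * fst v)))

    slope-≥ : ∀ {k} v → 0# < fst v → snd v ≤ k * fst v → slope v ≤ k
    slope-≥ {k} v 0<x y≤kx = ≤-respʳ-≈ (trans (*-assoc k _ _) (trans (*-congˡ (*-recip (0<⇒≉0 0<x))) (*-identityʳ k)))
      (0≤⇒≤ (*-nonNeg (≤⇒0≤ y≤kx) (<⇒≤ (0<recip 0<x))) ([y-z]x≈yx-zx (recip (fst v)) (k * fst v) (snd v)))

    -- Cleared of denominators, the two excesses are `(k - m) * fst w` and `(k - m) * fst v`, where
    -- `m` and `k` are the slopes of `v` and `w`.
    mediant : ∀ v w → 0# < fst v → 0# < fst w → slope v ≤ slope w →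
              slope v ≤ slope (v ⊕ w) × slope (v ⊕ w) ≤ slope w
    mediant v w 0<v 0<w v≤w =
        slope-≤ (v ⊕ w) 0<v⊕w (0≤⇒≤ (*-nonNeg (≤⇒0≤ v≤w) (<⇒≤ 0<w))
          (trans (lower (slope v) (slope w) (fst v) (fst w)) (+-congʳ (+-cong (fst*slope v 0<v) (fst*slope w 0<w)))))
      , slope-≥ (v ⊕ w) 0<v⊕w (0≤⇒≤ (*-nonNeg (≤⇒0≤ v≤w) (<⇒≤ 0<v))
          (trans (upper (slope v) (slope w) (fst v) (fst w)) (+-congˡ (-‿cong (+-cong (fst*slope v 0<v) (fst*slope w 0<w))))))
      where
      0<v⊕w : 0# < fst v + fst w
      0<v⊕w = 0<+ 0<v (<⇒≤ 0<w)
      lower : ∀ m k x y → (k - m) * y ≈ (x * m + y * k) - m * (x + y)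
      lower = solve 4 (λ m k x y → (k :- m) :* y := (x :* m :+ y :* k) :- m :* (x :+ y)) refl
      upper : ∀ m k x y → (k - m) * x ≈ k * (x + y) - (x * m + y * k)
      upper = solve 4 (λ m k x y → (k :- m) :* x := k :* (x :+ y) :- (x :* m :+ y :* k)) refl

    Transport : Pred Plane 0ℓ → Pred ℝᵈ 0ℓ
    Transport W v = 0# < fst v × W (fst v , slope v)

    slope-cong : ∀ v w → 0# < fst v → v ≋ w → slope v ≈ slope w
    slope-cong v w 0<x v≋w = antisym
      (slope-≤ w 0<x′ (≤-reflexive (trans (*-comm _ _) (trans (*-congʳ (sym (v≋w zero))) (trans (fst*slope v 0<x) (v≋w (suc zero)))))))
      (slope-≥ w 0<x′ (≤-reflexive (trans (sym (v≋w (suc zero))) (trans (sym (fst*slope v 0<x)) (trans (*-congʳ (v≋w zero)) (*-comm _ _))))))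
      where
      0<x′ : 0# < fst w
      0<x′ = <-respʳ (v≋w zero) 0<x

    module _ {_⊑_ : Carrier → Carrier → Set} (⊑-reflexive : ∀ {m k} → m ≈ k → m ⊑ k)
             (⊑-total : ∀ m k → m ⊑ k ⊎ k ⊑ m)
             (⊑-mediant : ∀ v w → 0# < fst v → 0# < fst w → slope v ⊑ slope w → slope v ⊑ slope (v ⊕ w)) where

      -- A sum lies to the right of both summands and its slope follows the first of theirs in the
      -- order `⊑`, so membership spreads from the summand whose slope comes first.
      transport-up : ∀ {W} → UpSet _⊑_ W → IsSemigroup (Transport W)
      transport-up {W} up = record
        { resp-≋ = λ {v} {w} v≋w (0<x , q) → <-respʳ (v≋w zero) 0<x ,
            up q (≤-reflexive (v≋w zero)) (⊑-reflexive (slope-cong v w 0<x v≋w))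
        ; closed = λ {v} {w} (0<v , p) (0<w , q) → 0<+ 0<v (<⇒≤ 0<w) , by-order v w 0<v p 0<w q (⊑-total (slope v) (slope w))
        }
        where
        by-order : ∀ v w → 0# < fst v → W (fst v , slope v) → 0# < fst w → W (fst w , slope w) →
                   slope v ⊑ slope w ⊎ slope w ⊑ slope v → W (fst (v ⊕ w) , slope (v ⊕ w))
        by-order v w 0<v p 0<w q (inj₁ v⊑w) = up p (<⇒≤ (a+b>a 0<w)) (⊑-mediant v w 0<v 0<w v⊑w)
        by-order v w 0<v p 0<w q (inj₂ w⊑v) = up (up q (<⇒≤ (a+b>a 0<v)) (⊑-mediant w v 0<w 0<v w⊑v))
          (≤-reflexive (+-comm _ _))
          (⊑-reflexive (slope-cong (w ⊕ v) (v ⊕ w) (0<+ 0<w (<⇒≤ 0<v)) λ i → +-comm (w i) (v i)))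

    transport-NE : ∀ {W} → NorthEast W → IsSemigroup (Transport W)
    transport-NE = transport-up ≤-reflexive total λ v w 0<v 0<w v≤w → proj₁ (mediant v w 0<v 0<w v≤w)

    transport-NW : ∀ {W} → NorthWest W → IsSemigroup (Transport W)
    transport-NW = transport-up (λ e → ≤-reflexive (sym e)) (λ m k → total k m) λ v w 0<v 0<w w≤v →
      ≤-respˡ-≈ (slope-cong (w ⊕ v) (v ⊕ w) (0<+ 0<w (<⇒≤ 0<v)) λ i → +-comm (w i) (v i))
        (proj₂ (mediant w v 0<w 0<v w≤v))

    right-half : 𝔄 (λ v → 0# < fst v)
    right-half = 𝔄-resp 2 proj₂ (tt ,_) (Slabs.positive-ray 2 whole fst-additive)

    transport : ∀ {W} → 𝔐 W → 𝔄 (Transport W)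
    transport (generator (inj₁ ne)) = generator (transport-NE ne)
    transport (generator (inj₂ nw)) = generator (transport-NW nw)
    -- `Transport` has `x > 0` built in, so the complement must be cut back to the right half-plane.
    transport (complement s) = 𝔄-resp 2
      (λ (0<x , ¬w) → 0<x , λ w → ¬w (0<x , w)) (λ (0<x , ¬w) → 0<x , λ (_ , w) → ¬w w)
      (intersection right-half (complement (transport s)))
    transport (union s t) = 𝔄-resp 2
      Sum.[ (λ (0<x , w) → 0<x , inj₁ w) , (λ (0<x , w) → 0<x , inj₂ w) ]′
      (λ (0<x , w) → Sum.map (0<x ,_) (0<x ,_) w)
      (union (transport s) (transport t))
    transport (intersection s t) = 𝔄-resp 2
      (λ ((0<x , w) , (_ , w′)) → 0<x , w , w′) (λ (0<x , w , w′) → (0<x , w) , (0<x , w′))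
      (intersection (transport s) (transport t))
    transport (resp-≐ (f , g) s) = 𝔄-resp 2 (λ (0<x , w) → 0<x , f w) (λ (0<x , w) → 0<x , g w) (transport s)

    -- The substitution `y = x m`. A general `f` serves both sides: `f x = x` on the right, and
    -- `f x = - x` for the left half-plane after a point reflection.
    polyM-evaluate : ∀ p {f} → PolyX f → ∃[ n ] PolyM n (λ x m → ⟦ p ⟧ (f x ,, f x * m))
    polyM-evaluate []            _ = 0 , nil λ _ _ → refl
    polyM-evaluate ((c , α) ∷ p) {f} q =
      let n , rest = polyM-evaluate p q
      in (suc j) ℕ.⊔ n , polyM-+
           (polyM-≤ (ℕ.m≤m⊔n (suc j) n) (polyM-resp (λ x m → sym (term (f x) m)) (polyM-monomial
             (polyX-scale c (polyX-* (polyX-^ q i) (polyX-^ q j))) j)))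
           (polyM-≤ (ℕ.m≤n⊔m (suc j) n) rest)
      where
      i j : ℕ
      i = α zero
      j = α (suc zero)
      regroup : ∀ c s t u → c * (s * ((t * u) * 1#)) ≈ (c * (s * t)) * u
      regroup = solve 4 (λ c s t u → c :* (s :* ((t :* u) :* :1)) := (c :* (s :* t)) :* u) refl
      term : ∀ x m → evalTerm (c , α) (x ,, x * m) ≈ (c * (x ^ i * x ^ j)) * m ^ j
      term x m = trans (*-congˡ (*-congˡ (*-congʳ (^-distrib-* x m j)))) (regroup c (x ^ i) (x ^ j) (m ^ j))

    half-plane : ∀ {Φ : ℝᵈ → Carrier} {n F} → (∀ {v w} → v ≋ w → Φ v ≈ Φ w) → PolyM n F →
                 (∀ v → 0# < fst v → Φ v ≈ F (fst v) (slope v)) → 𝔄 (λ v → 0# < fst v × 0# < Φ v)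
    half-plane {Φ} {n} {F} Φ-cong p Φ≈F =
      let r , far  = Tame.positivity-set em ℝ at-infinity p
          s , near = Tame.positivity-set em ℝ at-zero p
      in 𝔄-resp 2 (λ (_ , q , 0<x) → 0<x , q) (λ (0<x , q) → tt , q , 0<x)
           (Slabs.between-germs 2 whole fst-additive (λ {v} {w} v≋w → <-respʳ (Φ-cong {v} {w} v≋w)) r s
             (part at-infinity r far) (part at-zero s near))
      where
      part : ∀ 𝒢 r → 𝔐 (λ (x , m) → Germ._∋_ 𝒢 r x × 0# < F x m) →
             𝔄 (λ v → ⊤ × 0# < Φ v × Germ._∋_ 𝒢 r (fst v))
      part 𝒢 r s = 𝔄-resp 2
        (λ {v} (0<x , i , q) → tt , <-respʳ (sym (Φ≈F v 0<x)) q , i)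
        (λ {v} (_ , q , i) → let 0<x = Germ.positive 𝒢 r i in 0<x , i , <-respʳ (Φ≈F v 0<x) q)
        (transport s)

    opposite : ℝᵈ → ℝᵈ
    opposite v i = - v i

    opposite-opposite : ∀ v → opposite (opposite v) ≋ v
    opposite-opposite v i = -‿involutive (v i)

    -- Point reflection is additive, so it carries semigroups to semigroups and the algebra to
    -- itself.
    reflect : ∀ {X} → 𝔄 X → 𝔄 (λ v → X (opposite v))
    reflect (generator s) = generator (record
      { resp-≋ = λ v≋w → s .resp-≋ (λ i → -‿cong (v≋w i))
      ; closed = λ {v} {w} x y → s .resp-≋ (λ i → -‿+-comm (v i) (w i)) (s .closed x y)
      })
    reflect (complement s)       = complement (reflect s)
    reflect (union s t)          = union (reflect s) (reflect t)
    reflect (intersection s t)   = intersection (reflect s) (reflect t)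
    reflect (resp-≐ (f , g) s)   = 𝔄-resp 2 f g (reflect s)

    axis : IsSemigroup (λ v → fst v ≈ 0#)
    axis = record
      { resp-≋ = λ v≋w e → trans (sym (v≋w zero)) e
      ; closed = λ e f → trans (+-cong e f) (+-identityˡ 0#)
      }

    -- The left half-plane is reflected onto the right one. On the axis, where no slope exists, the
    -- restriction is a polynomial in `y` and the one-variable argument applies to the semigroup
    -- `axis`.
    positive : ∀ p → 𝔄 (λ v → 0# < ⟦ p ⟧ v)
    positive p = 𝔄-resp 2
      (λ {v} → back {v})
      (λ {v} q → by-order {v} (compare (fst v) 0#) q)
      (union (half-plane (λ {v} {w} → evaluate-cong 2 p {v} {w}) (proj₂ (polyM-evaluate p polyX-x)) λ v 0<x →
                evaluate-cong 2 p (,,-cong {v} refl (sym (fst*slope v 0<x))))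
      (union (reflect (half-plane (λ {v} {w} v≋w → evaluate-cong 2 p {opposite v} {opposite w} λ i → -‿cong (v≋w i))
                (proj₂ (polyM-evaluate p (polyX-neg polyX-x))) λ v 0<x →
                evaluate-cong 2 p (,,-cong {opposite v} refl (trans (-‿cong (sym (fst*slope v 0<x))) (-‿distribˡ-* (fst v) (slope v))))))
             (line 2 axis snd-additive (polyX-evaluate 2 p {λ y → 0# ,, y} on-axis-polynomial))))
      where
      on-axis : ∀ v → fst v ≈ 0# → ⟦ p ⟧ v ≈ ⟦ p ⟧ (0# ,, snd v)
      on-axis v e = evaluate-cong 2 p (,,-cong {v} e refl)
      on-axis-polynomial : ∀ i → PolyX (λ y → (0# ,, y) i)
      on-axis-polynomial zero       = polyX-0
      on-axis-polynomial (suc zero) = polyX-x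
      back : ∀ {v} →
        (0# < fst v × 0# < ⟦ p ⟧ v) ⊎ (0# < - fst v × 0# < ⟦ p ⟧ (opposite (opposite v))) ⊎
        (fst v ≈ 0# × 0# < ⟦ p ⟧ (0# ,, snd v)) → 0# < ⟦ p ⟧ v
      back     (inj₁ (_ , q))        = q
      back {v} (inj₂ (inj₁ (_ , q))) = <-respʳ (evaluate-cong 2 p (opposite-opposite v)) q
      back {v} (inj₂ (inj₂ (e , q))) = <-respʳ (sym (on-axis v e)) q
      by-order : ∀ {v} → Trichotomy (fst v) 0# → 0# < ⟦ p ⟧ v →
        (0# < fst v × 0# < ⟦ p ⟧ v) ⊎ (0# < - fst v × 0# < ⟦ p ⟧ (opposite (opposite v))) ⊎
        (fst v ≈ 0# × 0# < ⟦ p ⟧ (0# ,, snd v))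
      by-order     (gt 0<x) q = inj₁ (0<x , q)
      by-order {v} (lt x<0) q =
        inj₂ (inj₁ (neg-pos x<0 , <-respʳ (sym (evaluate-cong 2 p (opposite-opposite v))) q))
      by-order {v} (eq x≈0) q = inj₂ (inj₂ (x≈0 , <-respʳ (on-axis v x≈0) q))

open import Relation.Binary.PropositionalEquality using (refl)

theorem8 : ExcludedMiddle 0ℓ → (ℝ : RealNumbers) (d : ℕ) → d ≡ 1 ⊎ d ≡ 2 →
    (S : Pred (Euclidean.ℝᵈ ℝ d) 0ℓ) →
    Euclidean.SemiAlgebraic ℝ d S → Euclidean.𝔄 ℝ d S
theorem8 em ℝ _ (inj₁ refl) _ = Assembly.Sets.semiAlgebraic⊆𝔄 em ℝ 1 (Assembly.OneDimensional.positive em ℝ)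
theorem8 em ℝ _ (inj₂ refl) _ = Assembly.Sets.semiAlgebraic⊆𝔄 em ℝ 2 (Assembly.TwoDimensional.positive em ℝ)
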